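{- Let $T$ be a basic trigraph in the class $\mathcal F$ that contains no odd prism and no antihole. Then: (1) $T$ is either complete or has an even pair; (2) if $T$ is favorable, then $T$ has an even pair disjoint from its switchable component.
   Context: A trigraph $T$ consists of a finite set $V(T)$ and a map $\theta:\binom{V(T)}{2}\to\{ -1,0,1\}$. Distinct $u,v$ are strongly adjacent if $\theta(uv)=1$, strongly antiadjacent if $\theta(uv)=-1$, semiadjacent (a switchable pair) if $\theta(uv)=0$; adjacent if $\theta(uv)\in\{0,1\}$, antiadjacent if $\theta(uv)\in\{0,-1\}$. $N(v)$ is the set of vertices adjacent to $v$. The complement $\overline T$ has adjacency $-\theta$. $T|X$ is the restriction to $X$, $T\setminus X=T|(V(T)\setminus X)$; $T$ contains $H$ if $H$ is isomorphic to some $T|X$. A clique (strong clique) is a set of pairwise adjacent (strongly adjacent) vertices; $T$ is complete if $V(T)$ is a clique; a stable set (strongly stable set) is a set of pairwise antiadjacent (strongly antiadjacent) vertices. The full realization of $T$ is the graph on $V(T)$ whose edges are the adjacent pairs. A path is a sequence $p_1,\dots,p_k$ of distinct vertices with $p_i,p_j$ adjacent when $|i-j|=1$ and antiadjacent when $|i-j|>1$; length $k-1$. A hole is a sequence $h_1,\dots,h_k$ ($k\ge5$) of distinct vertices, cyclically consecutive ones adjacent, other pairs antiadjacent; antipaths/antiholes are induced subtrigraphs whose complements are paths/holes of $\overline T$. $T$ is Berge if it has no odd hole and no odd antihole. An even pair is a strongly antiadjacent pair $\{u,v\}$ such that every path from $u$ to $v$ has even length. A prism in $T$ is an induced subtrigraph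 whose full realization is a prism: two disjoint triangles $\{a_1,a_2,a_3\},\{b_1,b_2,b_3\}$ and three vertex-disjoint paths (rungs) $P_i$ from $a_i$ to $b_i$, with no other edges; it is odd if all rungs have odd length. Basic trigraphs: $T$ is bipartite if $V(T)$ partitions into two strongly stable sets; $T$ is a line trigraph if its full realization is the line graph of a bipartite graph and every clique of size at least $3$ is a strong clique; $T$ is a doubled graph if it has a good partition, i.e. a partition $(X,Y)$ of $V(T)$ such that every component of $T|X$ and every anticomponent of $T|Y$ has at most two vertices (components/anticomponents are maximal sets that are connected in the graph of adjacent pairs / in the graph of antiadjacent pairs), no switchable pair is between $X$ and $Y$, and for every component $C_x$ of $T|X$ and anticomponent $C_y$ of $T|Y$, every vertex of $C_x\cup C_y$ is incident with at most one strong edge and at most one strong antiedge between $C_x$ and $C_y$. $T$ is basic if it is bipartite, the complement of a bipartite trigraph, a line trigraph, the complement of a line trigraph, or a doubled graph. $\Sigma(T)$ is the graph on $V(T)$ whose edges are the switchable pairs; a switchable component is a component of $\Sigma(T)$ with at least two vertices. $\mathcal F$ is the class of Berge trigraphs with at most one switchable component, having at most two edges, such that if it has one edge $xy$ then $N(x)\cap N(y)=\emptyset$ (small), and if it has two edges $vx,vy$ then $v$ is strongly antiadjacent to all vertices outside $\{v,x,y\}$, $x,y$ are strongly antiadjacent and $N(x)\cap N(y)=\{v\}$ (light). $D$ denotes the vertex set of the switchable component ($\emptyset$ if none); a pair is disjoint from the switchable component if it does not meet $D$. $T\in\mathcal F$ is favorable if $|V(T)|\ge5$, $T$ has a strongly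 antiadjacent pair disjoint from $D$, and, if $D=\{x,y\}$ is small, at least one of $T\setminus(D\cup N(x))$, $T\setminus(D\cup N(y))$ is not a clique. -}

module Defs where

open import Data.Nat using (ℕ; zero; suc; _+_; _*_; _≤_; _<_; _%_)
open import Data.Fin using (Fin; toℕ) renaming (zero to fzero; suc to fsuc)
open import Data.Fin.Subset using (Subset; ∣_∣) renaming (_∈_ to _∈ₛ_)
open import Data.Bool using (Bool; true; false)
open import Data.Product using (Σ; ∃; ∃-syntax; _×_; _,_; proj₁; proj₂)
open import Data.Sum using (_⊎_)
open import Data.Empty using (⊥)
import Data.Unit
open import Relation.Nullary using (¬_)
open import Relation.Binary.PropositionalEquality using (_≡_; _≢_; sym; cong)
open import Relation.Binary.Construct.Closure.ReflexiveTransitive using (Star)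

-- Trigraphs on vertex set Fin n.
-- θ is given as a symmetric function; its values on the diagonal (u,u)
-- are meaningless and every notion below only looks at distinct pairs.

data Adj : Set where
  strong : Adj
  semi   : Adj
  anti   : Adj

negAdj : Adj → Adj
negAdj strong = anti
negAdj semi   = semi
negAdj anti   = strong

record Trigraph (n : ℕ) : Set where
  field
    θ     : Fin n → Fin n → Adj
    θ-sym : ∀ u v → θ u v ≡ θ v u
open Trigraph public

complement : ∀ {n} → Trigraph n → Trigraph n
complement T = record { θ = λ u v → negAdj (θ T u v)
                      ; θ-sym = λ u v → cong negAdj (θ-sym T u v) }

module _ {n : ℕ} (T : Trigraph n) where

  StronglyAdjacent : Fin n → Fin n → Set
  StronglyAdjacent u v = u ≢ v × θ T u v ≡ strong

  StronglyAntiadjacent : Fin n → Fin n → Set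
  StronglyAntiadjacent u v = u ≢ v × θ T u v ≡ anti

  Semiadjacent : Fin n → Fin n → Set
  Semiadjacent u v = u ≢ v × θ T u v ≡ semi

  Adjacent : Fin n → Fin n → Set
  Adjacent u v = u ≢ v × (θ T u v ≡ strong ⊎ θ T u v ≡ semi)

  Antiadjacent : Fin n → Fin n → Set
  Antiadjacent u v = u ≢ v × (θ T u v ≡ semi ⊎ θ T u v ≡ anti)

  IsClique : (Fin n → Set) → Set
  IsClique S = ∀ u v → S u → S v → u ≢ v → Adjacent u v

  IsComplete : Set
  IsComplete = ∀ u v → u ≢ v → Adjacent u v

  -- sets of vertices as finite subsets (needed when counting)
  IsCliqueₛ : Subset n → Set
  IsCliqueₛ S = ∀ u v → u ∈ₛ S → v ∈ₛ S → u ≢ v → Adjacent u v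

  IsStrongCliqueₛ : Subset n → Set
  IsStrongCliqueₛ S = ∀ u v → u ∈ₛ S → v ∈ₛ S → u ≢ v → StronglyAdjacent u v

  record IsPath {k : ℕ} (p : Fin k → Fin n) : Set where
    field
      inj  : ∀ i j → p i ≡ p j → i ≡ j
      adj  : ∀ i j → suc (toℕ i) ≡ toℕ j → Adjacent (p i) (p j)
      nonadj : ∀ i j → suc (toℕ i) < toℕ j → Antiadjacent (p i) (p j)

  CycConsec : (k : ℕ) → Fin k → Fin k → Set
  CycConsec k i j = suc (toℕ i) ≡ toℕ j ⊎ suc (toℕ j) ≡ toℕ i
                  ⊎ (toℕ i ≡ 0 × suc (toℕ j) ≡ k) ⊎ (toℕ j ≡ 0 × suc (toℕ i) ≡ k)

  record IsHole {k : ℕ} (h : Fin k → Fin n) : Set where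
    field
      len  : 5 ≤ k
      inj  : ∀ i j → h i ≡ h j → i ≡ j
      adj  : ∀ i j → i ≢ j → CycConsec k i j → Adjacent (h i) (h j)
      nonadj : ∀ i j → i ≢ j → ¬ CycConsec k i j → Antiadjacent (h i) (h j)

Odd : ℕ → Set
Odd m = m % 2 ≡ 1

Even : ℕ → Set
Even m = m % 2 ≡ 0

IsAntihole : ∀ {n} (T : Trigraph n) {k : ℕ} → (Fin k → Fin n) → Set
IsAntihole T h = IsHole (complement T) h

Berge : ∀ {n} → Trigraph n → Set
Berge {n} T = (∀ k (h : Fin k → Fin n) → IsHole T h → ¬ Odd k)
            × (∀ k (h : Fin k → Fin n) → IsAntihole T h → ¬ Odd k)

NoAntihole : ∀ {n} → Trigraph n → Set
NoAntihole {n} T = ∀ k (h : Fin k → Fin n) → ¬ IsAntihole T h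

last : (k : ℕ) → Fin (suc k)
last zero    = fzero
last (suc k) = fsuc (last k)

PathFromTo : ∀ {n} → Trigraph n → Fin n → Fin n → (k : ℕ) → (Fin (suc k) → Fin n) → Set
PathFromTo T u v k p = IsPath T p × p fzero ≡ u × p (last k) ≡ v

IsEvenPair : ∀ {n} → Trigraph n → Fin n → Fin n → Set
IsEvenPair {n} T u v = StronglyAntiadjacent T u v
  × (∀ k (p : Fin (suc k) → Fin n) → PathFromTo T u v k p → Even k)

HasEvenPair : ∀ {n} → Trigraph n → Set
HasEvenPair T = ∃[ u ] ∃[ v ] IsEvenPair T u v

-- prisms: an induced subtrigraph whose full realization is a prism.
-- Rung i (i : Fin 3) has length l i ≥ 1 and vertices indexed by
-- Fin (suc (l i)); position 0 is a_i, position l i is b_i.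

PIdx : (Fin 3 → ℕ) → Set
PIdx l = Σ (Fin 3) (λ i → Fin (suc (l i)))

PrismEdge : (l : Fin 3 → ℕ) → PIdx l → PIdx l → Set
PrismEdge l (i , x) (j , y) =
    (i ≡ j × (suc (toℕ x) ≡ toℕ y ⊎ suc (toℕ y) ≡ toℕ x))
  ⊎ (i ≢ j × toℕ x ≡ 0 × toℕ y ≡ 0)
  ⊎ (i ≢ j × toℕ x ≡ l i × toℕ y ≡ l j)

record IsPrism {n} (T : Trigraph n) (l : Fin 3 → ℕ) (f : PIdx l → Fin n) : Set where
  field
    rung≥1 : ∀ i → 1 ≤ l i
    inj    : ∀ p q → f p ≡ f q → p ≡ q
    edge   : ∀ p q → p ≢ q → PrismEdge l p q → Adjacent T (f p) (f q)
    nonedge : ∀ p q → p ≢ q → ¬ PrismEdge l p q → StronglyAntiadjacent T (f p) (f q)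

NoOddPrism : ∀ {n} → Trigraph n → Set
NoOddPrism {n} T = ∀ (l : Fin 3 → ℕ) (f : PIdx l → Fin n) →
  IsPrism T l f → ¬ (∀ i → Odd (l i))

Bipartite : ∀ {n} → Trigraph n → Set
Bipartite {n} T = Σ (Fin n → Bool) λ c →
  ∀ (u v : Fin n) → u ≢ v → c u ≡ c v → StronglyAntiadjacent T u v

-- full realization is the line graph of a bipartite graph H with parts
-- Fin a and Fin b: vertex u of T is the edge (proj₁ (e u), proj₂ (e u)) of H,
-- e is injective (distinct vertices are distinct edges, H simple), and two
-- distinct vertices are adjacent iff the edges share an end;
-- moreover every clique of size at least 3 is a strong clique.
LineTrigraph : ∀ {n} → Trigraph n → Set
LineTrigraph {n} T =
  (Σ ℕ λ a → Σ ℕ λ b → Σ (Fin n → Fin a × Fin b) λ e →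
      (∀ u v → e u ≡ e v → u ≡ v)
    × (∀ u v → u ≢ v → Adjacent T u v → (proj₁ (e u) ≡ proj₁ (e v) ⊎ proj₂ (e u) ≡ proj₂ (e v)))
    × (∀ u v → u ≢ v → (proj₁ (e u) ≡ proj₁ (e v) ⊎ proj₂ (e u) ≡ proj₂ (e v)) → Adjacent T u v))
  × (∀ (S : Subset n) → IsCliqueₛ T S → 3 ≤ ∣ S ∣ → IsStrongCliqueₛ T S)

-- doubled graphs.  A partition (X,Y) is given by c : Fin n → Bool
-- (X = c⁻¹ true, Y = c⁻¹ false).
module _ {n : ℕ} (T : Trigraph n) (c : Fin n → Bool) where

  EdgeX : Fin n → Fin n → Set
  EdgeX u v = c u ≡ true × c v ≡ true × Adjacent T u v

  AntiEdgeY : Fin n → Fin n → Set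
  AntiEdgeY u v = c u ≡ false × c v ≡ false × Antiadjacent T u v

  InComponentX : Fin n → Fin n → Set
  InComponentX x z = Star EdgeX x z

  InAnticomponentY : Fin n → Fin n → Set
  InAnticomponentY y z = Star AntiEdgeY y z

  record IsGoodPartition : Set where
    field
      compX : ∀ x u v w → c x ≡ true →
              InComponentX x u → InComponentX x v → InComponentX x w →
              u ≢ v → u ≢ w → v ≢ w → ⊥
      compY : ∀ y u v w → c y ≡ false →
              InAnticomponentY y u → InAnticomponentY y v → InAnticomponentY y w →
              u ≢ v → u ≢ w → v ≢ w → ⊥
      noSemi : ∀ u v → c u ≡ true → c v ≡ false → ¬ Semiadjacent T u v
      strongX : ∀ x y z w₁ w₂ → c x ≡ true → c y ≡ false →
                InComponentX x z → InAnticomponentY y w₁ → InAnticomponentY y w₂ →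
                StronglyAdjacent T z w₁ → StronglyAdjacent T z w₂ → w₁ ≡ w₂
      antiX   : ∀ x y z w₁ w₂ → c x ≡ true → c y ≡ false →
                InComponentX x z → InAnticomponentY y w₁ → InAnticomponentY y w₂ →
                StronglyAntiadjacent T z w₁ → StronglyAntiadjacent T z w₂ → w₁ ≡ w₂
      strongY : ∀ x y z w₁ w₂ → c x ≡ true → c y ≡ false →
                InAnticomponentY y z → InComponentX x w₁ → InComponentX x w₂ →
                StronglyAdjacent T z w₁ → StronglyAdjacent T z w₂ → w₁ ≡ w₂
      antiY   : ∀ x y z w₁ w₂ → c x ≡ true → c y ≡ false →
                InAnticomponentY y z → InComponentX x w₁ → InComponentX x w₂ →
                StronglyAntiadjacent T z w₁ → StronglyAntiadjacent T z w₂ → w₁ ≡ w₂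

DoubledGraph : ∀ {n} → Trigraph n → Set
DoubledGraph {n} T = Σ (Fin n → Bool) λ c → IsGoodPartition T c

Basic : ∀ {n} → Trigraph n → Set
Basic T = Bipartite T ⊎ Bipartite (complement T) ⊎ LineTrigraph T
        ⊎ LineTrigraph (complement T) ⊎ DoubledGraph T

-- the class F.  Since T has at most one switchable component and it has
-- at most two edges, the set of switchable pairs is empty, a single pair
-- xy (which must be small), or two pairs vx, vy with x ≠ y (light).

module _ {n : ℕ} (T : Trigraph n) where

  OnlySemi1 : Fin n → Fin n → Set
  OnlySemi1 a b = ∀ u v → Semiadjacent T u v → (u ≡ a × v ≡ b) ⊎ (u ≡ b × v ≡ a)

  data SwitchStructure : Set where
    noSwitch : (∀ u v → ¬ Semiadjacent T u v) → SwitchStructure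
    small    : (x y : Fin n) → Semiadjacent T x y → OnlySemi1 x y →
               (∀ w → Adjacent T x w → Adjacent T y w → ⊥) →
               SwitchStructure
    light    : (v x y : Fin n) → x ≢ y → Semiadjacent T v x → Semiadjacent T v y →
               (∀ a b → Semiadjacent T a b →
                  ((a ≡ v × b ≡ x) ⊎ (a ≡ x × b ≡ v)) ⊎ ((a ≡ v × b ≡ y) ⊎ (a ≡ y × b ≡ v))) →
               (∀ w → w ≢ v → w ≢ x → w ≢ y → StronglyAntiadjacent T v w) →
               StronglyAntiadjacent T x y →
               (∀ w → Adjacent T x w → Adjacent T y w → w ≡ v) →
               SwitchStructure

  InF : Set
  InF = Berge T × SwitchStructure

  InD : InF → Fin n → Set
  InD (_ , noSwitch _) w = ⊥
  InD (_ , small x y _ _ _) w = w ≡ x ⊎ w ≡ y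
  InD (_ , light v x y _ _ _ _ _ _ _) w = w ≡ v ⊎ w ≡ x ⊎ w ≡ y

  RestCliqueSmall : Fin n → Fin n → Fin n → Set
  RestCliqueSmall x y z =
    IsClique T (λ w → w ≢ x × w ≢ y × ¬ Adjacent T z w)

  SmallCondition : InF → Set
  SmallCondition (_ , noSwitch _) = Data.Unit.⊤
  SmallCondition (_ , small x y _ _ _) =
    ¬ RestCliqueSmall x y x ⊎ ¬ RestCliqueSmall x y y
  SmallCondition (_ , light _ _ _ _ _ _ _ _ _ _) = Data.Unit.⊤

  Favorable : InF → Set
  Favorable F = 5 ≤ n
    × (∃[ u ] ∃[ v ] (StronglyAntiadjacent T u v × ¬ InD F u × ¬ InD F v))
    × SmallCondition F

  HasEvenPairDisjoint : InF → Set
  HasEvenPairDisjoint F = ∃[ u ] ∃[ v ] (IsEvenPair T u v × ¬ InD F u × ¬ InD F v)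

{-# OPTIONS --safe #-}
-- In the class F a semiadjacent pair has no common neighbour, which makes switchable pairs harmless;
-- the five basic classes are then treated separately.
--
-- Bipartite: two vertices of the same colour form an even pair.
--
-- Complement of bipartite: paths have length at most three, so a bisimplicial edge of the bipartite
-- graph of strongly antiadjacent pairs is an even pair. As that graph has no long hole, such an edge
-- exists: take a connected set C that is maximal subject to some edge avoiding C and N(C), and find the
-- edge in the rest by induction; two vertices of N(C) on opposite sides are joined, by a hole argument.
--
-- Line trigraph of a bipartite host graph H: edges u v and u′ v′ of H (u, u′ on the same side) form an even
-- pair iff H has no path from u to u′ avoiding v, v′ and none from v to v′ avoiding u, u′. This holds when
-- enough of the four ends have only leaves as further neighbours. Since an odd prism is a theta of H
-- with both branch vertices on the same side, a connected set attached to a cycle of H is attached to at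
-- most one vertex of each side; hence, as long as no even pair is visible, one can pass to a smaller
-- component hanging off a new cycle, a process that stops.
--
-- Complement of a line trigraph: an induced path of the complement whose first edge is not an even
-- pair of T can be rerouted into a longer one.
--
-- Doubled graphs: two antiadjacent pairs in Y and an edge in X give an antihole on six vertices, and the
-- remaining configurations are small.

module Submission where

open import Defs
open import Data.Nat using (ℕ; zero; suc; _+_; _≤_; _<_; z≤n; s≤s)
import Data.Nat.Properties as ℕₚ
open import Data.Nat.Induction using (<-wellFounded)
open import Induction.WellFounded using (Acc; acc)
open import Data.Fin using (Fin; toℕ) renaming (zero to fzero; suc to fsuc)
import Data.Fin as Fin
import Data.Fin.Properties as Finₚ
open import Data.Fin.Subset using (Subset; ∣_∣; _∪_; ⁅_⁆) renaming (_∈_ to _∈ₛ_)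
import Data.Fin.Subset.Properties as Subsetₚ
open import Data.Bool using (Bool; true; false; not; if_then_else_)
import Data.Bool.Properties as Boolₚ
open import Data.Product using (∃; ∃-syntax; _×_; _,_; proj₁; proj₂)
open import Data.Sum using (_⊎_; inj₁; inj₂; [_,_]′)
import Data.Sum as Sum
import Data.Sum.Properties as Sumₚ
open import Data.Empty using (⊥; ⊥-elim)
open import Data.Unit using (⊤; tt)
open import Data.List using (List; []; _∷_; _++_; [_]; length; lookup; map; filter; allFin; reverse)
import Data.List.Properties as Listₚ
open import Data.List.Membership.Propositional using (_∈_; _∉_; find; lose)
open import Data.List.Membership.Propositional.Properties
  using (∈-++⁺ˡ; ∈-++⁺ʳ; ∈-++⁻; ∈-map⁺; ∈-allFin; ∈-∃++; ∈-filter⁺; ∈-filter⁻; ∈-lookup)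
import Data.List.Membership.DecPropositional as DecMembership
open import Data.List.Relation.Unary.Any using (Any; here; there; index)
import Data.List.Relation.Unary.Any as Any
import Data.List.Relation.Unary.Any.Properties as Anyₚ
open import Data.List.Relation.Unary.All using (All; []; _∷_)
import Data.List.Relation.Unary.All as All
import Data.List.Relation.Unary.All.Properties as Allₚ
open import Data.List.Relation.Unary.AllPairs using ([]; _∷_)
open import Data.List.Relation.Unary.Unique.Propositional using (Unique)
import Data.List.Relation.Unary.Unique.Propositional.Properties as Uniqueₚ
open import Data.List.Relation.Binary.Permutation.Propositional using (_↭_; ↭-refl; ↭-sym; ↭⇒↭ₛ)
open import Data.List.Relation.Binary.Permutation.Propositional.Properties
  using (++-comm; ↭-reverse; ∈-resp-↭)
import Data.List.Relation.Binary.Permutation.Setoid.Properties as Permutationₛ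
open import Relation.Nullary using (¬_; Dec; yes; no; does)
open import Relation.Nullary.Decidable
  using (_×-dec_; ¬?; _⊎-dec_; _→-dec_; map′; dec-true; dec-false; decidable-stable)
open import Relation.Binary.Definitions using (DecidableEquality; tri<; tri≈; tri>)
open import Relation.Binary.Construct.Closure.ReflexiveTransitive using (_◅_) renaming (ε to done)
open import Relation.Binary.PropositionalEquality
  using (_≡_; _≢_; refl; sym; trans; cong; cong₂; subst; setoid)
open import Function using (_∘_; case_of_; id)

-- Basic facts and bipartite trigraphs

-- Parity drives the line case. A path of the host graph with m inner vertices has m + 1 edges, and
-- these form a path of length m in the line graph; so branch vertices on one side give three odd
-- rungs, and an odd path of `T` becomes a host walk with both ends on one side. The obstacle is the
-- second claim, which asks for a pair away from the switchable component. The descent therefore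
-- carries a set `Bad` of forbidden edges, keeps all their ends inside an explored set `Z`, and
-- always holds one edge `s z` outside `Bad`, ready to be half of the pair. Every step enlarges `Z`,
-- so the number of vertices outside `Z` decreases. In the host graph both kinds of switchable
-- component are paths with one or two inner vertices that have no neighbours off the path. The
-- condition on small components enters where all remaining edges sit at the ends of that path or at
-- one further vertex joined to both ends.

covers⇒≤ : ∀ {n} (xs : List (Fin n)) → (∀ w → w ∈ xs) → n ≤ length xs
covers⇒≤ xs all∈ = Finₚ.injective⇒≤ {f = λ w → index (all∈ w)}
  (λ {v} {w} eq → trans (Anyₚ.lookup-index (all∈ v))
    (trans (cong (lookup xs) eq) (sym (Anyₚ.lookup-index (all∈ w)))))

_≟Adj_ : (p q : Adj) → Dec (p ≡ q)
strong ≟Adj strong = yes refl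
strong ≟Adj semi   = no λ ()
strong ≟Adj anti   = no λ ()
semi   ≟Adj strong = no λ ()
semi   ≟Adj semi   = yes refl
semi   ≟Adj anti   = no λ ()
anti   ≟Adj strong = no λ ()
anti   ≟Adj semi   = no λ ()
anti   ≟Adj anti   = yes refl

alternate : ℕ → Bool → Bool
alternate zero    c = c
alternate (suc k) c = alternate k (not c)

not≢ : ∀ c → not c ≢ c
not≢ false ()
not≢ true  ()

≢⇒≡not : ∀ {c d : Bool} → c ≢ d → d ≡ not c
≢⇒≡not {false} {false} c≢d = ⊥-elim (c≢d refl)
≢⇒≡not {false} {true}  c≢d = refl
≢⇒≡not {true}  {false} c≢d = refl
≢⇒≡not {true}  {true}  c≢d = ⊥-elim (c≢d refl)

≢∧≢⇒≡ : ∀ {c d e : Bool} → c ≢ d → e ≢ d → c ≡ e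
≢∧≢⇒≡ c≢d e≢d = trans (≢⇒≡not (c≢d ∘ sym)) (sym (≢⇒≡not (e≢d ∘ sym)))

even-or-odd : ∀ k c → (Even k × alternate k c ≡ c) ⊎ (Odd k × alternate k c ≡ not c)
even-or-odd zero          c = inj₁ (refl , refl)
even-or-odd (suc zero)    c = inj₂ (refl , refl)
even-or-odd (suc (suc k)) c rewrite Boolₚ.not-involutive c = even-or-odd k c

alternate-≡⇒Even : ∀ k c → alternate k c ≡ c → Even k
alternate-≡⇒Even k c eq with even-or-odd k c
... | inj₁ (even , _) = even
... | inj₂ (_ , eq′)  = ⊥-elim (not≢ c (trans (sym eq′) eq))

toℕ-last : ∀ k → toℕ (last k) ≡ k
toℕ-last zero    = refl
toℕ-last (suc k) = cong suc (toℕ-last k)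

module _ {n : ℕ} (T : Trigraph n) where

  Adjacent-sym : ∀ {u v} → Adjacent T u v → Adjacent T v u
  Adjacent-sym {u} {v} (u≢v , p) rewrite θ-sym T u v = u≢v ∘ sym , p

  Antiadjacent-sym : ∀ {u v} → Antiadjacent T u v → Antiadjacent T v u
  Antiadjacent-sym {u} {v} (u≢v , p) rewrite θ-sym T u v = u≢v ∘ sym , p

  StronglyAntiadjacent-sym : ∀ {u v} → StronglyAntiadjacent T u v → StronglyAntiadjacent T v u
  StronglyAntiadjacent-sym {u} {v} (u≢v , p) = u≢v ∘ sym , trans (θ-sym T v u) p

  Semiadjacent-sym : ∀ {u v} → Semiadjacent T u v → Semiadjacent T v u
  Semiadjacent-sym {u} {v} (u≢v , p) = u≢v ∘ sym , trans (θ-sym T v u) p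

  semi⇒adj : ∀ {u v} → Semiadjacent T u v → Adjacent T u v
  semi⇒adj (u≢v , p) = u≢v , inj₂ p

  semi⇒antiadj : ∀ {u v} → Semiadjacent T u v → Antiadjacent T u v
  semi⇒antiadj (u≢v , p) = u≢v , inj₁ p

  strongAnti⇒antiadj : ∀ {u v} → StronglyAntiadjacent T u v → Antiadjacent T u v
  strongAnti⇒antiadj (u≢v , p) = u≢v , inj₂ p

  adj∧antiadj⇒semi : ∀ {u v} → Adjacent T u v → Antiadjacent T u v → Semiadjacent T u v
  adj∧antiadj⇒semi (u≢v , inj₂ p) _ = u≢v , p
  adj∧antiadj⇒semi (u≢v , inj₁ p) (_ , inj₁ q) = u≢v , q
  adj∧antiadj⇒semi (u≢v , inj₁ p) (_ , inj₂ q) = case trans (sym p) q of λ ()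

  adj⇒¬strongAnti : ∀ {u v} → Adjacent T u v → ¬ StronglyAntiadjacent T u v
  adj⇒¬strongAnti (_ , inj₁ p) (_ , q) = case trans (sym p) q of λ ()
  adj⇒¬strongAnti (_ , inj₂ p) (_ , q) = case trans (sym p) q of λ ()

  adj-or-strongAnti : ∀ {u v} → u ≢ v → Adjacent T u v ⊎ StronglyAntiadjacent T u v
  adj-or-strongAnti {u} {v} u≢v with θ T u v in eq
  ... | strong = inj₁ (u≢v , inj₁ refl)
  ... | semi   = inj₁ (u≢v , inj₂ refl)
  ... | anti   = inj₂ (u≢v , refl)

  ¬adj⇒strongAnti : ∀ {u v} → u ≢ v → ¬ Adjacent T u v → StronglyAntiadjacent T u v
  ¬adj⇒strongAnti u≢v ¬adj = [ ⊥-elim ∘ ¬adj , id ]′ (adj-or-strongAnti u≢v)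

  ¬antiadj⇒adj : ∀ {u v} → u ≢ v → ¬ Antiadjacent T u v → Adjacent T u v
  ¬antiadj⇒adj u≢v ¬anti = [ id , ⊥-elim ∘ ¬anti ∘ strongAnti⇒antiadj ]′ (adj-or-strongAnti u≢v)

  ¬adj⇒antiadj : ∀ {u v} → u ≢ v → ¬ Adjacent T u v → Antiadjacent T u v
  ¬adj⇒antiadj u≢v ¬adj = strongAnti⇒antiadj (¬adj⇒strongAnti u≢v ¬adj)

  adjacent? : ∀ u v → Dec (Adjacent T u v)
  adjacent? u v = ¬? (u Finₚ.≟ v) ×-dec ((θ T u v ≟Adj strong) ⊎-dec (θ T u v ≟Adj semi))

  strongAnti? : ∀ u v → Dec (StronglyAntiadjacent T u v)
  strongAnti? u v = ¬? (u Finₚ.≟ v) ×-dec (θ T u v ≟Adj anti)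

  antiadjacent? : ∀ u v → Dec (Antiadjacent T u v)
  antiadjacent? u v = ¬? (u Finₚ.≟ v) ×-dec ((θ T u v ≟Adj semi) ⊎-dec (θ T u v ≟Adj anti))

  complete-or-strongAnti : IsComplete T ⊎ (∃[ u ] ∃[ v ] StronglyAntiadjacent T u v)
  complete-or-strongAnti with Finₚ.any? (λ u → Finₚ.any? (strongAnti? u))
  ... | yes p = inj₂ p
  ... | no ¬p = inj₁ λ u v u≢v → [ id , (λ s → ⊥-elim (¬p (u , v , s))) ]′ (adj-or-strongAnti u≢v)

  -- In the light case one of the two vertices is the centre, whose only neighbours are `x` and `y`;
  -- a common neighbour would be the other of these, and `x`, `y` are strongly antiadjacent.
  semi-no-common-neighbour : SwitchStructure T → ∀ {u v w} →
    Semiadjacent T u v → Adjacent T u w → Adjacent T v w → ⊥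
  semi-no-common-neighbour (noSwitch none) s _ _ = none _ _ s
  semi-no-common-neighbour (small x y _ only none) {u} {v} {w} s uw vw with only u v s
  ... | inj₁ (refl , refl) = none w uw vw
  ... | inj₂ (refl , refl) = none w vw uw
  semi-no-common-neighbour (light c x y x≢y cx cy only iso xy none) {u} {v} {w} s uw vw with only u v s
  ... | inj₁ (inj₁ (refl , refl)) = case w Finₚ.≟ y of λ where
          (yes refl) → adj⇒¬strongAnti vw xy
          (no w≢y) → adj⇒¬strongAnti uw (iso w (proj₁ uw ∘ sym) (proj₁ vw ∘ sym) w≢y)
  ... | inj₁ (inj₂ (refl , refl)) = case w Finₚ.≟ y of λ where
          (yes refl) → adj⇒¬strongAnti uw xy
          (no w≢y) → adj⇒¬strongAnti vw (iso w (proj₁ vw ∘ sym) (proj₁ uw ∘ sym) w≢y)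
  ... | inj₂ (inj₁ (refl , refl)) = case w Finₚ.≟ x of λ where
          (yes refl) → adj⇒¬strongAnti (Adjacent-sym vw) xy
          (no w≢x) → adj⇒¬strongAnti uw (iso w (proj₁ uw ∘ sym) w≢x (proj₁ vw ∘ sym))
  ... | inj₂ (inj₂ (refl , refl)) = case w Finₚ.≟ x of λ where
          (yes refl) → adj⇒¬strongAnti (Adjacent-sym uw) xy
          (no w≢x) → adj⇒¬strongAnti vw (iso w (proj₁ vw ∘ sym) w≢x (proj₁ uw ∘ sym))

  path-tail : ∀ {k} {p : Fin (suc k) → Fin n} → IsPath T p → IsPath T (p ∘ fsuc)
  path-tail P = record
    { inj    = λ i j eq → Finₚ.suc-injective (IsPath.inj P (fsuc i) (fsuc j) eq)
    ; adj    = λ i j eq → IsPath.adj P (fsuc i) (fsuc j) (cong suc eq)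
    ; nonadj = λ i j lt → IsPath.nonadj P (fsuc i) (fsuc j) (s≤s lt)
    }

  -- Lengths 0 and 2 are even, and a path of length 1 would make its strongly antiadjacent ends
  -- adjacent.
  long-paths⇒evenPair : ∀ {u v} → StronglyAntiadjacent T u v →
    (∀ k p → IsPath T p → p fzero ≡ u → p (last (3 + k)) ≡ v → Even (3 + k)) → IsEvenPair T u v
  long-paths⇒evenPair uv long = uv , λ where
    zero p _ → refl
    (suc zero) p (P , refl , refl) → ⊥-elim (adj⇒¬strongAnti (IsPath.adj P fzero (fsuc fzero) refl) uv)
    (suc (suc zero)) p _ → refl
    (suc (suc (suc k))) p (P , p≡u , p≡v) → long k p P p≡u p≡v

  RestCliqueSmall-or-pair : ∀ x y z → RestCliqueSmall T x y z ⊎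
    (∃[ u ] ∃[ v ] (StronglyAntiadjacent T u v
      × (u ≢ x × u ≢ y × ¬ Adjacent T z u) × (v ≢ x × v ≢ y × ¬ Adjacent T z v)))
  RestCliqueSmall-or-pair x y z with
    Finₚ.any? (λ u → Finₚ.any? (λ v → strongAnti? u v ×-dec out? u ×-dec out? v))
    where out? = λ u → ¬? (u Finₚ.≟ x) ×-dec ¬? (u Finₚ.≟ y) ×-dec ¬? (adjacent? z u)
  ... | yes p = inj₂ p
  ... | no ¬p = inj₁ λ u v pu pv u≢v →
        [ id , (λ s → ⊥-elim (¬p (u , v , s , pu , pv))) ]′ (adj-or-strongAnti u≢v)

  Conclusion : InF T → Set
  Conclusion F = (IsComplete T ⊎ HasEvenPair T) × (Favorable T F → HasEvenPairDisjoint T F)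

  inD? : ∀ F w → Dec (InD T F w)
  inD? (_ , noSwitch _) w = no λ ()
  inD? (_ , small x y _ _ _) w = (w Finₚ.≟ x) ⊎-dec (w Finₚ.≟ y)
  inD? (_ , light v x y _ _ _ _ _ _ _) w = (w Finₚ.≟ v) ⊎-dec ((w Finₚ.≟ x) ⊎-dec (w Finₚ.≟ y))

  module _ (c : Fin n → Bool) (adj⇒≢ : ∀ {u v} → Adjacent T u v → c u ≢ c v) where

    path-alternates : ∀ k (p : Fin (suc k) → Fin n) → IsPath T p →
      c (p (last k)) ≡ alternate k (c (p fzero))
    path-alternates zero p P = refl
    path-alternates (suc k) p P =
      trans (path-alternates k (p ∘ fsuc) (path-tail P))
            (cong (alternate k) (≢⇒≡not (adj⇒≢ (IsPath.adj P fzero (fsuc fzero) refl))))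

  module _ (c : Fin n → Bool)
           (mono : ∀ u v → u ≢ v → c u ≡ c v → StronglyAntiadjacent T u v) where

    adj⇒colours≢ : ∀ {u v} → Adjacent T u v → c u ≢ c v
    adj⇒colours≢ a eq = adj⇒¬strongAnti a (mono _ _ (proj₁ a) eq)

    same-colour⇒evenPair : ∀ u v → u ≢ v → c u ≡ c v → IsEvenPair T u v
    same-colour⇒evenPair u v u≢v eq = mono u v u≢v eq , λ where
      k p (P , refl , refl) → alternate-≡⇒Even k (c (p fzero))
        (trans (sym (path-alternates c adj⇒colours≢ k p P)) (sym eq))

    sameColour? : ∀ (A : Fin n → Set) → (∀ w → Dec (A w)) →
      Dec (∃[ u ] ∃[ v ] (u ≢ v × c u ≡ c v × A u × A v))
    sameColour? A A? = Finₚ.any? λ u → Finₚ.any? λ v →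
      ¬? (u Finₚ.≟ v) ×-dec ((c u Boolₚ.≟ c v) ×-dec (A? u ×-dec A? v))

    third-colour : ∀ {A : Fin n → Set} →
      ¬ (∃[ u ] ∃[ v ] (u ≢ v × c u ≡ c v × A u × A v)) →
      ∀ {u v} → A u → A v → c u ≢ c v → ∀ w → A w → w ≡ u ⊎ w ≡ v
    third-colour none {u} {v} Au Av cu≢cv w Aw with w Finₚ.≟ u | w Finₚ.≟ v
    ... | yes p | _     = inj₁ p
    ... | _     | yes p = inj₂ p
    ... | no w≢u | no w≢v with c w Boolₚ.≟ c u
    ...   | yes eq = ⊥-elim (none (w , u , w≢u , eq , Aw , Au))
    ...   | no ne  = ⊥-elim (none (w , v , w≢v , ≢∧≢⇒≡ ne (cu≢cv ∘ sym) , Aw , Av))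

    -- No path joins `u` to `v` at all. A neighbour of `u` is `x` or `y`, because `v` and `a` are
    -- excluded, so `u` has the colour of `a`; the same holds for `v`, but the colours of `u` and
    -- `v` differ.
    light-evenPair : ∀ {a x y u v} →
      (∀ w → w ≢ a → w ≢ x → w ≢ y → StronglyAntiadjacent T a w) →
      Semiadjacent T a x → Semiadjacent T a y →
      StronglyAntiadjacent T u v →
      (∀ w → (w ≡ u ⊎ w ≡ v) ⊎ w ≡ a ⊎ w ≡ x ⊎ w ≡ y) →
      ¬ (u ≡ a ⊎ u ≡ x ⊎ u ≡ y) → ¬ (v ≡ a ⊎ v ≡ x ⊎ v ≡ y) →
      c u ≢ c v → IsEvenPair T u v
    light-evenPair {a} {x} {y} {u} {v} iso ax ay uv cover u∉D v∉D cu≢cv =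
      uv , λ where
        zero p (P , refl , eq) → refl
        (suc k) p (P , refl , refl) →
          ⊥-elim (cu≢cv (trans
            (towards uv u∉D cover (IsPath.adj P fzero (fsuc fzero) refl))
            (sym (towards (StronglyAntiadjacent-sym uv) v∉D (Sum.map₁ Sum.swap ∘ cover)
              (Adjacent-sym (final P))))))
      where
      final : ∀ {k} {p : Fin (suc (suc k)) → Fin n} → IsPath T p →
        Adjacent T (p (Fin.inject₁ (last k))) (p (fsuc (last k)))
      final {k} P = IsPath.adj P (Fin.inject₁ (last k)) (fsuc (last k))
        (cong suc (Finₚ.toℕ-inject₁ (last k)))
      opposite : ∀ {z} → Semiadjacent T a z → ∀ {w} → Adjacent T w z → c w ≡ c a
      opposite az wz = ≢∧≢⇒≡ (adj⇒colours≢ wz) (adj⇒colours≢ (semi⇒adj az))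
      not-a : ∀ {w} → ¬ (w ≡ a ⊎ w ≡ x ⊎ w ≡ y) → ¬ Adjacent T w a
      not-a w∉D wa = adj⇒¬strongAnti (Adjacent-sym wa)
        (iso _ (w∉D ∘ inj₁) (w∉D ∘ inj₂ ∘ inj₁) (w∉D ∘ inj₂ ∘ inj₂))
      towards : ∀ {w w′ z} → StronglyAntiadjacent T w w′ → ¬ (w ≡ a ⊎ w ≡ x ⊎ w ≡ y) →
        (∀ z → (z ≡ w ⊎ z ≡ w′) ⊎ z ≡ a ⊎ z ≡ x ⊎ z ≡ y) → Adjacent T w z → c w ≡ c a
      towards {z = z} ww′ w∉D cov wz with cov z
      ... | inj₁ (inj₁ refl) = ⊥-elim (proj₁ wz refl)
      ... | inj₁ (inj₂ refl) = ⊥-elim (adj⇒¬strongAnti wz ww′)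
      ... | inj₂ (inj₁ refl) = ⊥-elim (not-a w∉D wz)
      ... | inj₂ (inj₂ (inj₁ refl)) = opposite ax wz
      ... | inj₂ (inj₂ (inj₂ refl)) = opposite ay wz

    bipartite-hasEvenPair : ∀ {u v} → StronglyAntiadjacent T u v → HasEvenPair T
    bipartite-hasEvenPair {u} {v} uv with sameColour? (λ _ → ⊤) (λ _ → yes tt)
    ... | yes (a , b , a≢b , eq , _) = a , b , same-colour⇒evenPair a b a≢b eq
    ... | no none with c u Boolₚ.≟ c v
    ...   | yes eq = ⊥-elim (none (u , v , proj₁ uv , eq , tt , tt))
    ...   | no ne  = u , v , long-paths⇒evenPair uv λ k p P p≡u p≡v →
            case third-colour none tt tt ne (p (fsuc fzero)) tt of λ where
              (inj₁ e) → case IsPath.inj P _ _ (trans p≡u (sym e)) of λ ()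
              (inj₂ e) → case IsPath.inj P _ _ (trans p≡v (sym e)) of λ ()

    bipartite-disjoint : (F : InF T) → Favorable T F → HasEvenPairDisjoint T F
    bipartite-disjoint F (5≤n , (u , v , uv , u∉D , v∉D) , _)
      with sameColour? (λ w → ¬ InD T F w) (λ w → ¬? (inD? F w))
    ... | yes (a , b , a≢b , eq , a∉D , b∉D) =
          a , b , same-colour⇒evenPair a b a≢b eq , a∉D , b∉D
    ... | no none with c u Boolₚ.≟ c v
    ...   | yes eq = ⊥-elim (none (u , v , proj₁ uv , eq , u∉D , v∉D))
    ...   | no cu≢cv = u , v , crowded F u∉D v∉D outside , u∉D , v∉D
      where
      outside : ∀ w → InD T F w ⊎ (w ≡ u ⊎ w ≡ v)
      outside w with inD? F w
      ... | yes w∈D = inj₁ w∈D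
      ... | no w∉D  = inj₂ (third-colour none u∉D v∉D cu≢cv w w∉D)
      -- Outside the switchable component only `u` and `v` remain, so there are at most 2, 4 or 5
      -- vertices in the three cases; five vertices leave only the light one.
      crowded : (F : InF T) → ¬ InD T F u → ¬ InD T F v →
        (∀ w → InD T F w ⊎ (w ≡ u ⊎ w ≡ v)) → IsEvenPair T u v
      crowded (_ , noSwitch _) _ _ out = case ℕₚ.≤-trans 5≤n
          (covers⇒≤ (u ∷ v ∷ []) λ w → [ (λ ()) , [ here , there ∘ here ]′ ]′ (out w)) of λ
          { (s≤s (s≤s ())) }
      crowded (_ , small x y _ _ _) _ _ out = case ℕₚ.≤-trans 5≤n
          (covers⇒≤ (x ∷ y ∷ u ∷ v ∷ []) λ w → [ [ here , there ∘ here ]′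
            , [ there ∘ there ∘ here , there ∘ there ∘ there ∘ here ]′ ]′ (out w)) of λ
          { (s≤s (s≤s (s≤s (s≤s ())))) }
      crowded (_ , light a x y _ ax ay _ iso _ _) u∉D v∉D out =
        light-evenPair iso ax ay uv (Sum.swap ∘ out) u∉D v∉D cu≢cv

  bipartite-conclusion : Bipartite T → (F : InF T) → Conclusion F
  bipartite-conclusion (c , mono) F =
    Sum.map₂ (λ (_ , _ , uv) → bipartite-hasEvenPair c mono uv) complete-or-strongAnti ,
    bipartite-disjoint c mono F

-- Induced paths and holes

module _ {n : ℕ} (T : Trigraph n) where

  -- The first vertex is an index, so paths grow at the front and suffixes are again paths.
  -- Distinctness needs no clause, since adjacency and antiadjacency both include it.
  data InducedPath : Fin n → List (Fin n) → Set where
    end  : ∀ {x} → InducedPath x []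
    step : ∀ {x y ys} → Adjacent T x y → All (Antiadjacent T x) ys →
           InducedPath y ys → InducedPath x (y ∷ ys)

  data AdjacentToLast (u : Fin n) : List (Fin n) → Set where
    final : ∀ {z} → Adjacent T u z → AdjacentToLast u (z ∷ [])
    skip  : ∀ {z zs} → Antiadjacent T u z → AdjacentToLast u zs → AdjacentToLast u (z ∷ zs)

  private
    Pairing : (k : ℕ) → Fin k → Fin k → Fin n → Fin n → Set
    Pairing k i j u v = (CycConsec T k i j × Adjacent T u v) ⊎ (¬ CycConsec T k i j × Antiadjacent T u v)

  CycConsec-swap : ∀ {k i j} → CycConsec T k i j → CycConsec T k j i
  CycConsec-swap (inj₁ p) = inj₂ (inj₁ p)
  CycConsec-swap (inj₂ (inj₁ p)) = inj₁ p
  CycConsec-swap (inj₂ (inj₂ (inj₁ p))) = inj₂ (inj₂ (inj₂ p))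
  CycConsec-swap (inj₂ (inj₂ (inj₂ p))) = inj₂ (inj₂ (inj₁ p))

  path-pair : ∀ {x xs} → InducedPath x xs → ∀ i j → toℕ i < toℕ j →
    (suc (toℕ i) ≡ toℕ j × Adjacent T (lookup (x ∷ xs) i) (lookup (x ∷ xs) j)) ⊎
    (suc (toℕ i) ≢ toℕ j × Antiadjacent T (lookup (x ∷ xs) i) (lookup (x ∷ xs) j))
  path-pair (step a _ _) fzero (fsuc fzero) _ = inj₁ (refl , a)
  path-pair (step a as _) fzero (fsuc (fsuc j)) _ = inj₂ ((λ ()) , All.lookup as (∈-lookup j))
  path-pair (step _ _ p) (fsuc i) (fsuc j) (s≤s lt) =
    Sum.map (λ (e , a) → cong suc e , a) (λ (e , a) → e ∘ ℕₚ.suc-injective , a) (path-pair p i j lt)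

  last-pair : ∀ {u xs} → AdjacentToLast u xs → ∀ i →
    (suc (toℕ i) ≡ length xs × Adjacent T u (lookup xs i)) ⊎
    (suc (toℕ i) ≢ length xs × Antiadjacent T u (lookup xs i))
  last-pair (final a) fzero = inj₁ (refl , a)
  last-pair (skip {zs = z ∷ zs} a l) fzero = inj₂ ((λ ()) , a)
  last-pair (skip a l) (fsuc i) =
    Sum.map (λ (e , a) → cong suc e , a) (λ (e , a) → e ∘ ℕₚ.suc-injective , a) (last-pair l i)

  module _ {u x xs} (path : InducedPath x xs) (ux : Adjacent T u x) (ul : AdjacentToLast u xs) where

    private
      k = suc (suc (length xs))
      h = lookup (u ∷ x ∷ xs)

      pair : ∀ i j → toℕ i < toℕ j → Pairing k i j (h i) (h j)
      pair fzero (fsuc fzero) _ = inj₁ (inj₁ refl , ux)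
      pair fzero (fsuc (fsuc j)) _ with last-pair ul j
      ... | inj₁ (e , a) = inj₁ (inj₂ (inj₂ (inj₁ (refl , cong suc (cong suc e)))) , a)
      ... | inj₂ (ne , a) = inj₂ ((λ where
              (inj₁ ())
              (inj₂ (inj₁ ()))
              (inj₂ (inj₂ (inj₁ (_ , e)))) → ne (ℕₚ.suc-injective (ℕₚ.suc-injective e))
              (inj₂ (inj₂ (inj₂ (() , _))))) , a)
      pair (fsuc i) (fsuc j) (s≤s lt) with path-pair path i j lt
      ... | inj₁ (e , a) = inj₁ (inj₁ (cong suc e) , a)
      ... | inj₂ (ne , a) = inj₂ ((λ where
              (inj₁ e) → ne (ℕₚ.suc-injective e)
              (inj₂ (inj₁ e)) → ℕₚ.<-asym lt (ℕₚ.≤-reflexive (ℕₚ.suc-injective e))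
              (inj₂ (inj₂ (inj₁ (() , _))))
              (inj₂ (inj₂ (inj₂ (() , _))))) , a)

      pair′ : ∀ i j → i ≢ j → Pairing k i j (h i) (h j)
      pair′ i j i≢j with ℕₚ.<-cmp (toℕ i) (toℕ j)
      ... | tri< lt _ _ = pair i j lt
      ... | tri≈ _ eq _ = ⊥-elim (i≢j (Finₚ.toℕ-injective eq))
      ... | tri> _ _ gt = Sum.map (λ (c , a) → CycConsec-swap c , Adjacent-sym T a)
                                  (λ (c , a) → c ∘ CycConsec-swap , Antiadjacent-sym T a) (pair j i gt)

    -- The path has `suc (length xs)` vertices and `u` closes it, so four path vertices give the
    -- five that a hole requires.
    hole : 4 ≤ suc (length xs) → IsHole T h
    hole 4≤ = record
      { len = s≤s 4≤
      ; inj = λ i j eq → case i Finₚ.≟ j of λ where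
          (yes e) → e
          (no ne) → ⊥-elim ([ (λ (_ , a) → proj₁ a eq) , (λ (_ , a) → proj₁ a eq) ]′ (pair′ i j ne))
      ; adj = λ i j ne c → [ proj₂ , (λ (¬c , _) → ⊥-elim (¬c c)) ]′ (pair′ i j ne)
      ; nonadj = λ i j ne ¬c → [ (λ (c , _) → ⊥-elim (¬c c)) , proj₂ ]′ (pair′ i j ne)
      }

-- Walks and shortest paths in finite graphs

module Graph {V : Set} (_≟_ : DecidableEquality V)
             (vs : List V) (vs-complete : ∀ v → v ∈ vs)
             (E : V → V → Set) (E? : ∀ u v → Dec (E u v))
             (E-sym : ∀ {u v} → E u v → E v u) where

  open DecMembership _≟_ public using (_∈?_)

  any-vertex? : {P : V → Set} → (∀ v → Dec (P v)) → Dec (∃ P)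
  any-vertex? P? = map′ (λ p → let v , _ , q = find p in v , q) (λ (v , q) → lose (vs-complete v) q)
                        (Any.any? P? vs)

  data Walk (A : V → Set) : V → V → Set where
    stop : ∀ {u} → A u → Walk A u u
    go   : ∀ {u v w} → A u → E u v → Walk A v w → Walk A u w

  walk-start : ∀ {A u v} → Walk A u v → A u
  walk-start (stop a)    = a
  walk-start (go a _ _) = a

  walk-end : ∀ {A u v} → Walk A u v → A v
  walk-end (stop a)    = a
  walk-end (go _ _ w) = walk-end w

  walk-map : ∀ {A B : V → Set} → (∀ {v} → A v → B v) → ∀ {u v} → Walk A u v → Walk B u v
  walk-map f (stop a)    = stop (f a)
  walk-map f (go a e w) = go (f a) e (walk-map f w)

  walk-trans : ∀ {A u v w} → Walk A u v → Walk A v w → Walk A u w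
  walk-trans (stop _)    w′ = w′
  walk-trans (go a e w) w′ = go a e (walk-trans w w′)

  walk-snoc : ∀ {A u v w} → Walk A u v → E v w → A w → Walk A u w
  walk-snoc w e a = walk-trans w (go (walk-end w) e (stop a))

  walk-sym : ∀ {A u v} → Walk A u v → Walk A v u
  walk-sym (stop a)    = stop a
  walk-sym (go a e w) = walk-snoc (walk-sym w) (E-sym e) a

  walk-closed : ∀ {A S : V → Set} → (∀ {u v} → S u → E u v → A v → S v) →
    ∀ {u v} → Walk A u v → S u → S v
  walk-closed cl (stop _)    s = s
  walk-closed cl (go _ e w) s = walk-closed cl w (cl s e (walk-start w))

  Off : List V → V → Set
  Off Z v = v ∉ Z

  off-∷ : ∀ {Z} {x v : V} → v ≢ x → v ∉ Z → v ∉ x ∷ Z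
  off-∷ v≢x v∉Z (here eq)  = v≢x eq
  off-∷ v≢x v∉Z (there v∈) = v∉Z v∈

  -- This makes the search `reach-acc` complete: after its last visit to `y` a walk avoids `y`, so
  -- nothing is lost by deleting `y` before searching on from its neighbours.
  walk-last-visit : ∀ {Z} y {x v} → Walk (Off Z) x v →
    Walk (Off (y ∷ Z)) x v ⊎ v ≡ y ⊎ (∃[ x′ ] (E y x′ × Walk (Off (y ∷ Z)) x′ v))
  walk-last-visit y {x} (stop a) with x ≟ y
  ... | yes eq = inj₂ (inj₁ eq)
  ... | no ne  = inj₁ (stop (off-∷ ne a))
  walk-last-visit y {x} (go a e w) with walk-last-visit y w
  ... | inj₂ r = inj₂ r
  ... | inj₁ w′ with x ≟ y
  ...   | yes refl = inj₂ (inj₂ (_ , e , w′))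
  ...   | no ne    = inj₁ (go (off-∷ ne a) e w′)

  -- The measure for all recursions in which an explored or deleted set grows.
  free : List V → ℕ
  free Z = length (filter (λ v → ¬? (v ∈? Z)) vs)

  free-< : ∀ {Z Z′ y} → (∀ {v} → v ∈ Z → v ∈ Z′) → y ∉ Z → y ∈ Z′ → free Z′ < free Z
  free-< {Z} {Z′} {y} Z⊆Z′ y∉Z y∈Z′ = strict vs (vs-complete y)
    where
    count : List V → List V → ℕ
    count Z xs = length (filter (λ v → ¬? (v ∈? Z)) xs)
    weak : ∀ xs → count Z′ xs ≤ count Z xs
    weak [] = z≤n
    weak (x ∷ xs) with x ∈? Z′ | x ∈? Z
    ... | yes _ | yes _ = weak xs
    ... | yes _ | no _  = ℕₚ.m≤n⇒m≤1+n (weak xs)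
    ... | no x∉ | yes x∈ = ⊥-elim (x∉ (Z⊆Z′ x∈))
    ... | no _  | no _  = s≤s (weak xs)
    strict : ∀ xs → y ∈ xs → count Z′ xs < count Z xs
    strict (x ∷ xs) (here refl) with x ∈? Z′ | x ∈? Z
    ... | yes _ | yes x∈ = ⊥-elim (y∉Z x∈)
    ... | yes _ | no _   = s≤s (weak xs)
    ... | no x∉ | _      = ⊥-elim (x∉ y∈Z′)
    strict (x ∷ xs) (there y∈) with x ∈? Z′ | x ∈? Z
    ... | yes _ | yes _ = strict xs y∈
    ... | yes _ | no _  = ℕₚ.m≤n⇒m≤1+n (strict xs y∈)
    ... | no x∉ | yes x∈ = ⊥-elim (x∉ (Z⊆Z′ x∈))
    ... | no _  | no _  = s≤s (strict xs y∈)

  private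
    reach-acc : ∀ Z {P : V → Set} (P? : ∀ v → Dec (P v)) y → Acc _<_ (free Z) →
      Dec (∃[ v ] (Walk (Off Z) y v × P v))
    reach-acc Z P? y (acc rec) with y ∈? Z
    ... | yes y∈ = no λ (v , w , _) → walk-start w y∈
    ... | no y∉ with P? y
    ...   | yes py = yes (y , stop y∉ , py)
    ...   | no ¬py with any-vertex? (λ x → E? y x ×-dec
                           reach-acc (y ∷ Z) P? x (rec (free-< there y∉ (here refl))))
    ...     | yes (x , e , v , w , pv) =
                yes (v , go y∉ e (walk-map (λ v∉ v∈ → v∉ (there v∈)) w) , pv)
    ...     | no ¬x = no λ (v , w , pv) → case walk-last-visit y w of λ where
                (inj₁ w′) → walk-start w′ (here refl)
                (inj₂ (inj₁ refl)) → ¬py pv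
                (inj₂ (inj₂ (x , e , w′))) → ¬x (x , e , v , w′ , pv)

  reach? : ∀ Z {P : V → Set} (P? : ∀ v → Dec (P v)) y → Dec (∃[ v ] (Walk (Off Z) y v × P v))
  reach? Z P? y = reach-acc Z P? y (<-wellFounded _)

  -- Only the last vertex satisfies `P`. If `P` means adjacency to a target, the path can therefore
  -- be prolonged to the target without creating a chord.
  data Induced (A P : V → Set) : V → List V → Set where
    end  : ∀ {y} → A y → P y → Induced A P y []
    step : ∀ {y x xs} → A y → ¬ P y → E y x → All (λ z → ¬ E y z) xs → y ∉ x ∷ xs →
           Induced A P x xs → Induced A P y (x ∷ xs)

  module _ {A P : V → Set} where

    induced-all : ∀ {y xs} → Induced A P y xs → All A (y ∷ xs)
    induced-all (end a _)            = a ∷ []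
    induced-all (step a _ _ _ _ ind) = a ∷ induced-all ind

    private
      suffix : ∀ {y x xs} → Induced A P x xs → y ∈ x ∷ xs → ∃ (Induced A P y)
      suffix ind (here refl) = _ , ind
      suffix (step _ _ _ _ _ ind) (there y∈) = suffix ind y∈

    -- Entering the path at the last neighbour of `y` skips every chord at `y`.
    last-neighbour : ∀ {y x xs} → E y x → Induced A P x xs →
      ∃[ x′ ] ∃[ xs′ ] (E y x′ × All (λ z → ¬ E y z) xs′ × Induced A P x′ xs′
        × (∀ {z} → z ∈ x′ ∷ xs′ → z ∈ x ∷ xs))
    last-neighbour {y} e ind@(end _ _) = _ , _ , e , [] , ind , id
    last-neighbour {y} {x} {x₂ ∷ xs} e ind@(step _ _ _ _ _ ind₂) with Any.any? (E? y) (x₂ ∷ xs)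
    ... | no none = _ , _ , e , All.tabulate (λ z∈ ez → none (lose z∈ ez)) , ind , id
    ... | yes some = let x′ , xs′ , r = later some ind₂ in
          x′ , xs′ , proj₁ r , proj₁ (proj₂ r) , proj₁ (proj₂ (proj₂ r)) , there ∘ proj₂ (proj₂ (proj₂ r))
      where
      later : ∀ {x xs} → Any.Any (E y) (x ∷ xs) → Induced A P x xs →
        ∃[ x′ ] ∃[ xs′ ] (E y x′ × All (λ z → ¬ E y z) xs′ × Induced A P x′ xs′
          × (∀ {z} → z ∈ x′ ∷ xs′ → z ∈ x ∷ xs))
      later (here e) ind = last-neighbour e ind
      later (there some) (step _ _ _ _ _ ind) =
        let x′ , xs′ , a , b , c , d = later some ind in x′ , xs′ , a , b , c , there ∘ d

    -- The walk is straightened from its end backwards: a new vertex that already lies on the path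
    -- is replaced by the suffix starting there, any other is joined to its last neighbour.
    induce : (∀ v → Dec (P v)) → ∀ {y v} → Walk A y v → P v → ∃ (Induced A P y)
    induce P? (stop a) p = [] , end a p
    induce P? {y} (go a e w) p with P? y
    ... | yes py = [] , end a py
    ... | no ¬py with induce P? w p
    ...   | xs , ind with y ∈? (_ ∷ xs)
    ...     | yes y∈ = suffix ind y∈
    ...     | no y∉ = let x′ , xs′ , e′ , none , ind′ , sub = last-neighbour e ind in
              x′ ∷ xs′ , step a ¬py e′ none (y∉ ∘ sub) ind′

-- Host graphs and thetas

Unique-resp-↭ : ∀ {A : Set} {xs ys : List A} → xs ↭ ys → Unique xs → Unique ys
Unique-resp-↭ {A} p = Permutationₛ.Unique-resp-↭ (setoid A) (↭⇒↭ₛ p)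

Unique-++⁻ : ∀ {A : Set} (xs : List A) {ys} → Unique (xs ++ ys) →
  Unique xs × Unique ys × (∀ {v} → v ∈ xs → v ∉ ys)
Unique-++⁻ [] u = [] , u , λ ()
Unique-++⁻ (x ∷ xs) (x≢ ∷ u) with Unique-++⁻ xs u
... | uxs , uys , dis = Allₚ.++⁻ˡ xs x≢ ∷ uxs , uys , λ where
      (here refl) v∈ → All.lookup (Allₚ.++⁻ʳ xs x≢) v∈ refl
      (there v∈xs)   → dis v∈xs

All≢⇒∉ : ∀ {A : Set} {x : A} {xs} → All (x ≢_) xs → x ∉ xs
All≢⇒∉ all x∈ = All.lookup all x∈ refl

∉⇒All≢ : ∀ {A : Set} {x : A} {xs} → x ∉ xs → All (x ≢_) xs
∉⇒All≢ x∉ = All.tabulate λ { v∈ refl → x∉ v∈ }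

-- The bipartite graph of which the full realization is the line graph: its edges are Fin n.
module Host {n a b : ℕ} (ε : Fin n → Fin a × Fin b)
            (ε-inj : ∀ u v → ε u ≡ ε v → u ≡ v) where

  V : Set
  V = Fin a ⊎ Fin b

  side : V → Bool
  side (inj₁ _) = true
  side (inj₂ _) = false

  endpoint : Bool → Fin n → V
  endpoint true  e = inj₁ (proj₁ (ε e))
  endpoint false e = inj₂ (proj₂ (ε e))

  side-endpoint : ∀ c e → side (endpoint c e) ≡ c
  side-endpoint true  e = refl
  side-endpoint false e = refl

  _≟V_ : DecidableEquality V
  _≟V_ = Sumₚ.≡-dec Finₚ._≟_ Finₚ._≟_

  -- Choosing the endpoint by the side of `v` turns incidence into one equation valid on both sides
  -- of the bipartition, so most arguments below need no case split on the side.
  Inc : Fin n → V → Set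
  Inc e v = v ≡ endpoint (side v) e

  record Edge (e : Fin n) (u v : V) : Set where
    constructor mkEdge
    field
      incˡ  : Inc e u
      incʳ  : Inc e v
      sides : side v ≡ not (side u)
  open Edge public

  edge-sym : ∀ {e u v} → Edge e u v → Edge e v u
  edge-sym {u = u} (mkEdge p q s) =
    mkEdge q p (trans (sym (Boolₚ.not-involutive (side u))) (cong not (sym s)))

  endpoint-inc : ∀ c e → Inc e (endpoint c e)
  endpoint-inc c e = cong (λ d → endpoint d e) (sym (side-endpoint c e))

  edge-ends : ∀ c e → Edge e (endpoint c e) (endpoint (not c) e)
  edge-ends c e = mkEdge (endpoint-inc c e) (endpoint-inc (not c) e)
    (trans (side-endpoint (not c) e) (cong not (sym (side-endpoint c e))))

  endpoints-injective : ∀ c {e f} → endpoint c e ≡ endpoint c f →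
    endpoint (not c) e ≡ endpoint (not c) f → e ≡ f
  endpoints-injective true  p q = ε-inj _ _ (cong₂ _,_ (Sumₚ.inj₁-injective p) (Sumₚ.inj₂-injective q))
  endpoints-injective false p q = ε-inj _ _ (cong₂ _,_ (Sumₚ.inj₁-injective q) (Sumₚ.inj₂-injective p))

  inc-same-side : ∀ {e u v} → Inc e u → Inc e v → side u ≡ side v → u ≡ v
  inc-same-side {e} p q s = trans p (trans (cong (λ c → endpoint c e) s) (sym q))

  sides≢ : ∀ {e u v} → Edge e u v → side u ≢ side v
  sides≢ {u = u} ed s = not≢ (side u) (trans (sym (sides ed)) (sym s))

  inc-cases : ∀ {e u v w} → Edge e u v → Inc e w → w ≡ u ⊎ w ≡ v
  inc-cases {e} {u} {v} {w} ed i with side w Boolₚ.≟ side u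
  ... | yes s = inj₁ (inc-same-side i (incˡ ed) s)
  ... | no ne = inj₂ (inc-same-side i (incʳ ed) (≢∧≢⇒≡ ne (sides≢ ed ∘ sym)))

  edge-unique : ∀ {e f u v} → Edge e u v → Inc f u → Inc f v → e ≡ f
  edge-unique {e} {f} {u} {v} ed iu iv = endpoints-injective (side u)
    (trans (sym (incˡ ed)) iu)
    (subst (λ c → endpoint c e ≡ endpoint c f) (sides ed) (trans (sym (incʳ ed)) iv))

  edge-≢ : ∀ {e u v} → Edge e u v → u ≢ v
  edge-≢ ed refl = sides≢ ed refl

  other-side : ∀ {e f u v w} → Edge e u v → Edge f w v → side u ≡ side w
  other-side ed fd = ≢∧≢⇒≡ (sides≢ ed) (sides≢ fd)

  E : V → V → Set
  E u v = ∃[ e ] Edge e u v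

  edge? : ∀ e u v → Dec (Edge e u v)
  edge? e u v = map′ (λ (p , q , s) → mkEdge p q s) (λ (mkEdge p q s) → p , q , s)
    ((u ≟V endpoint (side u) e) ×-dec ((v ≟V endpoint (side v) e) ×-dec (side v Boolₚ.≟ not (side u))))

  E-sym : ∀ {u v} → E u v → E v u
  E-sym (e , ed) = e , edge-sym ed

  vertices : List V
  vertices = map inj₁ (allFin a) ++ map inj₂ (allFin b)

  vertices-complete : ∀ v → v ∈ vertices
  vertices-complete (inj₁ i) = ∈-++⁺ˡ (∈-map⁺ inj₁ (∈-allFin i))
  vertices-complete (inj₂ j) = ∈-++⁺ʳ (map inj₁ (allFin a)) (∈-map⁺ inj₂ (∈-allFin j))

  open Graph _≟V_ vertices vertices-complete E (λ u v → Finₚ.any? (λ e → edge? e u v)) E-sym public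

  E? : ∀ u v → Dec (E u v)
  E? u v = Finₚ.any? (λ e → edge? e u v)

  E-side : ∀ {u v w} → E u v → E w v → side u ≡ side w
  E-side (_ , p) (_ , q) = other-side p q

  E-sides≢ : ∀ {u v} → E u v → side u ≢ side v
  E-sides≢ (_ , p) = sides≢ p

  E-irrefl : ∀ {v} → ¬ E v v
  E-irrefl e = E-sides≢ e refl

  -- Repetitions are not excluded here but by separate `Unique` hypotheses. This admits closed
  -- paths, among them the one that runs along a single edge and back.
  data Path : V → List V → V → Set where
    arrive : ∀ {u v} → E u v → Path u [] v
    _∷_  : ∀ {u x xs v} → E u x → Path x xs v → Path u (x ∷ xs) v

  path-side : ∀ {u xs v} → Path u xs v → side v ≡ alternate (suc (length xs)) (side u)
  path-side (arrive (_ , ed)) = sides ed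
  path-side {xs = _ ∷ xs} ((_ , ed) ∷ p) =
    trans (path-side p) (cong (alternate (suc (length xs))) (sides ed))

  path-++ : ∀ {u xs v ys w} → Path u xs v → Path v ys w → Path u (xs ++ v ∷ ys) w
  path-++ (arrive e) q = e ∷ q
  path-++ (e ∷ p)  q = e ∷ path-++ p q

  path-split : ∀ {u} xs {v ys w} → Path u (xs ++ v ∷ ys) w → Path u xs v × Path v ys w
  path-split []       (e ∷ p) = arrive e , p
  path-split (x ∷ xs) (e ∷ p) = let q , r = path-split xs p in e ∷ q , r

  path-reverse : ∀ {u xs v} → Path u xs v → Path v (reverse xs) u
  path-reverse (arrive e) = arrive (E-sym e)
  path-reverse {u} {x ∷ xs} {v} (e ∷ p) =
    subst (λ l → Path v l u) (sym (Listₚ.unfold-reverse x xs))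
      (path-++ (path-reverse p) (arrive (E-sym e)))

  induced-path : ∀ {A w y xs} → Induced A (λ v → E v w) y xs → Path y xs w
  induced-path (end _ p)             = arrive p
  induced-path (step _ _ e _ _ ind) = e ∷ induced-path ind

  induced-unique : ∀ {A P y xs} → Induced A P y xs → Unique (y ∷ xs)
  induced-unique (end _ _)             = [] ∷ []
  induced-unique (step _ _ _ _ y∉ ind) = ∉⇒All≢ y∉ ∷ induced-unique ind

  -- Position `suc (length xs)` is the far end; later positions also return `w`, which is why
  -- injectivity bounds its indices.
  point : V → List V → V → ℕ → V
  point u _        w zero    = u
  point u []       w (suc k) = w
  point u (x ∷ xs) w (suc k) = point x xs w k

  point-end : ∀ u xs w → point u xs w (suc (length xs)) ≡ w
  point-end u []       w = refl
  point-end u (x ∷ xs) w = point-end x xs w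

  point-interior : ∀ u xs w k → k < length xs → point u xs w (suc k) ∈ xs
  point-interior u (x ∷ xs) w zero    _        = here refl
  point-interior u (x ∷ xs) w (suc k) (s≤s lt) = there (point-interior x xs w k lt)

  edgeAt : ∀ {u xs w} → Path u xs w → Fin (suc (length xs)) → Fin n
  edgeAt (arrive (e , _))           fzero    = e
  edgeAt {xs = _ ∷ _} ((e , _) ∷ p) fzero    = e
  edgeAt {xs = _ ∷ _} (_ ∷ p)       (fsuc j) = edgeAt p j

  edgeAt-edge : ∀ {u xs w} (p : Path u xs w) j →
    Edge (edgeAt p j) (point u xs w (toℕ j)) (point u xs w (suc (toℕ j)))
  edgeAt-edge (arrive (e , ed))                        fzero    = ed
  edgeAt-edge {xs = _ ∷ []}    ((e , ed) ∷ arrive _)   fzero    = ed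
  edgeAt-edge {xs = _ ∷ _ ∷ _} ((e , ed) ∷ (_ ∷ _))  fzero    = ed
  edgeAt-edge {xs = _ ∷ _}     (_ ∷ p)               (fsuc j) = edgeAt-edge p j

  data Position (xs : List V) (u w : V) (k : ℕ) : Set where
    first : k ≡ 0 → Position xs u w k
    inner : point u xs w k ∈ xs → Position xs u w k
    final : k ≡ suc (length xs) → Position xs u w k

  position : ∀ u xs w k → k ≤ suc (length xs) → Position xs u w k
  position u xs w zero    _        = first refl
  position u xs w (suc k) (s≤s le) with ℕₚ.m≤n⇒m<n∨m≡n le
  ... | inj₁ lt = inner (point-interior u xs w k lt)
  ... | inj₂ eq = final (cong suc eq)

  point-injective : ∀ {u xs w} → u ∉ xs → w ∉ xs → u ≢ w → Unique xs →
    ∀ k l → k ≤ suc (length xs) → l ≤ suc (length xs) →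
    point u xs w k ≡ point u xs w l → k ≡ l
  point-injective u∉ w∉ u≢w un zero zero _ _ _ = refl
  point-injective {u} {xs} {w} u∉ w∉ u≢w un zero (suc l) _ l≤ eq with position u xs w (suc l) l≤
  ... | inner p    = ⊥-elim (u∉ (subst (_∈ xs) (sym eq) p))
  ... | final refl = ⊥-elim (u≢w (trans eq (point-end u xs w)))
  point-injective {u} {xs} {w} u∉ w∉ u≢w un (suc k) zero k≤ _ eq with position u xs w (suc k) k≤
  ... | inner p    = ⊥-elim (u∉ (subst (_∈ xs) eq p))
  ... | final refl = ⊥-elim (u≢w (trans (sym eq) (point-end u xs w)))
  point-injective {xs = []} _ _ _ _ (suc zero) (suc zero) _ _ _ = refl
  point-injective {xs = []} _ _ _ _ (suc (suc k)) (suc l) (s≤s ()) _ _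
  point-injective {xs = []} _ _ _ _ (suc zero) (suc (suc l)) _ (s≤s ()) _
  point-injective {xs = x ∷ xs} u∉ w∉ u≢w (x≢ ∷ un) (suc k) (suc l) (s≤s k≤) (s≤s l≤) eq =
    cong suc (point-injective (All≢⇒∉ x≢) (w∉ ∘ there) (w∉ ∘ here ∘ sym) un k l k≤ l≤ eq)

  record Theta (u w : V) (I : Fin 3 → List V) : Set where
    field
      u≢w      : u ≢ w
      paths    : ∀ i → Path u (I i) w
      uniques  : ∀ i → Unique (I i)
      u∉       : ∀ i → u ∉ I i
      w∉       : ∀ i → w ∉ I i
      disjoint : ∀ {i j v} → i ≢ j → v ∈ I i → v ∉ I j

    pt : Fin 3 → ℕ → V
    pt i = point u (I i) w

    len : Fin 3 → ℕ
    len i = length (I i)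

    Same : Fin 3 → ℕ → Fin 3 → ℕ → Set
    Same i k j l = (i ≡ j × k ≡ l) ⊎ (k ≡ 0 × l ≡ 0) ⊎ (k ≡ suc (len i) × l ≡ suc (len j))

    same-point : ∀ i k j l → k ≤ suc (len i) → l ≤ suc (len j) → pt i k ≡ pt j l → Same i k j l
    same-point i k j l k≤ l≤ eq with i Finₚ.≟ j
    ... | yes refl = inj₁ (refl , point-injective (u∉ i) (w∉ i) u≢w (uniques i) k l k≤ l≤ eq)
    ... | no i≢j with position u (I i) w k k≤ | position u (I j) w l l≤
    ...   | first p | first q = inj₂ (inj₁ (p , q))
    ...   | final p | final q = inj₂ (inj₂ (p , q))
    ...   | inner p | inner q = ⊥-elim (disjoint i≢j p (subst (_∈ I j) (sym eq) q))
    ...   | first refl | inner q = ⊥-elim (u∉ j (subst (_∈ I j) (sym eq) q))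
    ...   | inner p | first refl = ⊥-elim (u∉ i (subst (_∈ I i) eq p))
    ...   | first refl | final refl = ⊥-elim (u≢w (trans eq (point-end u (I j) w)))
    ...   | final refl | first refl = ⊥-elim (u≢w (trans (sym eq) (point-end u (I i) w)))
    ...   | inner p | final refl = ⊥-elim (w∉ i (subst (_∈ I i) (trans eq (point-end u (I j) w)) p))
    ...   | final refl | inner q = ⊥-elim (w∉ j (subst (_∈ I j) (trans (sym eq) (point-end u (I i) w)) q))

    rung : PIdx len → Fin n
    rung (i , x) = edgeAt (paths i) x

    rung-edge : ∀ i x → Edge (rung (i , x)) (pt i (toℕ x)) (pt i (suc (toℕ x)))
    rung-edge i x = edgeAt-edge (paths i) x

    private
      x≤ : ∀ {m} (x : Fin (suc m)) → toℕ x ≤ suc m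
      x≤ x = ℕₚ.<⇒≤ (Finₚ.toℕ<n x)
      sx≤ : ∀ {m} (x : Fin (suc m)) → suc (toℕ x) ≤ suc m
      sx≤ x = Finₚ.toℕ<n x
      x≢ : ∀ {m} (x : Fin (suc m)) → toℕ x ≢ suc m
      x≢ x eq = ℕₚ.<-irrefl eq (Finₚ.toℕ<n x)

      pidx-≡ : ∀ {i} {x y : Fin (suc (len i))} → toℕ x ≡ toℕ y → _≡_ {A = PIdx len} (i , x) (i , y)
      pidx-≡ eq = cong (_ ,_) (Finₚ.toℕ-injective eq)

    -- A common edge is traversed either in the same direction or in opposite ones. In the first
    -- case two different paths could share it only if each consisted of that edge alone, which the
    -- bound on `len` excludes; in the second the positions contradict each other.
    rung-injective : (∀ i → 1 ≤ len i) → ∀ p q → rung p ≡ rung q → p ≡ q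
    rung-injective 1≤ (i , x) (j , y) eq with side (pt i (toℕ x)) Boolₚ.≟ side (pt j (toℕ y))
    ... | yes s = straight
          (same-point i (toℕ x) j (toℕ y) (x≤ x) (x≤ y) (inc-same-side (incˡ ex) (incˡ ey) s))
          (same-point i _ j _ (sx≤ x) (sx≤ y) (inc-same-side (incʳ ex) (incʳ ey)
            (≢∧≢⇒≡ (sides≢ (edge-sym ex)) (sides≢ (edge-sym ey) ∘ (λ e → trans e s)))))
      where
      ex = rung-edge i x
      ey : Edge (rung (i , x)) (pt j (toℕ y)) (pt j (suc (toℕ y)))
      ey = subst (λ e → Edge e (pt j (toℕ y)) (pt j (suc (toℕ y)))) (sym eq) (rung-edge j y)
      straight : Same i (toℕ x) j (toℕ y) → Same i (suc (toℕ x)) j (suc (toℕ y)) → (i , x) ≡ (j , y)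
      straight (inj₁ (refl , k≡)) _ = pidx-≡ k≡
      straight (inj₂ (inj₂ (k≡ , _))) _ = ⊥-elim (x≢ x k≡)
      straight (inj₂ (inj₁ (k≡ , l≡))) (inj₁ (refl , _)) = pidx-≡ (trans k≡ (sym l≡))
      straight (inj₂ (inj₁ (k≡ , l≡))) (inj₂ (inj₁ (() , _)))
      straight (inj₂ (inj₁ (k≡ , l≡))) (inj₂ (inj₂ (k′≡ , _))) =
        case subst (1 ≤_) (trans (sym (ℕₚ.suc-injective k′≡)) k≡) (1≤ i) of λ ()
    ... | no ns = ⊥-elim (crossing
          (same-point i (toℕ x) j _ (x≤ x) (sx≤ y) (inc-same-side (incˡ ex) (incʳ ey)
            (≢∧≢⇒≡ ns (sides≢ (edge-sym ey)))))
          (same-point i _ j (toℕ y) (sx≤ x) (x≤ y) (inc-same-side (incʳ ex) (incˡ ey)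
            (≢∧≢⇒≡ (sides≢ (edge-sym ex)) (ns ∘ sym)))))
      where
      ex = rung-edge i x
      ey : Edge (rung (i , x)) (pt j (toℕ y)) (pt j (suc (toℕ y)))
      ey = subst (λ e → Edge e (pt j (toℕ y)) (pt j (suc (toℕ y)))) (sym eq) (rung-edge j y)
      crossing : Same i (toℕ x) j (suc (toℕ y)) → Same i (suc (toℕ x)) j (toℕ y) → ⊥
      crossing (inj₂ (inj₁ (_ , ()))) _
      crossing (inj₂ (inj₂ (k≡ , _))) _ = x≢ x k≡
      crossing (inj₁ _) (inj₂ (inj₁ (() , _)))
      crossing (inj₁ _) (inj₂ (inj₂ (_ , l≡))) = x≢ y l≡
      crossing (inj₁ (_ , k≡)) (inj₁ (_ , l≡)) =
        ℕₚ.<-asym (ℕₚ.≤-reflexive (sym k≡)) (ℕₚ.≤-reflexive l≡)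

    prismEdge⇒meet : ∀ p q → PrismEdge len p q → ∃[ v ] (Inc (rung p) v × Inc (rung q) v)
    prismEdge⇒meet (i , x) (j , y) (inj₁ (refl , inj₁ eq)) =
      _ , incʳ (rung-edge i x) , subst (Inc (rung (i , y)) ∘ pt i) (sym eq) (incˡ (rung-edge i y))
    prismEdge⇒meet (i , x) (j , y) (inj₁ (refl , inj₂ eq)) =
      _ , subst (Inc (rung (i , x)) ∘ pt i) (sym eq) (incˡ (rung-edge i x)) , incʳ (rung-edge i y)
    prismEdge⇒meet (i , x) (j , y) (inj₂ (inj₁ (_ , p , q))) =
      u , subst (Inc (rung (i , x)) ∘ pt i) p (incˡ (rung-edge i x))
        , subst (Inc (rung (j , y)) ∘ pt j) q (incˡ (rung-edge j y))
    prismEdge⇒meet (i , x) (j , y) (inj₂ (inj₂ (_ , p , q))) = w , at-end i x p , at-end j y q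
      where
      at-end : ∀ i x → toℕ x ≡ len i → Inc (rung (i , x)) w
      at-end i x eq = subst (Inc (rung (i , x)))
        (trans (cong (pt i ∘ suc) eq) (point-end u (I i) w)) (incʳ (rung-edge i x))

    -- Two rung vertices share a host vertex in three ways: an inner vertex of one path gives
    -- consecutive vertices of a rung, `u` gives the first triangle, `w` the second.
    meet⇒prismEdge : ∀ p q → p ≢ q → ∀ v → Inc (rung p) v → Inc (rung q) v → PrismEdge len p q
    meet⇒prismEdge (i , x) (j , y) p≢q v iv jv
      with inc-cases (rung-edge i x) iv | inc-cases (rung-edge j y) jv
    ... | inj₁ refl | inj₁ eq = case same-point i _ j _ (x≤ x) (x≤ y) eq of λ where
          (inj₁ (refl , k≡)) → ⊥-elim (p≢q (pidx-≡ k≡))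
          (inj₂ (inj₁ (k≡ , l≡))) → inj₂ (inj₁ ((λ { refl → p≢q (pidx-≡ (trans k≡ (sym l≡))) }) , k≡ , l≡))
          (inj₂ (inj₂ (k≡ , _))) → ⊥-elim (x≢ x k≡)
    ... | inj₂ refl | inj₂ eq = case same-point i _ j _ (sx≤ x) (sx≤ y) eq of λ where
          (inj₁ (refl , k≡)) → ⊥-elim (p≢q (pidx-≡ (ℕₚ.suc-injective k≡)))
          (inj₂ (inj₁ (() , _)))
          (inj₂ (inj₂ (k≡ , l≡))) → inj₂ (inj₂
            ((λ { refl → p≢q (pidx-≡ (ℕₚ.suc-injective (trans k≡ (sym l≡)))) })
            , ℕₚ.suc-injective k≡ , ℕₚ.suc-injective l≡))
    ... | inj₁ refl | inj₂ eq = case same-point i _ j _ (x≤ x) (sx≤ y) eq of λ where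
          (inj₁ (refl , k≡)) → inj₁ (refl , inj₂ (sym k≡))
          (inj₂ (inj₁ (_ , ())))
          (inj₂ (inj₂ (k≡ , _))) → ⊥-elim (x≢ x k≡)
    ... | inj₂ refl | inj₁ eq = case same-point i _ j _ (sx≤ x) (x≤ y) eq of λ where
          (inj₁ (refl , k≡)) → inj₁ (refl , inj₁ k≡)
          (inj₂ (inj₁ (() , _)))
          (inj₂ (inj₂ (_ , l≡))) → ⊥-elim (x≢ y l≡)

-- Line trigraphs

module LineGraph {n a b : ℕ} (T : Trigraph n) (switch : SwitchStructure T) (noOddPrism : NoOddPrism T)
  (ε : Fin n → Fin a × Fin b) (ε-inj : ∀ u v → ε u ≡ ε v → u ≡ v)
  (adj⇒share : ∀ u v → u ≢ v → Adjacent T u v → proj₁ (ε u) ≡ proj₁ (ε v) ⊎ proj₂ (ε u) ≡ proj₂ (ε v))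
  (share⇒adj : ∀ u v → u ≢ v → proj₁ (ε u) ≡ proj₁ (ε v) ⊎ proj₂ (ε u) ≡ proj₂ (ε v) → Adjacent T u v)
  where

  open Host ε ε-inj

  adj⇒endpoint : ∀ {e f} → Adjacent T e f → ∃[ c ] (endpoint c e ≡ endpoint c f)
  adj⇒endpoint a = case adj⇒share _ _ (proj₁ a) a of λ where
    (inj₁ eq) → true , cong inj₁ eq
    (inj₂ eq) → false , cong inj₂ eq

  meet⇒adj : ∀ {e f v} → e ≢ f → Inc e v → Inc f v → Adjacent T e f
  meet⇒adj {v = inj₁ _} e≢f p q = share⇒adj _ _ e≢f (inj₁ (Sumₚ.inj₁-injective (trans (sym p) q)))
  meet⇒adj {v = inj₂ _} e≢f p q = share⇒adj _ _ e≢f (inj₂ (Sumₚ.inj₂-injective (trans (sym p) q)))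

  adj⇒meet : ∀ {e f} → Adjacent T e f → ∃[ v ] (Inc e v × Inc f v)
  adj⇒meet {e} {f} a with adj⇒endpoint a
  ... | c , eq = endpoint c e , endpoint-inc c e , subst (Inc f) (sym eq) (endpoint-inc c f)

  ¬meet⇒strongAnti : ∀ {e f} → e ≢ f → (∀ {v} → Inc e v → Inc f v → ⊥) → StronglyAntiadjacent T e f
  ¬meet⇒strongAnti e≢f none = ¬adj⇒strongAnti T e≢f λ a → let v , p , q = adj⇒meet a in none p q

  disjoint-edges : ∀ {e f u v u′ v′} → Edge e u v → Edge f u′ v′ → side u ≡ side u′ →
    u ≢ u′ → v ≢ v′ → StronglyAntiadjacent T e f
  disjoint-edges {e} {f} {u} {v} {u′} {v′} ed fd s u≢ v≢ = ¬meet⇒strongAnti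
    (λ { refl → u≢ (inc-same-side (incˡ ed) (incˡ fd) s) })
    (λ p q → meet (inc-cases ed p) (inc-cases fd q))
    where
    meet : ∀ {w} → w ≡ u ⊎ w ≡ v → w ≡ u′ ⊎ w ≡ v′ → ⊥
    meet (inj₁ refl) (inj₁ eq) = u≢ eq
    meet (inj₂ refl) (inj₂ eq) = v≢ eq
    meet (inj₁ refl) (inj₂ refl) = sides≢ fd (sym s)
    meet (inj₂ refl) (inj₁ refl) = sides≢ ed s

  -- Two of three edges at a common host vertex cannot be antiadjacent: they would be
  -- semiadjacent and the third one a common neighbour.
  no-antiadjacent-pair-at : ∀ {e f g v} → Inc e v → Inc f v → Inc g v → g ≢ e → g ≢ f →
    ¬ Antiadjacent T e f
  no-antiadjacent-pair-at ie if ig g≢e g≢f ef =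
    semi-no-common-neighbour T switch (adj∧antiadj⇒semi T (meet⇒adj (proj₁ ef) ie if) ef)
      (meet⇒adj (g≢e ∘ sym) ie ig) (meet⇒adj (g≢f ∘ sym) if ig)

  module _ {u w : V} {I : Fin 3 → List V} (θ : Theta u w I) (s : side u ≡ side w) where
    open Theta θ

    private
      odd-len : ∀ i → Odd (len i)
      odd-len i with even-or-odd (len i) (not (side u))
      ... | inj₁ (_ , eq) = ⊥-elim (not≢ (side u) (trans (sym eq) (sym (trans s (path-side (paths i))))))
      ... | inj₂ (odd , _) = odd

      odd⇒1≤ : ∀ {m} → Odd m → 1 ≤ m
      odd⇒1≤ {suc m} _ = s≤s z≤n

      1≤len : ∀ i → 1 ≤ len i
      1≤len i = odd⇒1≤ (odd-len i)

    no-odd-theta : ⊥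
    no-odd-theta = noOddPrism len rung (record
      { rung≥1 = 1≤len
      ; inj = rung-injective 1≤len
      ; edge = λ p q p≢q pe → let v , i , j = prismEdge⇒meet p q pe in
          meet⇒adj (p≢q ∘ rung-injective 1≤len p q) i j
      ; nonedge = λ p q p≢q ¬pe → ¬meet⇒strongAnti (p≢q ∘ rung-injective 1≤len p q)
          (λ {v} i j → ¬pe (meet⇒prismEdge p q p≢q v i j))
      }) odd-len

  Link : ∀ {k} → (Fin k → Fin n) → V → Set
  Link p v = ∃[ i ] ∃[ j ] (suc (toℕ i) ≡ toℕ j × Inc (p i) v × Inc (p j) v)

  penultimate : ∀ k → Fin (suc (suc k))
  penultimate k = Fin.inject₁ (last k)

  record HostWalk {k} (p : Fin (suc (suc k)) → Fin n) : Set where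
    field
      c     : Bool
      start : endpoint c (p fzero) ≡ endpoint c (p (fsuc fzero))
      finish : endpoint (alternate k c) (p (penultimate k)) ≡ endpoint (alternate k c) (p (last (suc k)))
      walk  : Walk (Link p) (endpoint c (p fzero)) (endpoint (alternate k c) (p (last (suc k))))

  -- Three consecutive edges cannot meet in one host vertex, because the outer two are antiadjacent.
  -- So successive meeting points are the two ends of the edge between them, and their sides
  -- alternate.
  hostWalk : ∀ {k} (p : Fin (suc (suc k)) → Fin n) → IsPath T p → HostWalk p
  hostWalk {k} p P with adj⇒endpoint (IsPath.adj P fzero (fsuc fzero) refl)
  hostWalk {zero} p P | c , eq = record
    { c = c ; start = eq ; finish = eq
    ; walk = subst (Walk (Link p) _) eq (stop (fzero , fsuc fzero , refl
               , endpoint-inc c _ , subst (Inc (p (fsuc fzero))) (sym eq) (endpoint-inc c _))) }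
  hostWalk {suc k} p P | c , eq with hostWalk (p ∘ fsuc) (path-tail T P)
  ... | W with HostWalk.c W Boolₚ.≟ c
  ...   | yes refl = ⊥-elim (no-antiadjacent-pair-at {v = endpoint c (p (fsuc fzero))}
            (subst (Inc (p fzero)) eq (endpoint-inc c _))
            (subst (Inc (p (fsuc (fsuc fzero)))) (sym (HostWalk.start W)) (endpoint-inc c _))
            (endpoint-inc c (p (fsuc fzero)))
            (proj₁ (Adjacent-sym T (IsPath.adj P fzero (fsuc fzero) refl)))
            (proj₁ (IsPath.adj P (fsuc fzero) (fsuc (fsuc fzero)) refl))
            (IsPath.nonadj P fzero (fsuc (fsuc fzero)) (s≤s (s≤s z≤n))))
  ...   | no ne with HostWalk.c W | ≢⇒≡not (ne ∘ sym) | HostWalk.finish W | HostWalk.walk W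
  ...     | _ | refl | fin | w = record
    { c = c ; start = eq ; finish = fin
    ; walk = subst (λ v → Walk (Link p) v (endpoint (alternate k (not c)) (p (last (suc (suc k)))))) (sym eq)
        (go (fzero , fsuc fzero , refl , subst (Inc (p fzero)) eq (endpoint-inc c _) , endpoint-inc c _)
            (_ , edge-ends c (p (fsuc fzero)))
            (walk-map (λ (i , j , e , ii , ij) → fsuc i , fsuc j , cong suc e , ii , ij) w)) }

  module _ {k} {p : Fin (suc (suc k)) → Fin n} (P : IsPath T p) where
    open IsPath P

    private
      distinct : ∀ {i j} → toℕ i < toℕ j → p i ≢ p j
      distinct lt eq = ℕₚ.<-irrefl (cong toℕ (inj _ _ eq)) lt

    -- If the other end of the first edge were a meeting point, either the first two edges would
    -- share both ends, or two later consecutive edges would pass through it, the second of them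
    -- antiadjacent to the first edge of the path.
    link-avoids-first : ∀ {c v} → endpoint c (p fzero) ≡ endpoint c (p (fsuc fzero)) → Link p v →
      v ≢ endpoint (not c) (p fzero)
    link-avoids-first {c} eq (fzero , fsuc fzero , _ , _ , ij) refl =
      distinct (s≤s z≤n) (endpoints-injective c eq
        (trans ij (cong (λ d → endpoint d (p (fsuc fzero))) (side-endpoint (not c) _))))
    link-avoids-first {c} eq (fsuc i , j , e , ii , ij) refl =
      no-antiadjacent-pair-at (endpoint-inc (not c) (p fzero)) ij ii
        (distinct {fzero} {fsuc i} (s≤s z≤n) ∘ sym)
        (distinct (ℕₚ.≤-reflexive e))
        (nonadj fzero j (subst (1 <_) e (s≤s (s≤s z≤n))))

    link-avoids-last : ∀ {c v} →
      endpoint c (p (penultimate k)) ≡ endpoint c (p (last (suc k))) → Link p v →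
      v ≢ endpoint (not c) (p (last (suc k)))
    link-avoids-last {c} eq (i , j , e , ii , ij) refl with j Finₚ.≟ last (suc k)
    ... | yes refl = distinct {i} {j} (ℕₚ.≤-reflexive e) (endpoints-injective c
            (subst (λ i → endpoint c (p i) ≡ endpoint c (p j)) (sym i≡) eq)
            (sym (trans ii (cong (λ d → endpoint d (p i)) (side-endpoint (not c) _)))))
      where
      i≡ : i ≡ penultimate k
      i≡ = Finₚ.toℕ-injective (trans (ℕₚ.suc-injective (trans e (toℕ-last (suc k))))
             (sym (trans (Finₚ.toℕ-inject₁ (last k)) (toℕ-last k))))
    ... | no j≢ = no-antiadjacent-pair-at ii (endpoint-inc (not c) _) ij
            (distinct (ℕₚ.≤-reflexive e) ∘ sym) (distinct j<)
            (nonadj i (last (suc k)) (subst (_< toℕ (last (suc k))) (sym e) j<))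
      where
      j< : toℕ j < toℕ (last (suc k))
      j< = ℕₚ.≤∧≢⇒< (subst (toℕ j ≤_) (sym (toℕ-last (suc k))) (ℕₚ.≤-pred (Finₚ.toℕ<n j)))
             (j≢ ∘ Finₚ.toℕ-injective)

  Avoiding : V → V → V → Set
  Avoiding u v x = x ≢ u × x ≢ v

  endpoint-of : ∀ {e v} c → Inc e v → side v ≡ c → endpoint c e ≡ v
  endpoint-of {e} c i s = trans (cong (λ d → endpoint d e) (sym s)) (sym i)

  -- An odd path from e to f enters and leaves on the same side of the host graph.
  evenPair : ∀ {e f u v u′ v′} → Edge e u v → Edge f u′ v′ → side u ≡ side u′ → u ≢ u′ → v ≢ v′ →
    ¬ Walk (Avoiding v v′) u u′ → ¬ Walk (Avoiding u u′) v v′ → IsEvenPair T e f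
  evenPair {e} {f} {u} {v} {u′} {v′} ed fd s u≢ v≢ ¬uu′ ¬vv′ =
    disjoint-edges ed fd s u≢ v≢ , λ where
      zero p _ → refl
      (suc k) p (P , e≡ , f≡) → check k p P (sym e≡) (sym f≡)
    where
    s′ : side v ≡ side v′
    s′ = ≢∧≢⇒≡ (sides≢ ed ∘ sym) (λ q → sides≢ fd (trans (sym s) (sym q)))

    check : ∀ k p → IsPath T p → e ≡ p fzero → f ≡ p (last (suc k)) → Even (suc k)
    check k p P refl refl with hostWalk p P
    ... | W with even-or-odd k (HostWalk.c W)
    ...   | inj₂ (_ , odd) = alternate-≡⇒Even (suc k) (not (HostWalk.c W))
              (trans (cong (alternate k) (Boolₚ.not-involutive _)) odd)
    ...   | inj₁ (_ , even) with HostWalk.c W | HostWalk.start W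
                               | alternate k (HostWalk.c W) | even | HostWalk.finish W | HostWalk.walk W
    ...     | c | st | _ | refl | fin | w with side u Boolₚ.≟ c
    ...       | yes refl = ⊥-elim (¬uu′ (subst (λ x → Walk _ x u′) (endpoint-of c (incˡ ed) refl)
                  (subst (λ x → Walk _ _ x) (endpoint-of c (incˡ fd) (sym s))
                  (walk-map (λ l → (λ x≡ → link-avoids-first P st l (trans x≡ (sym (endpoint-of (not c) (incʳ ed) (sides ed)))))
                                 , (λ x≡ → link-avoids-last P fin l (trans x≡ (sym (endpoint-of (not c) (incʳ fd) (trans (sym s′) (sides ed)))))))
                    w))))
    ...       | no ne = ⊥-elim (¬vv′ (subst (λ x → Walk _ x v′) (endpoint-of c (incʳ ed) vc)
                  (subst (λ x → Walk _ _ x) (endpoint-of c (incʳ fd) (trans (sym s′) vc))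
                  (walk-map (λ l → (λ x≡ → link-avoids-first P st l (trans x≡ (sym (endpoint-of (not c) (incˡ ed) uc))))
                                 , (λ x≡ → link-avoids-last P fin l (trans x≡ (sym (endpoint-of (not c) (incˡ fd) (trans (sym s) uc))))))
                    w))))
      where
      vc : side v ≡ c
      vc = ≢∧≢⇒≡ (sides≢ ed ∘ sym) (ne ∘ sym)
      uc : side u ≡ not c
      uc = ≢⇒≡not (ne ∘ sym)

  Leaf : V → V → Set
  Leaf h q = ∀ g → E h g → g ≡ q

  branch? : ∀ h q → Dec (∃[ g ] (E h g × g ≢ q))
  branch? h q = any-vertex? (λ g → E? h g ×-dec ¬? (g ≟V q))

  no-branch⇒leaf : ∀ {h q} → ¬ (∃[ g ] (E h g × g ≢ q)) → Leaf h q
  no-branch⇒leaf {h} {q} ¬br g e = decidable-stable (g ≟V q) (λ g≢q → ¬br (g , e , g≢q))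

  Stuck : V → V → V → Set
  Stuck q u v = ∀ h → E q h → h ≢ u → h ≢ v → Leaf h q

  leaf-stuck : ∀ {h q u v} → Leaf h q → u ≡ q ⊎ v ≡ q → Stuck h u v
  leaf-stuck leaf (inj₁ refl) g e g≢u g≢v = ⊥-elim (g≢u (leaf g e))
  leaf-stuck leaf (inj₂ refl) g e g≢u g≢v = ⊥-elim (g≢v (leaf g e))

  -- While `u` and `v` are forbidden, `q` leads only to leaves, and a leaf leads only back to `q`.
  stuck-walk : ∀ {q u v x} → Stuck q u v → Walk (Avoiding u v) q x → side x ≡ side q → x ≡ q
  stuck-walk {q} {u} {v} stuck w s with walk-closed {S = λ x → x ≡ q ⊎ (E q x × Leaf x q)} closed w (inj₁ refl)
    where
    closed : ∀ {x y} → x ≡ q ⊎ (E q x × Leaf x q) → E x y → Avoiding u v y → y ≡ q ⊎ (E q y × Leaf y q)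
    closed (inj₁ refl) e (y≢u , y≢v) = inj₂ (e , stuck _ e y≢u y≢v)
    closed (inj₂ (_ , leaf)) e _     = inj₁ (leaf _ e)
  ... | inj₁ eq = eq
  ... | inj₂ (e , _) = ⊥-elim (E-sides≢ e (sym s))

  stuck-no-walk : ∀ {q q′ u v} → side q ≡ side q′ → q ≢ q′ → Stuck q u v ⊎ Stuck q′ u v →
    ¬ Walk (Avoiding u v) q q′
  stuck-no-walk s q≢ (inj₁ st) w = q≢ (sym (stuck-walk st w (sym s)))
  stuck-no-walk s q≢ (inj₂ st) w = q≢ (stuck-walk st (walk-sym w) s)

  -- Each of the two walks to be excluded is blocked as soon as one of its ends is stuck, so one
  -- stuck vertex on each side suffices.
  stuck-evenPair : ∀ {e f u v u′ v′} → Edge e u v → Edge f u′ v′ → side u ≡ side u′ → u ≢ u′ → v ≢ v′ →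
    Stuck u v v′ ⊎ Stuck u′ v v′ → Stuck v u u′ ⊎ Stuck v′ u u′ → IsEvenPair T e f
  stuck-evenPair {u = u} {v} {u′} {v′} ed fd s u≢ v≢ su sv = evenPair ed fd s u≢ v≢
    (stuck-no-walk s u≢ su)
    (stuck-no-walk (≢∧≢⇒≡ (sides≢ ed ∘ sym) (λ q → sides≢ fd (trans (sym s) (sym q)))) v≢ sv)

  rotate-path : ∀ {s xs u ys} → Path s (xs ++ u ∷ ys) s → Path u (ys ++ s ∷ xs) u
  rotate-path {xs = xs} p = let q , r = path-split xs p in path-++ r q

  -- One notion for a single vertex, an edge run through both ways and a genuine cycle, so that the
  -- ear argument serves all three.
  Cyclic : V → List V → Set
  Cyclic s O = (O ≡ [] ⊎ Path s O s) × Unique (s ∷ O)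

  rotate : ∀ {s O u} → Cyclic s O → u ∈ s ∷ O → ∃[ O′ ] (Cyclic u O′ × s ∷ O ↭ u ∷ O′)
  rotate cyc (here refl) = _ , cyc , ↭-refl
  rotate (inj₁ refl , _) (there ())
  rotate {s} {u = u} (inj₂ p , un) (there u∈) with ∈-∃++ u∈
  ... | xs , ys , refl = let perm = ++-comm (s ∷ xs) (u ∷ ys) in
        ys ++ s ∷ xs , (inj₂ (rotate-path {xs = xs} p) , Unique-resp-↭ perm un) , perm

  -- The ear through x₁, …, x₂ and the two arcs of the cycle would form an odd theta.
  ear : ∀ {Z s O u w x₁ x₂} → Cyclic s O → (∀ {v} → v ∈ s ∷ O → v ∈ Z) →
    u ∈ s ∷ O → w ∈ s ∷ O → side u ≡ side w → E x₁ u → E x₂ w → Walk (Off Z) x₁ x₂ → u ≡ w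
  ear {Z} {u = u} {w} {x₁} cyc O⊆Z u∈ w∈ su≡sw e₁ e₂ walk with u ≟V w
  ... | yes eq = eq
  ... | no u≢w with rotate cyc u∈
  ...   | O′ , (cyc′ , un) , perm with cyc′ | ∈-resp-↭ perm w∈
  ...     | _ | here eq = sym eq
  ...     | inj₁ refl | there ()
  ...     | inj₂ p | there w∈′ with ∈-∃++ w∈′ | induce (λ v → E? v w) walk e₂ | un
  ...       | ys , zs , refl | ks , ind | u≢ ∷ un′ with Unique-++⁻ ys un′ | path-split ys p
  ...         | uys , (w≢ ∷ uzs) , dis | p₁ , p₂ = ⊥-elim (no-odd-theta theta su≡sw)
    where
    in-Z : ∀ {v} → v ∈ u ∷ ys ++ w ∷ zs → v ∈ Z
    in-Z = O⊆Z ∘ ∈-resp-↭ (↭-sym perm)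
    ys⊆Z : ∀ {v} → v ∈ ys → v ∈ Z
    ys⊆Z = in-Z ∘ there ∘ ∈-++⁺ˡ
    zs⊆Z : ∀ {v} → v ∈ reverse zs → v ∈ Z
    zs⊆Z = in-Z ∘ there ∘ ∈-++⁺ʳ ys ∘ there ∘ ∈-resp-↭ (↭-reverse zs)
    off : ∀ {v} → v ∈ x₁ ∷ ks → v ∉ Z
    off = All.lookup (induced-all ind)
    I : Fin 3 → List V
    I fzero                = ys
    I (fsuc fzero)         = reverse zs
    I (fsuc (fsuc fzero)) = x₁ ∷ ks
    disjoint : ∀ i j {v} → i ≢ j → v ∈ I i → v ∉ I j
    disjoint fzero fzero i≢j _ _ = i≢j refl
    disjoint fzero (fsuc fzero) _ v∈ v∈′ = dis v∈ (there (∈-resp-↭ (↭-reverse zs) v∈′))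
    disjoint fzero (fsuc (fsuc fzero)) _ v∈ v∈′ = off v∈′ (ys⊆Z v∈)
    disjoint (fsuc fzero) fzero _ v∈ v∈′ = dis v∈′ (there (∈-resp-↭ (↭-reverse zs) v∈))
    disjoint (fsuc fzero) (fsuc fzero) i≢j _ _ = i≢j refl
    disjoint (fsuc fzero) (fsuc (fsuc fzero)) _ v∈ v∈′ = off v∈′ (zs⊆Z v∈)
    disjoint (fsuc (fsuc fzero)) fzero _ v∈ v∈′ = off v∈ (ys⊆Z v∈′)
    disjoint (fsuc (fsuc fzero)) (fsuc fzero) _ v∈ v∈′ = off v∈ (zs⊆Z v∈′)
    disjoint (fsuc (fsuc fzero)) (fsuc (fsuc fzero)) i≢j _ _ = i≢j refl
    theta : Theta u w I
    theta = record
      { u≢w = u≢w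
      ; paths = λ where
          fzero → p₁
          (fsuc fzero) → path-reverse p₂
          (fsuc (fsuc fzero)) → E-sym e₁ ∷ induced-path ind
      ; uniques = λ where
          fzero → uys
          (fsuc fzero) → Unique-resp-↭ (↭-sym (↭-reverse zs)) uzs
          (fsuc (fsuc fzero)) → induced-unique ind
      ; u∉ = λ where
          fzero → All≢⇒∉ (Allₚ.++⁻ˡ ys u≢)
          (fsuc fzero) u∈ → All≢⇒∉ u≢ (∈-++⁺ʳ ys (there (∈-resp-↭ (↭-reverse zs) u∈)))
          (fsuc (fsuc fzero)) u∈ → off u∈ (in-Z (here refl))
      ; w∉ = λ where
          fzero w∈ → dis w∈ (here refl)
          (fsuc fzero) w∈ → All≢⇒∉ w≢ (∈-resp-↭ (↭-reverse zs) w∈)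
          (fsuc (fsuc fzero)) w∈ → off w∈ (in-Z (there (∈-++⁺ʳ ys (here refl))))
      ; disjoint = disjoint _ _
      }

  -- Lobes attached to a cycle of the host graph, and the descent

  module Descent (Bad : Fin n → Set) where

    GoodPair : Set
    GoodPair = ∃[ e ] ∃[ f ] (IsEvenPair T e f × ¬ Bad e × ¬ Bad f)

    -- The component of y in the host graph minus Z attaches to Z only on the cycle s ∷ O
    -- (which may degenerate to a single vertex or to an edge), and is not just a leaf at s.
    record Lobe (Z O : List V) (s y z : V) : Set where
      field
        cyclic : Cyclic s O
        O⊆Z    : ∀ {v} → v ∈ s ∷ O → v ∈ Z
        y∉Z    : y ∉ Z
        sy     : E s y
        branch : ∃[ g ] (E y g × g ≢ s)
        z≢y    : z ≢ y
        sz     : ∃[ g ] (Edge g s z × ¬ Bad g)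
        closed : ∀ {v w} → Walk (Off Z) y v → E v w → w ∈ Z → w ∈ s ∷ O
        bad⊆Z  : ∀ {e v} → Bad e → Inc e v → v ∈ Z

    -- The edges `s q₁` and `q₂ q₃` form an even pair once `q₁` and `q₂` have only leaves as further
    -- neighbours. Otherwise such a neighbour that is not a leaf starts a lobe at `q₁` or `q₂`, with
    -- `q₁ q₂` or `q₂ q₃` as its reserved edge. All these edges are admissible because no bad edge
    -- meets `q₁` or `q₂`.
    cycle-end : ∀ {Z s q₁ q₂ q₃ rest} →
      Path s (q₁ ∷ q₂ ∷ q₃ ∷ rest) s → Unique (s ∷ q₁ ∷ q₂ ∷ q₃ ∷ rest) →
      (∀ {v} → v ∈ s ∷ q₁ ∷ q₂ ∷ q₃ ∷ rest → v ∈ Z) →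
      (∀ {e v} → Bad e → Inc e v → v ∈ Z) →
      (∀ {e} → Bad e → ¬ Inc e q₁ × ¬ Inc e q₂) →
      (∀ h → E q₁ h → h ∈ Z → h ≡ s ⊎ h ≡ q₂) →
      (∀ h → E q₂ h → h ∈ Z → h ≡ q₁ ⊎ h ≡ q₃) →
      (∀ {h v w} → h ∉ Z → E q₁ h ⊎ E q₂ h → Walk (Off Z) h v → E v w → w ∈ Z → w ∈ s ∷ q₁ ∷ q₂ ∷ q₃ ∷ rest) →
      (∀ {O s y z} → Lobe Z O s y z → GoodPair) → GoodPair
    cycle-end {Z} {s} {q₁} {q₂} {q₃} {rest} p@(e₁ ∷ e₂ ∷ e₃ ∷ p′) un@((_ ∷ s≢q₂ ∷ _) ∷ (_ ∷ q₁≢q₃ ∷ _) ∷ _)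
      O⊆Z bad⊆Z bad∉ chord₁ chord₂ closed rec
      with any-vertex? (λ h → (E? q₁ h ×-dec (¬? (h ≟V s) ×-dec ¬? (h ≟V q₂))) ×-dec branch? h q₁)
         | any-vertex? (λ h → (E? q₂ h ×-dec (¬? (h ≟V q₁) ×-dec ¬? (h ≟V q₃))) ×-dec branch? h q₂)
    ... | yes (h , (e , h≢s , h≢q₂) , br) | _ = let O′ , cyc′ , perm = rotate (inj₂ p , un) (there (here refl)) in
          rec (record
            { cyclic = cyc′ ; O⊆Z = O⊆Z ∘ ∈-resp-↭ (↭-sym perm) ; y∉Z = h∉ ; sy = e ; branch = br
            ; z≢y = h≢q₂ ∘ sym
            ; sz = proj₁ e₂ , proj₂ e₂ , λ bad → proj₁ (bad∉ bad) (incˡ (proj₂ e₂))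
            ; closed = λ w ev w∈ → ∈-resp-↭ perm (closed h∉ (inj₁ e) w ev w∈)
            ; bad⊆Z = bad⊆Z })
      where
      h∉ : h ∉ Z
      h∉ h∈ = [ h≢s , h≢q₂ ]′ (chord₁ h e h∈)
    ... | no _ | yes (h , (e , h≢q₁ , h≢q₃) , br) =
          let O′ , cyc′ , perm = rotate (inj₂ p , un) (there (there (here refl))) in
          rec (record
            { cyclic = cyc′ ; O⊆Z = O⊆Z ∘ ∈-resp-↭ (↭-sym perm) ; y∉Z = h∉ ; sy = e ; branch = br
            ; z≢y = h≢q₃ ∘ sym
            ; sz = proj₁ e₃ , proj₂ e₃ , λ bad → proj₂ (bad∉ bad) (incˡ (proj₂ e₃))
            ; closed = λ w ev w∈ → ∈-resp-↭ perm (closed h∉ (inj₂ e) w ev w∈)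
            ; bad⊆Z = bad⊆Z })
      where
      h∉ : h ∉ Z
      h∉ h∈ = [ h≢q₁ , h≢q₃ ]′ (chord₂ h e h∈)
    ... | no none₁ | no none₂ = proj₁ e₁ , proj₁ e₃ ,
          stuck-evenPair (proj₂ e₁) (proj₂ e₃) (E-side e₁ (E-sym e₂)) s≢q₂ q₁≢q₃
            (inj₂ λ h e h≢q₁ h≢q₃ → no-branch⇒leaf (λ br → none₂ (h , (e , h≢q₁ , h≢q₃) , br)))
            (inj₁ λ h e h≢s h≢q₂ → no-branch⇒leaf (λ br → none₁ (h , (e , h≢s , h≢q₂) , br))) ,
          (λ bad → proj₁ (bad∉ bad) (incʳ (proj₂ e₁))) ,
          (λ bad → proj₂ (bad∉ bad) (incˡ (proj₂ e₃)))

    induced-target : ∀ {A P y xs} → Induced A P y xs →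
      ∃[ v ] (P v × Walk A y v × (∀ {w} → E v w → Path y xs w))
    induced-target (end a p) = _ , p , stop a , arrive
    induced-target (step a _ e _ _ ind) = let v , p , w , f = induced-target ind in
      v , p , go a e w , (e ∷_) ∘ f

    induced-next : ∀ {A P q xs h} → Induced A P q xs → h ∈ xs → E q h → ∃[ r ] (xs ≡ h ∷ r)
    induced-next (step _ _ _ _ _ _) (here refl) _ = _ , refl
    induced-next (step _ _ _ none _ _) (there h∈) e = ⊥-elim (All.lookup none h∈ e)

    module _ {Z O s y z} (L : Lobe Z O s y z) where
      open Lobe L

      -- A second neighbour of `y` in `Z` would be a cycle vertex on the side of `s`, and `y` would
      -- be an ear between the two.
      attached : ∀ {h} → E y h → h ∈ Z → h ≡ s
      attached e h∈ = sym (ear cyclic O⊆Z (here refl) (closed (stop y∉Z) e h∈)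
                            (E-side sy (E-sym e)) (E-sym sy) e (stop y∉Z))

      -- Ears allow one attachment per side of the host graph. On the side of `s` it is `s` itself,
      -- so all others lie on the opposite side and coincide.
      attached-≡ : ∀ {v w v′ w′} → Walk (Off Z) y v → E v w → w ∈ Z → w ≢ s →
        Walk (Off Z) y v′ → E v′ w′ → w′ ∈ Z → w′ ≢ s → w ≡ w′
      attached-≡ {v} {w} {v′} {w′} yv vw w∈ w≢s yv′ vw′ w′∈ w′≢s =
        ear cyclic O⊆Z (closed yv vw w∈) (closed yv′ vw′ w′∈) (≢∧≢⇒≡ (opposite yv vw w∈ w≢s) (opposite yv′ vw′ w′∈ w′≢s))
          vw vw′ (walk-trans (walk-sym yv) yv′)
        where
        opposite : ∀ {v w} → Walk (Off Z) y v → E v w → w ∈ Z → w ≢ s → side w ≢ side s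
        opposite yv vw w∈ w≢s sw = w≢s (ear cyclic O⊆Z (closed yv vw w∈) (here refl) sw vw (E-sym sy) (walk-sym yv))

      -- The common last stage of two cases of the descent. The new cycle leaves `s` through `y`,
      -- `q` and the new vertices `xs`, and may then follow the old cycle. Once `y`, `q` and `xs`
      -- have joined `Z`, whatever hangs off `y` or `q` attaches only to the new cycle: to old
      -- vertices by the hypothesis on attachments, to new ones because they all lie on it.
      detour : ∀ {q tail} xs → Path s (y ∷ q ∷ tail) s → Unique (s ∷ y ∷ q ∷ tail) →
        All (Off Z) (y ∷ q ∷ xs) → All (λ h → ¬ E y h) xs →
        (∀ {v} → v ∈ tail → v ∈ xs ⊎ v ∈ s ∷ O) → (∀ {v} → v ∈ xs → v ∈ tail) →
        (∀ {h} → E q h → h ∈ xs ⊎ h ∈ Z → ∃[ r ] (tail ≡ h ∷ r)) →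
        (∀ {v w} → Walk (Off Z) y v → E v w → w ∈ Z → w ≡ s ⊎ w ∈ tail) →
        (∀ {Z′ O s y z} → free Z′ < free Z → Lobe Z′ O s y z → GoodPair) → GoodPair
      -- Here the cycle would be a triangle in a bipartite graph.
      detour {tail = []} _ (sy ∷ yq ∷ arrive qs) _ _ _ _ _ _ _ _ =
        ⊥-elim (E-sides≢ qs (E-side (E-sym yq) sy))
      detour {q} {q₃ ∷ rest} xs p@(_ ∷ yq ∷ _) un off none tail⊆ xs⊆ chord attach rec =
        cycle-end p un in-Z′ (λ bad i → old (bad⊆Z bad i))
          (λ bad → (λ i → y∉Z (bad⊆Z bad i)) , (λ i → q∉Z (bad⊆Z bad i)))
          chord₁ chord₂ closed′ (rec (free-< old y∉Z (here refl)))
        where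
        Z′ : List V
        Z′ = y ∷ q ∷ xs ++ Z
        old : ∀ {v} → v ∈ Z → v ∈ Z′
        old = there ∘ there ∘ ∈-++⁺ʳ xs
        q∉Z : q ∉ Z
        q∉Z = All.lookup off (there (here refl))
        in-Z′ : ∀ {v} → v ∈ s ∷ y ∷ q ∷ q₃ ∷ rest → v ∈ Z′
        in-Z′ (here refl)                 = old (O⊆Z (here refl))
        in-Z′ (there (here refl))         = here refl
        in-Z′ (there (there (here refl))) = there (here refl)
        in-Z′ (there (there (there v∈)))  =
          [ there ∘ there ∘ ∈-++⁺ˡ , old ∘ O⊆Z ]′ (tail⊆ v∈)
        chord₁ : ∀ h → E y h → h ∈ Z′ → h ≡ s ⊎ h ≡ q
        chord₁ h e (here refl)         = ⊥-elim (E-irrefl e)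
        chord₁ h e (there (here refl)) = inj₂ refl
        chord₁ h e (there (there h∈)) with ∈-++⁻ xs h∈
        ... | inj₁ h∈xs = ⊥-elim (All.lookup none h∈xs e)
        ... | inj₂ h∈Z  = inj₁ (attached e h∈Z)
        chord₂ : ∀ h → E q h → h ∈ Z′ → h ≡ y ⊎ h ≡ q₃
        chord₂ h e (here refl)         = inj₁ refl
        chord₂ h e (there (here refl)) = ⊥-elim (E-irrefl e)
        chord₂ h e (there (there h∈)) with chord e (∈-++⁻ xs h∈)
        ... | _ , refl = inj₂ refl
        closed′ : ∀ {h v w} → h ∉ Z′ → E y h ⊎ E q h → Walk (Off Z′) h v → E v w → w ∈ Z′ →
          w ∈ s ∷ y ∷ q ∷ q₃ ∷ rest
        closed′ _ _ _ _ (here refl)         = there (here refl)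
        closed′ _ _ _ _ (there (here refl)) = there (there (here refl))
        closed′ {h} {v} h∉ e wlk ev (there (there w∈)) with ∈-++⁻ xs w∈
        ... | inj₁ w∈xs = there (there (there (xs⊆ w∈xs)))
        ... | inj₂ w∈Z  = [ here , there ∘ there ∘ there ]′ (attach (from-y e) ev w∈Z)
          where
          wlk′ : Walk (Off Z) h v
          wlk′ = walk-map (λ v∉ → v∉ ∘ old) wlk
          from-y : E y h ⊎ E q h → Walk (Off Z) y v
          from-y (inj₁ e) = go y∉Z e wlk′
          from-y (inj₂ e) = go y∉Z yq (go q∉Z e wlk′)

    -- If the lobe touches `Z` at some `w` other than `s`, the cycle is rerouted through the lobe to
    -- `w` and back along an old arc. If the lobe without `y` still returns to `s`, it contains with
    -- `s` a new cycle. Otherwise `y` separates the rest of the lobe from `Z` and becomes a cycle of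
    -- one vertex, with `y s` as reserved edge.
    descend-acc : ∀ {Z O s y z} → Acc _<_ (free Z) → Lobe Z O s y z → GoodPair
    descend-acc {Z} {O} {s} {y} {z} (acc rec) L = attempt₁ (reach? Z target? y)
      where
      open Lobe L

      IH : ∀ {Z′ O s y z} → free Z′ < free Z → Lobe Z′ O s y z → GoodPair
      IH lt = descend-acc (rec lt)

      Target : V → Set
      Target v = ∃[ w ] (w ∈ Z × w ≢ s × E v w)

      target? : ∀ v → Dec (Target v)
      target? v = any-vertex? (λ w → (w ∈? Z) ×-dec (¬? (w ≟V s) ×-dec E? v w))

      -- Two steps from `y` lead back to the side of `y`, whereas `s` is on the other one.
      q-opposite : ∀ {q h} → E y q → E q h → h ≢ s
      q-opposite yq qs refl = E-sides≢ qs (E-side (E-sym yq) sy)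

      around : ∃ (Induced (Off Z) Target y) → GoodPair
      around (_ , end _ (w , w∈ , w≢s , e)) = ⊥-elim (w≢s (attached L e w∈))
      around (_ , ind@(step {x = q} {xs} _ _ yq noneY _ ind′)) with induced-target ind
      ... | v , (w , w∈ , w≢s , vw) , yv , mkPath with closed yv vw w∈ | cyclic
      ...   | here eq | _ = ⊥-elim (w≢s eq)
      ...   | there () | inj₁ refl , _
      ...   | there w∈O | inj₂ pO , unO with ∈-∃++ w∈O
      ...     | ts , zs , refl with Unique-++⁻ (s ∷ ts) unO | path-split ts pO
      ...       | _ , uwzs , dis | _ , pzs =
        detour L xs (sy ∷ path-++ (mkPath vw) pzs)
          (∉⇒All≢ s∉ ∷ Uniqueₚ.++⁺ (induced-unique ind) uwzs (λ (v∈ , v∈′) → off v∈ (O⊆Z (there (∈-++⁺ʳ ts v∈′)))))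
          (induced-all ind) noneY
          (Sum.map₂ (there ∘ ∈-++⁺ʳ ts) ∘ ∈-++⁻ xs) ∈-++⁺ˡ
          (λ e → [ (λ h∈ → let r , eq = induced-next ind′ h∈ e in r ++ w ∷ zs , cong (_++ w ∷ zs) eq)
                 , into-Z ind′ e ]′)
          (λ {v′} {w′} yv′ vw′ w′∈ → case w′ ≟V s of λ where
            (yes eq) → inj₁ eq
            (no ne) → inj₂ (∈-++⁺ʳ xs (here (attached-≡ L yv′ vw′ w′∈ ne yv vw w∈ w≢s))))
          IH
        where
        off : ∀ {v} → v ∈ y ∷ q ∷ xs → v ∉ Z
        off = All.lookup (induced-all ind)
        s∉ : s ∉ (y ∷ q ∷ xs) ++ w ∷ zs
        s∉ s∈ = [ (λ s∈ → off s∈ (O⊆Z (here refl))) , dis (here refl) ]′ (∈-++⁻ (y ∷ q ∷ xs) s∈)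
        into-Z : ∀ {xs h} → Induced (Off Z) Target q xs → E q h → h ∈ Z → ∃[ r ] (xs ++ w ∷ zs ≡ h ∷ r)
        into-Z (step _ ¬p _ _ _ _) e h∈ = ⊥-elim (¬p (_ , h∈ , q-opposite yq e , e))
        into-Z (end q∉ _) e h∈ =
          zs , cong (_∷ zs) (sym (attached-≡ L (go y∉Z yq (stop q∉)) e h∈ (q-opposite yq e) yv vw w∈ w≢s))

      module _ (none : ¬ (∃[ v ] (Walk (Off Z) y v × Target v))) where

        only-s : ∀ {v w} → Walk (Off Z) y v → E v w → w ∈ Z → w ≡ s
        only-s {w = w} yv vw w∈ with w ≟V s
        ... | yes eq = eq
        ... | no ne  = ⊥-elim (none (_ , yv , w , w∈ , ne , vw))

        back : ∀ {y′ v} → E y y′ → Walk (Off (y ∷ Z)) y′ v → E v s → GoodPair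
        back yy′ wlk vs with induce (λ v → E? v s) wlk vs
        ... | _ , ind with last-neighbour yy′ ind
        ...   | q , xs , yq , noneY , ind′ , _ =
          detour L xs (sy ∷ yq ∷ induced-path ind′)
            (∉⇒All≢ s∉ ∷ ∉⇒All≢ (λ y∈ → All.lookup (induced-all ind′) y∈ (here refl)) ∷ induced-unique ind′)
            (y∉Z ∷ All.map (λ v∉ → v∉ ∘ there) (induced-all ind′)) noneY inj₁ id
            (λ e → [ (λ h∈ → induced-next ind′ h∈ e)
                   , (λ h∈ → ⊥-elim (q-opposite yq e (only-s (go y∉Z yq (stop q∉)) e h∈))) ]′)
            (λ yv vw w∈ → inj₁ (only-s yv vw w∈))
            IH
          where
          q∉ : q ∉ Z
          q∉ = All.lookup (induced-all ind′) (here refl) ∘ there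
          s∉ : s ∉ y ∷ q ∷ xs
          s∉ (here refl) = E-irrefl sy
          s∉ (there s∈)  = All.lookup (induced-all ind′) s∈ (there (O⊆Z (here refl)))

        module _ (none′ : ¬ (∃[ y′ ] (E y y′ × ∃[ v ] (Walk (Off (y ∷ Z)) y′ v × E v s)))) where

          deeper : Dec (∃[ y′ ] ((E y y′ × y′ ≢ s) × ∃[ g ] (E y′ g × g ≢ y))) → GoodPair
          deeper (yes (y′ , (yy′ , y′≢s) , br)) =
            IH (free-< there y∉Z (here refl)) (record
              { cyclic = inj₁ refl , [] ∷ []
              ; O⊆Z = λ { (here refl) → here refl }
              ; y∉Z = y′∉ ; sy = yy′ ; branch = br
              ; z≢y = y′≢s ∘ sym
              ; sz = proj₁ sy , edge-sym (proj₂ sy) , λ bad → y∉Z (bad⊆Z bad (incʳ (proj₂ sy)))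
              ; closed = λ where
                  w e (here refl) → here refl
                  w e (there w∈) → ⊥-elim (none′ (y′ , yy′ , _ , w , subst (E _)
                    (only-s (go y∉Z yy′ (walk-map (λ v∉ → v∉ ∘ there) w)) e w∈) e))
              ; bad⊆Z = λ bad i → there (bad⊆Z bad i) })
            where
            y′∉ : y′ ∉ y ∷ Z
            y′∉ (here refl) = E-irrefl yy′
            y′∉ (there y′∈) = y′≢s (attached L yy′ y′∈)
          -- All neighbours of `y` other than `s` are leaves. The edge from `y` to such a leaf `y′`
          -- and the reserved edge `s z` are an even pair, blocked at `y′` and at `y`.
          deeper (no ¬br) = let y′ , yy′ , y′≢s = branch ; g , gd , ¬bad = sz in
            proj₁ yy′ , g ,
            stuck-evenPair (edge-sym (proj₂ yy′)) gd (E-side (E-sym yy′) sy) y′≢s (z≢y ∘ sym)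
              (inj₁ (leaf-stuck (leaf yy′ y′≢s) (inj₁ refl)))
              (inj₁ λ h e _ h≢s → leaf e h≢s) ,
            (λ bad → y∉Z (bad⊆Z bad (incˡ (proj₂ yy′)))) , ¬bad
            where
            leaf : ∀ {h} → E y h → h ≢ s → Leaf h y
            leaf {h} e h≢s = no-branch⇒leaf (λ br → ¬br (h , (e , h≢s) , br))

        attempt₂ : Dec (∃[ y′ ] (E y y′ × ∃[ v ] (Walk (Off (y ∷ Z)) y′ v × E v s))) → GoodPair
        attempt₂ (yes (_ , yy′ , _ , wlk , vs)) = back yy′ wlk vs
        attempt₂ (no none′) = deeper none′
          (any-vertex? (λ y′ → (E? y y′ ×-dec ¬? (y′ ≟V s)) ×-dec branch? y′ y))

      attempt₁ : Dec (∃[ v ] (Walk (Off Z) y v × Target v)) → GoodPair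
      attempt₁ (yes (_ , yv , t)) = around (induce target? yv t)
      attempt₁ (no none) = attempt₂ none
        (any-vertex? (λ y′ → E? y y′ ×-dec reach? (y ∷ Z) (λ v → E? v s) y′))

    descend : ∀ {Z O s y z} → Lobe Z O s y z → GoodPair
    descend = descend-acc (<-wellFounded _)

  strongAnti⇒disjoint : ∀ {e f u v u′ v′} → Edge e u v → Edge f u′ v′ → StronglyAntiadjacent T e f →
    u ≢ u′ × v ≢ v′
  strongAnti⇒disjoint ed fd ef =
    (λ { refl → adj⇒¬strongAnti T (meet⇒adj (proj₁ ef) (incˡ ed) (incˡ fd)) ef }) ,
    (λ { refl → adj⇒¬strongAnti T (meet⇒adj (proj₁ ef) (incʳ ed) (incʳ fd)) ef })

  path-walk : ∀ {A : V → Set} {u xs v w} → (∀ {x} → x ∈ u ∷ xs ++ v ∷ [] → A x) →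
    Path u xs v → w ∈ u ∷ xs ++ v ∷ [] → Walk A u w
  path-walk all p (here refl) = stop (all (here refl))
  path-walk all (arrive e) (there (here refl)) = go (all (here refl)) e (stop (all (there (here refl))))
  path-walk all (e ∷ p) (there w∈) = go (all (here refl)) e (path-walk (all ∘ there) p w∈)

  record StarAt (a p : V) (Z : List V) : Set where
    field
      centre : V
      leafᵛ  : V
      a-c    : E a centre
      c∉Z    : centre ∉ Z
      nbrs-a : ∀ {h} → E a h → h ≡ p ⊎ h ≡ centre
      c-l    : E centre leafᵛ
      l≢a    : leafᵛ ≢ a
      leaves : ∀ {h} → E centre h → h ≢ a → Leaf h centre

  -- Even pairs that avoid a chain of switchable edges

  module LinePairs (Bad : Fin n → Set) (Bad? : ∀ e → Dec (Bad e)) where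

    open Descent Bad

    -- The edge `e` serves as a degenerate cycle and as reserved edge. If no neighbour of its ends
    -- starts a lobe, both ends are stuck, and `e` forms an even pair with every edge strongly
    -- antiadjacent to it.
    from-edge : ∀ {Z e f u v u′ v′} → Edge e u v → Edge f u′ v′ → side u ≡ side u′ →
      StronglyAntiadjacent T e f → ¬ Bad e → ¬ Bad f →
      u ∈ Z → v ∈ Z → (∀ {e v} → Bad e → Inc e v → v ∈ Z) →
      (∀ {h} → E u h ⊎ E v h → h ∈ Z → h ≡ u ⊎ h ≡ v) →
      (∀ {h x w} → E u h ⊎ E v h → Walk (Off Z) h x → E x w → w ∈ Z → w ≡ u ⊎ w ≡ v) → GoodPair
    from-edge {Z} {e} {f} {u} {v} ed fd s ef ¬be ¬bf u∈ v∈ bad⊆Z adjacent closed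
      with any-vertex? (λ h → (E? u h ×-dec ¬? (h ≟V v)) ×-dec branch? h u)
         | any-vertex? (λ h → (E? v h ×-dec ¬? (h ≟V u)) ×-dec branch? h v)
    ... | yes (h , (uh , h≢v) , br) | _ = descend (record
          { cyclic = inj₂ ((e , ed) ∷ arrive (e , edge-sym ed)) , (edge-≢ ed ∷ []) ∷ [] ∷ []
          ; O⊆Z = λ { (here refl) → u∈ ; (there (here refl)) → v∈ }
          ; y∉Z = λ h∈ → [ (λ { refl → E-irrefl uh }) , h≢v ]′ (adjacent (inj₁ uh) h∈)
          ; sy = uh ; branch = br ; z≢y = h≢v ∘ sym ; sz = e , ed , ¬be
          ; closed = λ w xw w∈ → [ here , there ∘ here ]′ (closed (inj₁ uh) w xw w∈)
          ; bad⊆Z = bad⊆Z })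
    ... | no _ | yes (h , (vh , h≢u) , br) = descend (record
          { cyclic = inj₂ ((e , edge-sym ed) ∷ arrive (e , ed)) , ((edge-≢ ed ∘ sym) ∷ []) ∷ [] ∷ []
          ; O⊆Z = λ { (here refl) → v∈ ; (there (here refl)) → u∈ }
          ; y∉Z = λ h∈ → [ h≢u , (λ { refl → E-irrefl vh }) ]′ (adjacent (inj₂ vh) h∈)
          ; sy = vh ; branch = br ; z≢y = h≢u ∘ sym ; sz = e , edge-sym ed , ¬be
          ; closed = λ w xw w∈ → [ there ∘ here , here ]′ (closed (inj₂ vh) w xw w∈)
          ; bad⊆Z = bad⊆Z })
    ... | no none₁ | no none₂ = let u≢ , v≢ = strongAnti⇒disjoint ed fd ef in
          e , f , stuck-evenPair ed fd s u≢ v≢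
            (inj₁ λ h uh h≢v _ → no-branch⇒leaf (λ br → none₁ (h , (uh , h≢v) , br)))
            (inj₁ λ h vh h≢u _ → no-branch⇒leaf (λ br → none₂ (h , (vh , h≢u) , br))) , ¬be , ¬bf

    -- A switchable component seen in the host graph: a path from `a` to `b` whose inner vertices
    -- `ds` have neighbours only on it and meet only bad edges. Here `p` and `q` are the inner
    -- vertices next to `a` and `b`; they coincide for a small component. The small and the light
    -- case differ afterwards only in two arguments of `chain-pair`.
    record Chain (a b p q : V) (ds : List V) : Set where
      field
        path     : Path a ds b
        a≢b      : a ≢ b
        a∉       : a ∉ ds
        b∉       : b ∉ ds
        uniq     : Unique ds
        p∈       : p ∈ ds
        q∈       : q ∈ ds
        nbrs     : ∀ {d h} → d ∈ ds → E d h → h ∈ a ∷ b ∷ ds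
        a-p      : ∀ {h} → E a h → h ∈ ds → h ≡ p
        b-q      : ∀ {h} → E b h → h ∈ ds → h ≡ q
        no-ab    : ¬ E a b
        bad-ends : ∀ {g v} → Bad g → Inc g v → v ∈ a ∷ b ∷ ds
        inc-bad  : ∀ {g d} → d ∈ ds → Inc g d → Bad g

    flip-∈ : ∀ {a b ds} {v : V} → v ∈ a ∷ b ∷ ds → v ∈ b ∷ a ∷ reverse ds
    flip-∈ (here eq) = there (here eq)
    flip-∈ (there (here eq)) = here eq
    flip-∈ {ds = ds} (there (there v∈)) = there (there (∈-resp-↭ (↭-sym (↭-reverse ds)) v∈))

    flip : ∀ {a b p q ds} → Chain a b p q ds → Chain b a q p (reverse ds)
    flip {ds = ds} C = record
      { path = path-reverse path ; a≢b = a≢b ∘ sym ; a∉ = b∉ ∘ un ; b∉ = a∉ ∘ un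
      ; uniq = Unique-resp-↭ (↭-sym (↭-reverse ds)) uniq
      ; p∈ = ∈-resp-↭ (↭-sym (↭-reverse ds)) q∈ ; q∈ = ∈-resp-↭ (↭-sym (↭-reverse ds)) p∈
      ; nbrs = λ d∈ e → flip-∈ (nbrs (un d∈) e)
      ; a-p = λ e h∈ → b-q e (un h∈) ; b-q = λ e h∈ → a-p e (un h∈)
      ; no-ab = no-ab ∘ E-sym
      ; bad-ends = λ bad i → flip-∈ (bad-ends bad i)
      ; inc-bad = λ d∈ → inc-bad (un d∈) }
      where
      open Chain C
      un : ∀ {v} → v ∈ reverse ds → v ∈ ds
      un = ∈-resp-↭ (↭-reverse ds)

    module _ {a b p q ds} (C : Chain a b p q ds) where
      open Chain C

      private
        Z₀ : List V
        Z₀ = a ∷ b ∷ ds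

      beyond : ∀ {h} → E a h → h ≢ p → h ∉ Z₀
      beyond e h≢p (here refl)         = E-irrefl e
      beyond e h≢p (there (here refl)) = no-ab e
      beyond e h≢p (there (there h∈))  = h≢p (a-p e h∈)

      off-inside : ∀ {v d} → v ∉ Z₀ → E v d → d ∉ ds
      off-inside v∉ e d∈ = v∉ (nbrs d∈ (E-sym e))

      Separated : Set
      Separated = ∀ {r v} → E a r → Walk (Off Z₀) r v → ¬ E v b

      -- A neighbour `h` of `a` off the chain that is not a leaf starts a lobe at `a`, provided
      -- another neighbour `z` supplies the reserved edge `a z`. Failing this, `a h` can be reserved
      -- for a lobe at `h`. If that has no start either, `a` sees only `p` and `h`, and everything
      -- else at `h` is a leaf.
      lobes-at-end : Separated → GoodPair ⊎ (∀ {h} → E a h → h ≢ p → Leaf h a) ⊎ StarAt a p Z₀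
      lobes-at-end sep with any-vertex? (λ h → (E? a h ×-dec ¬? (h ≟V p)) ×-dec branch? h a)
      ... | no none = inj₂ (inj₁ λ {h} e h≢p → no-branch⇒leaf (λ br → none (h , (e , h≢p) , br)))
      ... | yes (h , (ah , h≢p) , br@(l , hl , l≢a))
        with any-vertex? (λ z → E? a z ×-dec (¬? (z ≟V p) ×-dec ¬? (z ≟V h)))
      ...   | yes (z , az , z≢p , z≢h) = inj₁ (descend (record
              { cyclic = inj₁ refl , [] ∷ []
              ; O⊆Z = λ { (here refl) → here refl }
              ; y∉Z = beyond ah h≢p ; sy = ah ; branch = br ; z≢y = z≢h
              ; sz = proj₁ az , proj₂ az , λ bad → beyond az z≢p (bad-ends bad (incʳ (proj₂ az)))
              ; closed = λ where
                  w e (here refl) → here refl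
                  w e (there (here refl)) → ⊥-elim (sep ah w e)
                  w e (there (there w∈)) → ⊥-elim (off-inside (walk-end w) e w∈)
              ; bad⊆Z = bad-ends }))
      ...   | no only with any-vertex? (λ g → (E? h g ×-dec ¬? (g ≟V a)) ×-dec branch? g h)
      ...     | yes (g , (hg , g≢a) , br′) = inj₁ (descend (record
              { cyclic = inj₁ refl , [] ∷ []
              ; O⊆Z = λ { (here refl) → here refl }
              ; y∉Z = λ where
                  (here refl) → E-irrefl hg
                  (there (here refl)) → g≢a refl
                  (there (there (here refl))) → sep ah (stop h∉) hg
                  (there (there (there g∈))) → off-inside h∉ hg g∈
              ; sy = hg ; branch = br′ ; z≢y = g≢a ∘ sym
              ; sz = proj₁ ah , edge-sym (proj₂ ah) , λ bad → h∉ (bad-ends bad (incʳ (proj₂ ah)))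
              ; closed = λ where
                  w e (here refl) → here refl
                  w e (there (here refl)) → ⊥-elim (escape w (E-sym e))
                  w e (there (there (here refl))) → ⊥-elim (sep ah (go h∉ hg (walk-map (λ v∉ → v∉ ∘ there) w)) e)
                  w e (there (there (there w∈))) → ⊥-elim (off-inside (walk-end w ∘ there) e w∈)
              ; bad⊆Z = λ bad i → there (bad-ends bad i) }))
              where
              h∉ : h ∉ Z₀
              h∉ = beyond ah h≢p
              escape : ∀ {g v} → Walk (Off (h ∷ Z₀)) g v → ¬ E a v
              escape {v = v} w av with v ≟V p | v ≟V h
              ... | yes refl | _ = walk-end w (there (there (there p∈)))
              ... | no _ | yes refl = walk-end w (here refl)
              ... | no v≢p | no v≢h = only (v , av , v≢p , v≢h)
      ...     | no none = inj₂ (inj₂ (record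
              { centre = h ; leafᵛ = l ; a-c = ah ; c∉Z = beyond ah h≢p
              ; nbrs-a = nbrs-a
              ; c-l = hl ; l≢a = l≢a
              ; leaves = λ {g} e g≢a → no-branch⇒leaf (λ br → none (g , (e , g≢a) , br)) }))
              where
              nbrs-a : ∀ {z} → E a z → z ≡ p ⊎ z ≡ h
              nbrs-a {z} az with z ≟V p | z ≟V h
              ... | yes eq | _      = inj₁ eq
              ... | no _   | yes eq = inj₂ eq
              ... | no z≢p | no z≢h = ⊥-elim (only (z , az , z≢p , z≢h))

      far-end : ∀ {c} → E b c → c ≢ q → c ∉ Z₀
      far-end bc c≢q (here refl)         = no-ab (E-sym bc)
      far-end bc c≢q (there (here refl)) = E-irrefl bc
      far-end bc c≢q (there (there c∈))  = c≢q (b-q bc c∈)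

      -- The pair consists of `b c` and an edge at the centre, chosen by parity: a leaf edge if `a`
      -- and `b` are on the same side, the edge to `a` otherwise. One walk is blocked at the star;
      -- the other is trapped because star and chain can be left only through `b`, which it must
      -- avoid.
      star-pair : StarAt a p Z₀ → Separated → ∀ {c} → E b c → c ≢ q → GoodPair
      star-pair S sep {c} bc c≢q with side a Boolₚ.≟ side b
      ... | yes sab = proj₁ c-l , proj₁ bc ,
            evenPair (edge-sym (proj₂ c-l)) (proj₂ bc) (trans (E-side (E-sym c-l) a-c) sab)
              (λ { refl → centre≁b c-l }) (λ { refl → centre≁b (E-sym bc) })
              (λ w → centre≁b (subst (E centre) (sym (stuck-walk (leaf-stuck (leaves c-l l≢a) (inj₁ refl)) w
                (trans (sym sab) (E-side a-c (E-sym c-l))))) c-l))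
              (λ w → outside (walk-closed closed w (inj₁ refl))) ,
            (λ bad → c∉Z (bad-ends bad (incˡ (proj₂ c-l)))) ,
            (λ bad → far-end bc c≢q (bad-ends bad (incʳ (proj₂ bc))))
        where
        open StarAt S
        centre≁b : ¬ E centre b
        centre≁b = sep a-c (stop c∉Z)
        Side : V → Set
        Side v = v ≡ centre ⊎ v ≡ a ⊎ v ∈ ds ⊎ Leaf v centre
        closed : ∀ {v h} → Side v → E v h → Avoiding leafᵛ b h → Side h
        closed {h = h} (inj₁ refl) e _ with h ≟V a
        ... | yes eq = inj₂ (inj₁ eq)
        ... | no ne  = inj₂ (inj₂ (inj₂ (leaves e ne)))
        closed (inj₂ (inj₁ refl)) e _ with nbrs-a e
        ... | inj₁ refl = inj₂ (inj₂ (inj₁ p∈))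
        ... | inj₂ eq   = inj₁ eq
        closed (inj₂ (inj₂ (inj₁ v∈))) e (_ , h≢b) with nbrs v∈ e
        ... | here eq          = inj₂ (inj₁ eq)
        ... | there (here eq)  = ⊥-elim (h≢b eq)
        ... | there (there h∈) = inj₂ (inj₂ (inj₁ h∈))
        closed (inj₂ (inj₂ (inj₂ leaf))) e _ = inj₁ (leaf _ e)
        outside : ¬ Side c
        outside (inj₁ refl) = centre≁b (E-sym bc)
        outside (inj₂ (inj₁ refl)) = no-ab (E-sym bc)
        outside (inj₂ (inj₂ (inj₁ c∈))) = c≢q (b-q bc c∈)
        outside (inj₂ (inj₂ (inj₂ leaf))) = c∉Z (subst (_∈ Z₀) (leaf _ (E-sym bc)) (there (here refl)))
      ... | no sab = proj₁ a-c , proj₁ bc ,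
            evenPair (edge-sym (proj₂ a-c)) (proj₂ bc)
              (≢∧≢⇒≡ (E-sides≢ (E-sym a-c)) (sab ∘ sym))
              (λ { refl → c∉Z (there (here refl)) }) (λ { refl → no-ab (E-sym bc) })
              (stuck-no-walk (≢∧≢⇒≡ (E-sides≢ (E-sym a-c)) (sab ∘ sym)) (λ { refl → c∉Z (there (here refl)) })
                (inj₁ λ h e h≢a _ → leaves e h≢a))
              (λ w → outside (walk-closed closed w (inj₁ refl))) ,
            (λ bad → c∉Z (bad-ends bad (incʳ (proj₂ a-c)))) ,
            (λ bad → far-end bc c≢q (bad-ends bad (incʳ (proj₂ bc))))
        where
        open StarAt S
        Side : V → Set
        Side v = v ≡ a ⊎ v ∈ ds
        closed : ∀ {v h} → Side v → E v h → Avoiding centre b h → Side h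
        closed (inj₁ refl) e (h≢c , _) with nbrs-a e
        ... | inj₁ refl = inj₂ p∈
        ... | inj₂ eq   = ⊥-elim (h≢c eq)
        closed (inj₂ v∈) e (_ , h≢b) with nbrs v∈ e
        ... | here eq          = inj₁ eq
        ... | there (here eq)  = ⊥-elim (h≢b eq)
        ... | there (there h∈) = inj₂ h∈
        outside : ¬ Side c
        outside (inj₁ refl) = no-ab (E-sym bc)
        outside (inj₂ c∈)   = c≢q (b-q bc c∈)

      Connected : Set
      Connected = ∀ {g} → ¬ Bad g → ∃[ v ] (Inc g v × Walk (λ _ → ⊤) a v)

      inc-edge : ∀ {g v} → Inc g v → ∃[ v′ ] Edge g v v′
      inc-edge {g} {v} i = endpoint (not (side v)) g ,
        mkEdge i (endpoint-inc (not (side v)) g) (side-endpoint (not (side v)) g)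

      -- Chain and star now form a whole component of the host graph, so all admissible edges pass
      -- through the centre and are pairwise adjacent.
      star-only : StarAt a p Z₀ → Connected → ¬ (∃[ c ] (E b c × c ≢ q)) →
        ∀ {e f} → StronglyAntiadjacent T e f → ¬ Bad e → ¬ Bad f → ⊥
      star-only S conn none ef ¬be ¬bf =
        adj⇒¬strongAnti T (meet⇒adj (proj₁ ef) (at-centre ¬be) (at-centre ¬bf)) ef
        where
        open StarAt S
        Side : V → Set
        Side v = v ∈ Z₀ ⊎ v ≡ centre ⊎ Leaf v centre
        closed : ∀ {v h} → Side v → E v h → ⊤ → Side h
        closed (inj₁ (here refl)) e _ with nbrs-a e
        ... | inj₁ refl = inj₁ (there (there p∈))
        ... | inj₂ eq   = inj₂ (inj₁ eq)
        closed {h = h} (inj₁ (there (here refl))) e _ with h ≟V q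
        ... | yes refl = inj₁ (there (there q∈))
        ... | no ne    = ⊥-elim (none (_ , e , ne))
        closed (inj₁ (there (there v∈))) e _ = inj₁ (nbrs v∈ e)
        closed {h = h} (inj₂ (inj₁ refl)) e _ with h ≟V a
        ... | yes refl = inj₁ (here refl)
        ... | no ne    = inj₂ (inj₂ (leaves e ne))
        closed (inj₂ (inj₂ leaf)) e _ = inj₂ (inj₁ (leaf _ e))
        at-centre : ∀ {g} → ¬ Bad g → Inc g centre
        at-centre {g} ¬bg with conn ¬bg
        ... | v , i , w with walk-closed closed w (inj₁ (here refl)) | inc-edge i
        ...   | inj₂ (inj₁ refl) | _ = i
        ...   | inj₂ (inj₂ leaf) | v′ , gd = subst (Inc g) (leaf v′ (g , gd)) (incʳ gd)
        ...   | inj₁ (there (there v∈)) | _ = ⊥-elim (¬bg (inc-bad v∈ i))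
        ...   | inj₁ (here refl) | v′ , gd with nbrs-a (g , gd)
        ...     | inj₁ refl = ⊥-elim (¬bg (inc-bad p∈ (incʳ gd)))
        ...     | inj₂ refl = incʳ gd
        at-centre {g} ¬bg | v , i , w | inj₁ (there (here refl)) | v′ , gd with v′ ≟V q
        ... | yes refl = ⊥-elim (¬bg (inc-bad q∈ (incʳ gd)))
        ... | no ne    = ⊥-elim (none (_ , (g , gd) , ne))

      star-end : StarAt a p Z₀ → Separated → Connected →
        ∀ {e f} → StronglyAntiadjacent T e f → ¬ Bad e → ¬ Bad f → GoodPair
      star-end S sep conn ef ¬be ¬bf with any-vertex? (λ c → E? b c ×-dec ¬? (c ≟V q))
      ... | yes (c , bc , c≢q) = star-pair S sep bc c≢q
      ... | no none = ⊥-elim (star-only S conn none ef ¬be ¬bf)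

      ends-only : Connected → (∀ {h} → E a h → h ≢ p → Leaf h a) → (∀ {h} → E b h → h ≢ q → Leaf h b) →
        ∀ {g} → ¬ Bad g → Inc g a ⊎ Inc g b
      ends-only conn leafA leafB {g} ¬bg with conn ¬bg
      ... | v , i , w with walk-closed {S = Side} closed w (inj₁ (here refl)) | inc-edge i
        where
        Side : V → Set
        Side v = v ∈ Z₀ ⊎ Leaf v a ⊎ Leaf v b
        closed : ∀ {v h} → Side v → E v h → ⊤ → Side h
        closed {h = h} (inj₁ (here refl)) e _ with h ≟V p
        ... | yes refl = inj₁ (there (there p∈))
        ... | no ne    = inj₂ (inj₁ (leafA e ne))
        closed {h = h} (inj₁ (there (here refl))) e _ with h ≟V q
        ... | yes refl = inj₁ (there (there q∈))
        ... | no ne    = inj₂ (inj₂ (leafB e ne))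
        closed (inj₁ (there (there v∈))) e _ = inj₁ (nbrs v∈ e)
        closed (inj₂ (inj₁ leaf)) e _ = inj₁ (here (leaf _ e))
        closed (inj₂ (inj₂ leaf)) e _ = inj₁ (there (here (leaf _ e)))
      ...   | inj₁ (here refl) | _ = inj₁ i
      ...   | inj₁ (there (here refl)) | _ = inj₂ i
      ...   | inj₁ (there (there v∈)) | _ = ⊥-elim (¬bg (inc-bad v∈ i))
      ...   | inj₂ (inj₁ leaf) | v′ , gd = inj₁ (subst (Inc g) (leaf v′ (g , gd)) (incʳ gd))
      ...   | inj₂ (inj₂ leaf) | v′ , gd = inj₂ (subst (Inc g) (leaf v′ (g , gd)) (incʳ gd))

      -- The path off the chain and the chain itself make a cycle. If the path has at least two
      -- vertices, its first two, `r` and `r₂`, meet no bad edge and act as `q₁` and `q₂` in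
      -- `cycle-end`. A path of one vertex offers no such pair and is left to `short`.
      around-chain : (∀ {r} → E a r → E r b → r ∉ Z₀ → GoodPair) →
        ∀ {r} → E a r → ∃ (Induced (Off Z₀) (λ v → E v b) r) → GoodPair
      around-chain short ar (_ , end r∉ rb) = short ar rb r∉
      around-chain short {r} ar (_ , ind@(step {x = r₂} {xs} r∉ ¬rb rr₂ noneR _ ind′)) = cycle xs refl
        where
        O = r ∷ (r₂ ∷ xs) ++ b ∷ reverse ds
        off : ∀ {v} → v ∈ r ∷ r₂ ∷ xs → v ∉ Z₀
        off = All.lookup (induced-all ind)
        b∷ds : ∀ {v} → v ∈ b ∷ reverse ds → v ∈ Z₀
        b∷ds (here eq)  = there (here eq)
        b∷ds (there v∈) = there (there (∈-resp-↭ (↭-reverse ds) v∈))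
        pathO : Path a O a
        pathO = ar ∷ path-++ (induced-path ind) (path-reverse path)
        uniqO : Unique (a ∷ O)
        uniqO = ∉⇒All≢ a∉O ∷ Uniqueₚ.++⁺ (induced-unique ind)
            (∉⇒All≢ (b∉ ∘ ∈-resp-↭ (↭-reverse ds)) ∷ Unique-resp-↭ (↭-sym (↭-reverse ds)) uniq)
            (λ (v∈ , v∈′) → off v∈ (b∷ds v∈′))
          where
          a∉O : a ∉ O
          a∉O a∈ with ∈-++⁻ (r ∷ r₂ ∷ xs) a∈
          ... | inj₁ a∈xs = off a∈xs (here refl)
          ... | inj₂ (here eq) = a≢b eq
          ... | inj₂ (there a∈ds) = a∉ (∈-resp-↭ (↭-reverse ds) a∈ds)
        ins : ∀ {v} → v ∈ Z₀ → v ∈ a ∷ O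
        ins (here eq) = here eq
        ins (there (here eq)) = there (∈-++⁺ʳ (r ∷ r₂ ∷ xs) (here eq))
        ins (there (there v∈)) = there (∈-++⁺ʳ (r ∷ r₂ ∷ xs) (there (∈-resp-↭ (↭-sym (↭-reverse ds)) v∈)))
        r₂∉ : r₂ ∉ Z₀
        r₂∉ = off (there (here refl))
        chord₁ : ∀ h → E r h → h ∈ a ∷ O → h ≡ a ⊎ h ≡ r₂
        chord₁ h e (here eq) = inj₁ eq
        chord₁ h e (there (here refl)) = ⊥-elim (E-irrefl e)
        chord₁ h e (there (there (here eq))) = inj₂ eq
        chord₁ h e (there (there (there h∈))) with ∈-++⁻ xs h∈
        ... | inj₁ h∈xs = ⊥-elim (All.lookup noneR h∈xs e)
        ... | inj₂ (here refl) = ⊥-elim (¬rb e)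
        ... | inj₂ (there h∈ds) = ⊥-elim (off-inside r∉ e (∈-resp-↭ (↭-reverse ds) h∈ds))
        next : ∀ {xs h} → Induced (Off Z₀) (λ v → E v b) r₂ xs → E r₂ h → h ∈ xs ++ b ∷ reverse ds →
          ∃[ rest ] (xs ++ b ∷ reverse ds ≡ h ∷ rest)
        next {xs} ind′ e h∈ with ∈-++⁻ xs h∈
        ... | inj₁ h∈xs = let _ , eq = induced-next ind′ h∈xs e in _ , cong (_++ b ∷ reverse ds) eq
        next (end _ _) e _ | inj₂ (here refl) = _ , refl
        next (step _ ¬p _ _ _ _) e _ | inj₂ (here refl) = ⊥-elim (¬p e)
        next _ e _ | inj₂ (there h∈ds) = ⊥-elim (off-inside r₂∉ e (∈-resp-↭ (↭-reverse ds) h∈ds))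
        finish : ∀ {q₃ rest} → xs ++ b ∷ reverse ds ≡ q₃ ∷ rest → GoodPair
        finish {q₃} {rest} eq = cycle-end {Z = a ∷ O}
            (subst (λ l → Path a (r ∷ r₂ ∷ l) a) eq pathO)
            (subst (λ l → Unique (a ∷ r ∷ r₂ ∷ l)) eq uniqO)
            (subst (λ l → _ ∈ a ∷ r ∷ r₂ ∷ l) (sym eq))
            (λ bad i → ins (bad-ends bad i))
            (λ bad → r∉ ∘ bad-ends bad , r₂∉ ∘ bad-ends bad)
            chord₁ chord₂
            (λ _ _ _ _ → subst (λ l → _ ∈ a ∷ r ∷ r₂ ∷ l) eq)
            descend
          where
          chord₂ : ∀ h → E r₂ h → h ∈ a ∷ O → h ≡ r ⊎ h ≡ q₃
          chord₂ h e (here refl) = ⊥-elim (E-sides≢ e (E-side (E-sym rr₂) ar))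
          chord₂ h e (there (here eq)) = inj₁ eq
          chord₂ h e (there (there (here refl))) = ⊥-elim (E-irrefl e)
          chord₂ h e (there (there (there h∈))) with next ind′ e h∈
          ... | _ , eq′ with trans (sym eq) eq′
          ...   | refl = inj₂ refl
        cycle : ∀ ys → ys ≡ xs → GoodPair
        cycle []       eq = finish (cong (_++ b ∷ reverse ds) (sym eq))
        cycle (y ∷ ys) eq = finish (cong (_++ b ∷ reverse ds) (sym eq))

    separated-flip : ∀ {a b p q ds} (C : Chain a b p q ds) → Separated C → Separated (flip C)
    separated-flip C sep e w va =
      sep (E-sym va) (walk-map (λ v∉ → v∉ ∘ flip-∈) (walk-sym w)) (E-sym e)

    path-connected : ∀ {a b p q ds} (C : Chain a b p q ds) → ∀ {v} → v ∈ a ∷ b ∷ ds → Walk (λ _ → ⊤) a v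
    path-connected {ds = ds} C v∈ = path-walk (λ _ → tt) (Chain.path C) (reorder v∈)
      where
      reorder : ∀ {a b} {v : V} → v ∈ a ∷ b ∷ ds → v ∈ a ∷ ds ++ b ∷ []
      reorder (here eq)          = here eq
      reorder (there (here eq))  = there (∈-++⁺ʳ ds (here eq))
      reorder (there (there v∈)) = there (∈-++⁺ˡ v∈)

    connected-flip : ∀ {a b p q ds} (C : Chain a b p q ds) → Connected C → Connected (flip C)
    connected-flip C conn ¬bg = let v , i , w = conn ¬bg in
      v , i , walk-trans (walk-sym (path-connected C (there (here refl)))) w

    connected-chain : ∀ {a b p q ds} (C : Chain a b p q ds) → Connected C →
      (∀ {r} → E a r → E r b → r ∉ a ∷ b ∷ ds → GoodPair) →
      ((∀ {h} → E a h → h ≢ p → Leaf h a) → (∀ {h} → E b h → h ≢ q → Leaf h b) →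
        (∀ {g} → ¬ Bad g → Inc g a ⊎ Inc g b) → GoodPair) →
      ∀ {e f} → StronglyAntiadjacent T e f → ¬ Bad e → ¬ Bad f → GoodPair
    connected-chain {a} {b} {p} {q} {ds} C conn short ends ef ¬be ¬bf
      with any-vertex? (λ r → E? a r ×-dec reach? (a ∷ b ∷ ds) (λ v → E? v b) r)
    ... | yes (r , ar , v , w , vb) = around-chain C short ar (induce (λ v → E? v b) w vb)
    ... | no none = analyse (lobes-at-end C sep) (lobes-at-end (flip C) (separated-flip C sep))
      where
      sep : Separated C
      sep ar w vb = none (_ , ar , _ , w , vb)
      analyse : GoodPair ⊎ (∀ {h} → E a h → h ≢ p → Leaf h a) ⊎ StarAt a p (a ∷ b ∷ ds) →
        GoodPair ⊎ (∀ {h} → E b h → h ≢ q → Leaf h b) ⊎ StarAt b q (b ∷ a ∷ reverse ds) → GoodPair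
      analyse (inj₁ g) _ = g
      analyse _ (inj₁ g) = g
      analyse (inj₂ (inj₂ S)) _ = star-end C S sep conn ef ¬be ¬bf
      analyse _ (inj₂ (inj₂ S)) =
        star-end (flip C) S (separated-flip C sep) (connected-flip C conn) ef ¬be ¬bf
      analyse (inj₂ (inj₁ leafA)) (inj₂ (inj₁ leafB)) =
        ends leafA leafB (ends-only C conn leafA leafB)

    -- Edges in different components of the host graph form an even pair, as neither walk exists. So
    -- all admissible edges may be taken in the component of `e`; if the chain lies elsewhere, the
    -- descent starts from `e` with the chain merely put into `Z`.
    chain-pair : ∀ {a b p q ds} (C : Chain a b p q ds) →
      (∀ {r} → Connected C → E a r → E r b → r ∉ a ∷ b ∷ ds → GoodPair) →
      ((∀ {h} → E a h → h ≢ p → Leaf h a) → (∀ {h} → E b h → h ≢ q → Leaf h b) →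
        (∀ {g} → ¬ Bad g → Inc g a ⊎ Inc g b) → GoodPair) →
      ∀ {e f} → StronglyAntiadjacent T e f → ¬ Bad e → ¬ Bad f → GoodPair
    chain-pair {a} {b} {p} {q} {ds} C short ends {e} {f} ef ¬be ¬bf
      with Finₚ.any? (λ g → ¬? (Bad? g) ×-dec ¬? (reach? [] (λ v → v ≟V endpoint true g) (endpoint true e)))
    ... | yes (g , ¬bg , apart) = e , g ,
          evenPair (edge-ends true e) (edge-ends true g) refl
            (λ eq → apart (_ , stop (λ ()) , eq))
            (λ eq → apart (_ , go (λ ()) (e , edge-ends true e) (subst (λ v → Walk (Off []) v (endpoint true g)) (sym eq)
              (go (λ ()) (g , edge-ends false g) (stop λ ()))) , refl))
            (λ w → apart (_ , walk-map (λ _ ()) w , refl))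
            (λ w → apart (_ , go (λ ()) (e , edge-ends true e)
              (walk-snoc (walk-map (λ _ ()) w) (g , edge-ends false g) (λ ())) , refl)) ,
          ¬be , ¬bg
    ... | no together with reach? [] (λ v → v ≟V a) (endpoint true e)
    ...   | yes (_ , wa , refl) = connected-chain C conn (short conn) ends ef ¬be ¬bf
      where
      conn : Connected C
      conn {g} ¬bg with reach? [] (λ v → v ≟V endpoint true g) (endpoint true e)
      ... | yes (_ , w , refl) = _ , endpoint-inc true g , walk-map (λ _ → tt) (walk-trans (walk-sym wa) w)
      ... | no ¬w = ⊥-elim (together (g , ¬bg , ¬w))
    ...   | no apart = from-edge {Z = endpoint true e ∷ endpoint false e ∷ a ∷ b ∷ ds}
            (edge-ends true e) (edge-ends true f) refl ef ¬be ¬bf (here refl) (there (here refl))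
            (λ bad i → there (there (Chain.bad-ends C bad i)))
            (λ where
              _ (here eq) → inj₁ eq
              _ (there (here eq)) → inj₂ eq
              eh (there (there h∈)) → ⊥-elim (unreachable h∈ (near eh)))
            (λ where
              _ _ _ (here eq) → inj₁ eq
              _ _ _ (there (here eq)) → inj₂ eq
              eh w xw (there (there w∈)) → ⊥-elim (unreachable w∈
                (walk-snoc (walk-trans (near eh) (walk-map (λ _ → tt) w)) xw tt)))
      where
      near : ∀ {h} → E (endpoint true e) h ⊎ E (endpoint false e) h → Walk (λ _ → ⊤) (endpoint true e) h
      near (inj₁ eh) = go tt eh (stop tt)
      near (inj₂ eh) = go tt (e , edge-ends true e) (go tt eh (stop tt))
      unreachable : ∀ {v} → v ∈ a ∷ b ∷ ds → ¬ Walk (λ _ → ⊤) (endpoint true e) v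
      unreachable v∈ w = apart (_ , walk-map (λ _ ()) (walk-trans w (walk-sym (path-connected C v∈))) , refl)

  line-hasEvenPair : ∀ {e f} → StronglyAntiadjacent T e f → HasEvenPair T
  line-hasEvenPair {e} {f} ef =
    let e′ , f′ , even , _ = LinePairs.from-edge (λ _ → ⊥) (λ _ → no λ ())
          {Z = endpoint true e ∷ endpoint false e ∷ []}
          (edge-ends true e) (edge-ends true f) refl ef (λ ()) (λ ())
          (here refl) (there (here refl)) (λ ()) (λ _ → ends) (λ _ _ _ → ends)
    in e′ , f′ , even
    where
    ends : ∀ {u v w : V} → w ∈ u ∷ v ∷ [] → w ≡ u ⊎ w ≡ v
    ends (here eq)         = inj₁ eq
    ends (there (here eq)) = inj₂ eq

  -- Line trigraphs with a small switchable component

  module SmallComponent {x y : Fin n} (xy : Semiadjacent T x y) (c : Bool)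
                        (meet : endpoint c x ≡ endpoint c y) where

    p A B : V
    p = endpoint c x
    A = endpoint (not c) x
    B = endpoint (not c) y

    Bad : Fin n → Set
    Bad g = g ≡ x ⊎ g ≡ y

    open LinePairs Bad (λ g → (g Finₚ.≟ x) ⊎-dec (g Finₚ.≟ y))
    open Descent Bad

    x-edge : Edge x A p
    x-edge = edge-sym (edge-ends c x)

    y-edge : Edge y p B
    y-edge = subst (λ v → Edge y v B) (sym meet) (edge-ends c y)

    -- A third edge at `p` would be a common neighbour of `x` and `y`.
    at-p : ∀ {g} → Inc g p → Bad g
    at-p {g} i with g Finₚ.≟ x | g Finₚ.≟ y
    ... | yes eq | _      = inj₁ eq
    ... | no _   | yes eq = inj₂ eq
    ... | no g≢x | no g≢y = ⊥-elim (semi-no-common-neighbour T switch xy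
            (meet⇒adj (g≢x ∘ sym) (incʳ x-edge) i) (meet⇒adj (g≢y ∘ sym) (incˡ y-edge) i))

    A~B : side A ≡ side B
    A~B = other-side x-edge (edge-sym y-edge)

    A≢B : A ≢ B
    A≢B eq = proj₁ xy (endpoints-injective c meet eq)

    p-nbrs : ∀ {h} → E p h → h ≡ A ⊎ h ≡ B
    p-nbrs (g , gd) with at-p (incˡ gd)
    ... | inj₁ refl = [ inj₁ , (λ { refl → ⊥-elim (edge-≢ gd refl) }) ]′ (inc-cases x-edge (incʳ gd))
    ... | inj₂ refl = [ (λ { refl → ⊥-elim (edge-≢ gd refl) }) , inj₂ ]′ (inc-cases y-edge (incʳ gd))

    chain : Chain A B p p (p ∷ [])
    chain = record
      { path = (x , x-edge) ∷ arrive (y , y-edge)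
      ; a≢b = A≢B
      ; a∉ = λ { (here eq) → edge-≢ x-edge eq }
      ; b∉ = λ { (here eq) → edge-≢ y-edge (sym eq) }
      ; uniq = [] ∷ []
      ; p∈ = here refl ; q∈ = here refl
      ; nbrs = λ { (here refl) e → [ here , there ∘ here ]′ (p-nbrs e) }
      ; a-p = λ { _ (here eq) → eq }
      ; b-q = λ { _ (here eq) → eq }
      ; no-ab = λ e → E-sides≢ e A~B
      ; bad-ends = λ where
          (inj₁ refl) i → [ here , there ∘ there ∘ here ]′ (inc-cases x-edge i)
          (inj₂ refl) i → [ there ∘ there ∘ here , there ∘ here ]′ (inc-cases y-edge i)
      ; inc-bad = λ { (here refl) i → at-p i }
      }

    -- For the case where the host graph is a four-cycle u r w p with leaves attached to u, r and w.
    corner′ : ∀ {u r w} → E w r →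
      (∀ {h} → E w h → h ≢ r → h ≢ p → Leaf h w) → (∀ {h} → E r h → h ≢ u → h ≢ w → Leaf h r) →
      ∀ {g g′} → StronglyAntiadjacent T g g′ → ¬ Bad g → ¬ Bad g′ → ¬ Inc g′ u →
      Inc g w → Inc g′ r → GoodPair
    corner′ {u} {r} {w} wr leafW leafR {g} {g′} gg′ ¬bg ¬bg′ ¬u iw ir
      with inc-edge chain iw | inc-edge chain ir
    ... | l′ , gd | l , gd′ with strongAnti⇒disjoint gd (edge-sym gd′) gg′
    ...   | w≢l , l′≢r = g , g′ ,
            stuck-evenPair gd (edge-sym gd′) (≢∧≢⇒≡ (E-sides≢ wr) (sides≢ (edge-sym gd′))) w≢l l′≢r
              (inj₂ (leaf-stuck (leafR (g′ , gd′) (λ { refl → ¬u (incʳ gd′) }) (w≢l ∘ sym)) (inj₂ refl)))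
              (inj₁ (leaf-stuck (leafW (g , gd) l′≢r (λ { refl → ¬bg (at-p (incʳ gd)) })) (inj₁ refl))) ,
            ¬bg , ¬bg′

    corner : ∀ {u r w} → E w r →
      (∀ {h} → E w h → h ≢ r → h ≢ p → Leaf h w) → (∀ {h} → E r h → h ≢ u → h ≢ w → Leaf h r) →
      (∀ {g} → ¬ Bad g → ¬ Inc g u → Inc g w ⊎ Inc g r) →
      ∀ {g g′} → StronglyAntiadjacent T g g′ → ¬ Bad g → ¬ Bad g′ → ¬ Inc g u → ¬ Inc g′ u → GoodPair
    corner wr leafW leafR at {g} {g′} gg′ ¬bg ¬bg′ ¬u ¬u′ with at ¬bg ¬u | at ¬bg′ ¬u′
    ... | inj₁ i | inj₁ j = ⊥-elim (adj⇒¬strongAnti T (meet⇒adj (proj₁ gg′) i j) gg′)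
    ... | inj₂ i | inj₂ j = ⊥-elim (adj⇒¬strongAnti T (meet⇒adj (proj₁ gg′) i j) gg′)
    ... | inj₁ i | inj₂ j = corner′ wr leafW leafR gg′ ¬bg ¬bg′ ¬u′ i j
    ... | inj₂ i | inj₁ j = corner′ wr leafW leafR (StronglyAntiadjacent-sym T gg′) ¬bg′ ¬bg ¬u j i

    module _ (cond : ¬ RestCliqueSmall T x y x ⊎ ¬ RestCliqueSmall T x y y) where

      -- Non-neighbours of `x` are edges missing `A`, those of `y` edges missing `B`; a set that is
      -- not a clique supplies two disjoint ones.
      split : ∀ {X : Set} →
        (∀ {g g′} → StronglyAntiadjacent T g g′ → ¬ Bad g → ¬ Bad g′ → ¬ Inc g A → ¬ Inc g′ A → X) →
        (∀ {g g′} → StronglyAntiadjacent T g g′ → ¬ Bad g → ¬ Bad g′ → ¬ Inc g B → ¬ Inc g′ B → X) → X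
      split f₁ f₂ = [ (λ ¬rest → case RestCliqueSmall-or-pair T x y x of λ where
                        (inj₁ rest) → ⊥-elim (¬rest rest)
                        (inj₂ (g , g′ , gg′ , (g≢x , g≢y , ¬a) , (g′≢x , g′≢y , ¬a′))) →
                          f₁ gg′ [ g≢x , g≢y ]′ [ g′≢x , g′≢y ]′
                            (λ i → ¬a (meet⇒adj (g≢x ∘ sym) (incˡ x-edge) i))
                            (λ i → ¬a′ (meet⇒adj (g′≢x ∘ sym) (incˡ x-edge) i)))
                    , (λ ¬rest → case RestCliqueSmall-or-pair T x y y of λ where
                        (inj₁ rest) → ⊥-elim (¬rest rest)
                        (inj₂ (g , g′ , gg′ , (g≢x , g≢y , ¬a) , (g′≢x , g′≢y , ¬a′))) →
                          f₂ gg′ [ g≢x , g≢y ]′ [ g′≢x , g′≢y ]′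
                            (λ i → ¬a (meet⇒adj (g≢y ∘ sym) (incʳ y-edge) i))
                            (λ i → ¬a′ (meet⇒adj (g′≢y ∘ sym) (incʳ y-edge) i))) ]′ cond

      -- Two edges that both miss `A` would both pass through `B`, or conversely, and so be
      -- adjacent.
      two-ends-absurd : (∀ {g} → ¬ Bad g → Inc g A ⊎ Inc g B) → GoodPair
      two-ends-absurd at = ⊥-elim (split
        (λ gg′ ¬bg ¬bg′ ¬a ¬a′ → adj⇒¬strongAnti T (meet⇒adj (proj₁ gg′)
          ([ ⊥-elim ∘ ¬a , id ]′ (at ¬bg)) ([ ⊥-elim ∘ ¬a′ , id ]′ (at ¬bg′))) gg′)
        (λ gg′ ¬bg ¬bg′ ¬b ¬b′ → adj⇒¬strongAnti T (meet⇒adj (proj₁ gg′)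
          ([ id , ⊥-elim ∘ ¬b ]′ (at ¬bg)) ([ id , ⊥-elim ∘ ¬b′ ]′ (at ¬bg′))) gg′))

      -- On the cycle `A r B p` only `r` lies off the chain, so `cycle-end` does not apply. Either a
      -- lobe starts at `A`, `B` or `r`, or every admissible edge has an end among these three, and
      -- the two edges from `split` are found at `r` and at one of `A`, `B`.
      four-cycle : ∀ {r} → Connected chain → E A r → E r B → r ∉ A ∷ B ∷ p ∷ [] → GoodPair
      four-cycle {r} conn ar rb r∉ = try (lobe? A) (lobe? B) (lobe? r)
        where
        O Z : List V
        O = r ∷ B ∷ p ∷ []
        Z = A ∷ O
        cyc : Cyclic A O
        cyc = inj₂ (ar ∷ rb ∷ (y , edge-sym y-edge) ∷ arrive (x , edge-sym x-edge)) ,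
          ((λ { refl → r∉ (here refl) }) ∷ A≢B ∷ edge-≢ x-edge ∷ []) ∷
          ((λ { refl → r∉ (there (here refl)) }) ∷ (λ { refl → r∉ (there (there (here refl))) }) ∷ []) ∷
          ((edge-≢ y-edge ∘ sym) ∷ []) ∷ [] ∷ []
        Lobe? : V → Set
        Lobe? u = ∃[ h ] ((E u h × h ∉ Z) × ∃[ g ] (E h g × g ≢ u))
        lobe? : ∀ u → Dec (Lobe? u)
        lobe? u = any-vertex? (λ h → (E? u h ×-dec ¬? (h ∈? Z)) ×-dec branch? h u)
        bad⊆Z : ∀ {g v} → Bad g → Inc g v → v ∈ Z
        bad⊆Z bad i with Chain.bad-ends chain bad i
        ... | here eq                 = here eq
        ... | there (here eq)         = there (there (here eq))
        ... | there (there (here eq)) = there (there (there (here eq)))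
        good-r : ∀ {g} → Inc g r → ¬ Bad g
        good-r i bad = r∉ (Chain.bad-ends chain bad i)
        start : ∀ {u z} → u ∈ Z → z ∈ Z → ∃[ g ] (Edge g u z × ¬ Bad g) → Lobe? u → GoodPair
        start u∈ z∈ g (h , (uh , h∉) , br) = let O′ , cyc′ , perm = rotate cyc u∈ in descend (record
          { cyclic = cyc′ ; O⊆Z = ∈-resp-↭ (↭-sym perm) ; y∉Z = h∉ ; sy = uh ; branch = br
          ; z≢y = λ { refl → h∉ z∈ } ; sz = g ; closed = λ _ _ → ∈-resp-↭ perm ; bad⊆Z = bad⊆Z })
        none⇒leaf : ∀ {u h} → ¬ Lobe? u → E u h → h ∉ Z → Leaf h u
        none⇒leaf none uh h∉ = no-branch⇒leaf (λ br → none (_ , (uh , h∉) , br))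
        module _ (noA : ¬ Lobe? A) (noB : ¬ Lobe? B) (noR : ¬ Lobe? r) where
          Side : V → Set
          Side v = v ∈ Z ⊎ Leaf v A ⊎ Leaf v B ⊎ Leaf v r
          closed : ∀ {v h} → Side v → E v h → ⊤ → Side h
          closed {h = h} (inj₁ v∈) e _ with h ∈? Z
          closed (inj₁ v∈) e _ | yes h∈ = inj₁ h∈
          closed (inj₁ (here refl)) e _ | no h∉ = inj₂ (inj₁ (none⇒leaf noA e h∉))
          closed (inj₁ (there (here refl))) e _ | no h∉ = inj₂ (inj₂ (inj₂ (none⇒leaf noR e h∉)))
          closed (inj₁ (there (there (here refl)))) e _ | no h∉ = inj₂ (inj₂ (inj₁ (none⇒leaf noB e h∉)))
          closed (inj₁ (there (there (there (here refl))))) e _ | no h∉ =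
            ⊥-elim (h∉ ([ here , there ∘ there ∘ here ]′ (p-nbrs e)))
          closed (inj₂ (inj₁ leaf)) e _ = inj₁ (here (leaf _ e))
          closed (inj₂ (inj₂ (inj₁ leaf))) e _ = inj₁ (there (there (here (leaf _ e))))
          closed (inj₂ (inj₂ (inj₂ leaf))) e _ = inj₁ (there (here (leaf _ e)))
          at : ∀ {g} → ¬ Bad g → Inc g A ⊎ Inc g B ⊎ Inc g r
          at {g} ¬bg with conn ¬bg
          ... | v , i , w with walk-closed closed w (inj₁ (here refl)) | inc-edge chain i
          ...   | inj₁ (here refl) | _ = inj₁ i
          ...   | inj₁ (there (here refl)) | _ = inj₂ (inj₂ i)
          ...   | inj₁ (there (there (here refl))) | _ = inj₂ (inj₁ i)
          ...   | inj₁ (there (there (there (here refl)))) | _ = ⊥-elim (¬bg (at-p i))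
          ...   | inj₂ (inj₁ leaf) | v′ , gd = inj₁ (subst (Inc g) (leaf v′ (g , gd)) (incʳ gd))
          ...   | inj₂ (inj₂ (inj₁ leaf)) | v′ , gd = inj₂ (inj₁ (subst (Inc g) (leaf v′ (g , gd)) (incʳ gd)))
          ...   | inj₂ (inj₂ (inj₂ leaf)) | v′ , gd = inj₂ (inj₂ (subst (Inc g) (leaf v′ (g , gd)) (incʳ gd)))
          not-p : ∀ {v h} → side v ≡ side A → E v h → h ≢ r → h ≢ p → h ∉ Z
          not-p s e _ _ (here refl) = E-sides≢ e s
          not-p s e h≢r _ (there (here eq)) = h≢r eq
          not-p s e _ _ (there (there (here refl))) = E-sides≢ e (trans s A~B)
          not-p s e _ h≢p (there (there (there (here eq)))) = h≢p eq
          leafR : ∀ {h} → E r h → h ≢ A → h ≢ B → Leaf h r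
          leafR e h≢A h≢B = none⇒leaf noR e λ where
            (here eq) → h≢A eq
            (there (here refl)) → E-irrefl e
            (there (there (here eq))) → h≢B eq
            (there (there (there (here refl)))) → E-sides≢ (E-sym ar) (E-side e (_ , x-edge))
          outcome : GoodPair
          outcome = split
            (corner (E-sym rb) (λ e h≢r h≢p → none⇒leaf noB e (not-p (sym A~B) e h≢r h≢p)) leafR
              (λ ¬bg ¬a → [ ⊥-elim ∘ ¬a , id ]′ (at ¬bg)))
            (corner ar (λ e h≢r h≢p → none⇒leaf noA e (not-p refl e h≢r h≢p)) (λ e h≢B h≢A → leafR e h≢A h≢B)
              (λ ¬bg ¬b → [ inj₁ , [ ⊥-elim ∘ ¬b , inj₂ ]′ ]′ (at ¬bg)))
        try : Dec (Lobe? A) → Dec (Lobe? B) → Dec (Lobe? r) → GoodPair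
        try (yes l) _ _ = start (here refl) (there (here refl))
          (proj₁ ar , proj₂ ar , good-r (incʳ (proj₂ ar))) l
        try _ (yes l) _ = start (there (there (here refl))) (there (here refl))
          (proj₁ rb , edge-sym (proj₂ rb) , good-r (incˡ (proj₂ rb))) l
        try _ _ (yes l) = start (there (here refl)) (here refl)
          (proj₁ ar , edge-sym (proj₂ ar) , good-r (incʳ (proj₂ ar))) l
        try (no noA) (no noB) (no noR) = outcome noA noB noR

      small-pair : ∀ {e f} → StronglyAntiadjacent T e f → ¬ Bad e → ¬ Bad f → GoodPair
      small-pair = chain-pair chain four-cycle (λ _ _ → two-ends-absurd)

  -- Line trigraphs with a light switchable component

  module LightComponent {v x y : Fin n} (vx : Semiadjacent T v x) (vy : Semiadjacent T v y)
    (iso : ∀ w → w ≢ v → w ≢ x → w ≢ y → StronglyAntiadjacent T v w)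
    (xy : StronglyAntiadjacent T x y)
    (common : ∀ w → Adjacent T x w → Adjacent T y w → w ≡ v)
    (c : Bool) (meet-x : endpoint c v ≡ endpoint c x) (meet-y : endpoint (not c) v ≡ endpoint (not c) y) where

    p q A B : V
    p = endpoint c v
    q = endpoint (not c) v
    A = endpoint (not c) x
    B = endpoint c y

    Bad : Fin n → Set
    Bad g = g ≡ v ⊎ g ≡ x ⊎ g ≡ y

    open LinePairs Bad (λ g → (g Finₚ.≟ v) ⊎-dec ((g Finₚ.≟ x) ⊎-dec (g Finₚ.≟ y)))
    open Descent Bad

    x-edge : Edge x A p
    x-edge = subst (Edge x A) (sym meet-x) (edge-sym (edge-ends c x))

    v-edge : Edge v p q
    v-edge = edge-ends c v

    y-edge : Edge y q B
    y-edge = subst (λ u → Edge y u B) (sym meet-y) (edge-sym (edge-ends c y))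

    x#y : ∀ {u} → Inc x u → ¬ Inc y u
    x#y i j = adj⇒¬strongAnti T (meet⇒adj (proj₁ xy) i j) xy

    at-v : ∀ {g u} → Inc v u → Inc g u → Bad g
    at-v {g} i j with g Finₚ.≟ v | g Finₚ.≟ x | g Finₚ.≟ y
    ... | yes eq | _      | _      = inj₁ eq
    ... | no _   | yes eq | _      = inj₂ (inj₁ eq)
    ... | no _   | no _   | yes eq = inj₂ (inj₂ eq)
    ... | no ≢v  | no ≢x  | no ≢y  =
          ⊥-elim (adj⇒¬strongAnti T (meet⇒adj (≢v ∘ sym) i j) (iso g ≢v ≢x ≢y))

    A~q : side A ≡ side q
    A~q = other-side x-edge (edge-sym v-edge)

    p~B : side p ≡ side B
    p~B = other-side v-edge (edge-sym y-edge)

    A≁B : side A ≢ side B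
    A≁B eq = sides≢ y-edge (trans (sym A~q) eq)

    A≢q : A ≢ q
    A≢q eq = x#y (incˡ x-edge) (subst (Inc y) (sym eq) (incˡ y-edge))

    B≢p : B ≢ p
    B≢p eq = x#y (incʳ x-edge) (subst (Inc y) eq (incʳ y-edge))

    p-nbrs : ∀ {h} → E p h → h ∈ A ∷ B ∷ p ∷ q ∷ []
    p-nbrs (g , gd) with at-v (incˡ v-edge) (incˡ gd)
    ... | inj₁ refl = [ there ∘ there ∘ here , there ∘ there ∘ there ∘ here ]′ (inc-cases v-edge (incʳ gd))
    ... | inj₂ (inj₁ refl) = [ here , there ∘ there ∘ here ]′ (inc-cases x-edge (incʳ gd))
    ... | inj₂ (inj₂ refl) = ⊥-elim (x#y (incʳ x-edge) (incˡ gd))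

    q-nbrs : ∀ {h} → E q h → h ∈ A ∷ B ∷ p ∷ q ∷ []
    q-nbrs (g , gd) with at-v (incʳ v-edge) (incˡ gd)
    ... | inj₁ refl = [ there ∘ there ∘ here , there ∘ there ∘ there ∘ here ]′ (inc-cases v-edge (incʳ gd))
    ... | inj₂ (inj₁ refl) = ⊥-elim (x#y (incˡ gd) (incˡ y-edge))
    ... | inj₂ (inj₂ refl) = [ there ∘ there ∘ there ∘ here , there ∘ here ]′ (inc-cases y-edge (incʳ gd))

    chain : Chain A B p q (p ∷ q ∷ [])
    chain = record
      { path = (x , x-edge) ∷ (v , v-edge) ∷ arrive (y , y-edge)
      ; a≢b = λ eq → A≁B (cong side eq)
      ; a∉ = λ { (here eq) → edge-≢ x-edge eq ; (there (here eq)) → A≢q eq }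
      ; b∉ = λ { (here eq) → B≢p eq ; (there (here eq)) → edge-≢ y-edge (sym eq) }
      ; uniq = (edge-≢ v-edge ∷ []) ∷ [] ∷ []
      ; p∈ = here refl ; q∈ = there (here refl)
      ; nbrs = λ { (here refl) e → p-nbrs e ; (there (here refl)) e → q-nbrs e }
      ; a-p = λ { _ (here eq) → eq ; e (there (here refl)) → ⊥-elim (E-sides≢ e A~q) }
      ; b-q = λ { e (here refl) → ⊥-elim (E-sides≢ e (sym p~B)) ; _ (there (here eq)) → eq }
      ; no-ab = no-ab
      ; bad-ends = λ where
          (inj₁ refl) i → [ there ∘ there ∘ here , there ∘ there ∘ there ∘ here ]′ (inc-cases v-edge i)
          (inj₂ (inj₁ refl)) i → [ here , there ∘ there ∘ here ]′ (inc-cases x-edge i)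
          (inj₂ (inj₂ refl)) i → [ there ∘ there ∘ there ∘ here , there ∘ here ]′ (inc-cases y-edge i)
      ; inc-bad = λ { (here refl) i → at-v (incˡ v-edge) i ; (there (here refl)) i → at-v (incʳ v-edge) i }
      }
      where
      -- An edge from `A` to `B` would be a common neighbour of `x` and `y`, hence `v`, whose ends
      -- are `p` and `q`.
      no-ab : ¬ E A B
      no-ab (g , gd) with common g
        (meet⇒adj (λ { refl → x#y (incʳ gd) (incʳ y-edge) }) (incˡ x-edge) (incˡ gd))
        (meet⇒adj (λ { refl → x#y (incˡ x-edge) (incˡ gd) }) (incʳ y-edge) (incʳ gd))
      ... | refl = [ edge-≢ x-edge , A≢q ]′ (inc-cases v-edge (incˡ gd))

    two-ends : (∀ {h} → E A h → h ≢ p → Leaf h A) → (∀ {h} → E B h → h ≢ q → Leaf h B) →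
      ∀ {e f} → StronglyAntiadjacent T e f → ¬ Bad e → ¬ Bad f → Inc e A → Inc f B → GoodPair
    two-ends leafA leafB {e} {f} ef ¬be ¬bf i j with inc-edge chain i | inc-edge chain j
    ... | l , ed | l′ , fd with strongAnti⇒disjoint ed (edge-sym fd) ef
    ...   | A≢l′ , l≢B = e , f ,
            stuck-evenPair ed (edge-sym fd) (≢∧≢⇒≡ A≁B (sides≢ (edge-sym fd))) A≢l′ l≢B
              (inj₂ (leaf-stuck (leafB (f , fd) (λ { refl → ¬bf (at-v (incʳ v-edge) (incʳ fd)) })) (inj₂ refl)))
              (inj₁ (leaf-stuck (leafA (e , ed) (λ { refl → ¬be (at-v (incˡ v-edge) (incʳ ed)) })) (inj₁ refl))) ,
            ¬be , ¬bf

    light-pair : ∀ {e f} → StronglyAntiadjacent T e f → ¬ Bad e → ¬ Bad f → GoodPair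
    light-pair {e} {f} ef ¬be ¬bf = chain-pair chain
      -- The chain has three edges, so `A` and `B` are on opposite sides and have no common
      -- neighbour.
      (λ _ ar rb _ → ⊥-elim (A≁B (E-side ar (E-sym rb))))
      (λ leafA leafB at → case at ¬be , at ¬bf of λ where
        (inj₁ i , inj₁ j) → ⊥-elim (adj⇒¬strongAnti T (meet⇒adj (proj₁ ef) i j) ef)
        (inj₂ i , inj₂ j) → ⊥-elim (adj⇒¬strongAnti T (meet⇒adj (proj₁ ef) i j) ef)
        (inj₁ i , inj₂ j) → two-ends leafA leafB ef ¬be ¬bf i j
        (inj₂ i , inj₁ j) → two-ends leafA leafB (StronglyAntiadjacent-sym T ef) ¬bf ¬be j i)
      ef ¬be ¬bf

line-conclusion : ∀ {n} (T : Trigraph n) → NoOddPrism T → LineTrigraph T → (F : InF T) → Conclusion T F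
line-conclusion T noOdd ((a , b , ε , inj , to , from) , _) F@(_ , switch) =
  Sum.map₂ (λ (_ , _ , uv) → line-hasEvenPair uv) (complete-or-strongAnti T) , disjoint F refl
  where
  open LineGraph T switch noOdd ε inj to from
  open Host ε inj using (endpoint; endpoint-inc; Inc)
  disjoint : (F : InF T) → proj₂ F ≡ switch → Favorable T F → HasEvenPairDisjoint T F
  disjoint (_ , noSwitch _) _ (_ , (u , v , uv , _) , _) =
    let e , f , even = line-hasEvenPair uv in e , f , even , (λ ()) , λ ()
  disjoint (_ , small x y xy only none) refl (_ , (u , v , uv , u∉ , v∉) , cond) =
    let c , meet = adj⇒endpoint (semi⇒adj T xy) in
    SmallComponent.small-pair xy c meet cond uv u∉ v∉
  disjoint (_ , light v x y _ vx vy _ iso xy common) refl (_ , (e , f , ef , e∉ , f∉) , _)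
    with adj⇒endpoint (semi⇒adj T vx) | adj⇒endpoint (semi⇒adj T vy)
  ... | c , meet-x | d , meet-y with d Boolₚ.≟ c
  -- If `x` and `y` met `v` at the same end, they would be adjacent.
  ...   | yes refl = ⊥-elim (adj⇒¬strongAnti T (meet⇒adj (proj₁ xy)
            (subst (Inc x) (sym meet-x) (endpoint-inc c x)) (subst (Inc y) (sym meet-y) (endpoint-inc c y))) xy)
  ...   | no ne with ≢⇒≡not (ne ∘ sym)
  ...     | refl = LightComponent.light-pair vx vy iso xy common c meet-x meet-y ef e∉ f∉

-- Doubled graphs

module _ {n : ℕ} (T : Trigraph n) where

  antiadj⇒adj-complement : ∀ {u v} → Antiadjacent T u v → Adjacent (complement T) u v
  antiadj⇒adj-complement (u≢v , inj₁ eq) = u≢v , inj₂ (cong negAdj eq)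
  antiadj⇒adj-complement (u≢v , inj₂ eq) = u≢v , inj₁ (cong negAdj eq)

  adj⇒antiadj-complement : ∀ {u v} → Adjacent T u v → Antiadjacent (complement T) u v
  adj⇒antiadj-complement (u≢v , inj₁ eq) = u≢v , inj₂ (cong negAdj eq)
  adj⇒antiadj-complement (u≢v , inj₂ eq) = u≢v , inj₁ (cong negAdj eq)

  last≢ : ∀ {k} {p : Fin (suc k) → Fin n} → IsPath T p → ∀ i {v} → p (last k) ≡ v → toℕ i < k → p i ≢ v
  last≢ {k} P i eq lt eq′ = ℕₚ.<-irrefl (trans (cong toℕ (IsPath.inj P _ _ (trans eq′ (sym eq)))) (toℕ-last k)) lt

  -- The second vertex of a path of length at least three is adjacent to `u` and antiadjacent to
  -- `v`.
  dominated-evenPair : ∀ {u v} → StronglyAntiadjacent T u v →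
    (∀ w → Adjacent T u w → ¬ Antiadjacent T w v) → IsEvenPair T u v
  dominated-evenPair uv dom = long-paths⇒evenPair T uv λ where
    k p P refl refl → ⊥-elim (dom (p (fsuc fzero))
      (IsPath.adj P fzero (fsuc fzero) refl)
      (IsPath.nonadj P (fsuc fzero) (last (3 + k)) (s≤s (s≤s (s≤s z≤n)))))

module Doubled {n : ℕ} (T : Trigraph n) (c : Fin n → Bool) (good : IsGoodPartition T c)
               (switch : SwitchStructure T) (noAntihole : NoAntihole T) where

  open IsGoodPartition good

  X Y : Fin n → Set
  X w = c w ≡ true
  Y w = c w ≡ false

  X? : ∀ w → Dec (X w)
  X? w = c w Boolₚ.≟ true

  Y? : ∀ w → Dec (Y w)
  Y? w = c w Boolₚ.≟ false

  X-or-Y : ∀ w → X w ⊎ Y w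
  X-or-Y w with c w
  ... | true  = inj₁ refl
  ... | false = inj₂ refl

  X∧Y : ∀ {w} → X w → Y w → ⊥
  X∧Y x y = case trans (sym x) y of λ ()

  X-unique : ∀ {x u v} → X x → X u → X v → Adjacent T x u → Adjacent T x v → u ≡ v
  X-unique {x} {u} {v} cx cu cv xu xv with u Finₚ.≟ v
  ... | yes eq = eq
  ... | no ne  = ⊥-elim (compX x x u v cx done ((cx , cu , xu) ◅ done) ((cx , cv , xv) ◅ done) (proj₁ xu) (proj₁ xv) ne)

  Y-unique : ∀ {y u v} → Y y → Y u → Y v → Antiadjacent T y u → Antiadjacent T y v → u ≡ v
  Y-unique {y} {u} {v} cy cu cv yu yv with u Finₚ.≟ v
  ... | yes eq = eq
  ... | no ne  = ⊥-elim (compY y y u v cy done ((cy , cu , yu) ◅ done) ((cy , cv , yv) ◅ done) (proj₁ yu) (proj₁ yv) ne)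

  cross-dichotomy : ∀ {x y} → X x → Y y → Adjacent T x y → ¬ Antiadjacent T x y
  cross-dichotomy cx cy a b = noSemi _ _ cx cy (adj∧antiadj⇒semi T a b)

  cross-strong : ∀ {x y} → X x → Y y → Adjacent T x y → StronglyAdjacent T x y
  cross-strong cx cy (ne , inj₁ eq) = ne , eq
  cross-strong cx cy (ne , inj₂ eq) = ⊥-elim (noSemi _ _ cx cy (ne , eq))

  X≢Y : ∀ {x y} → X x → Y y → x ≢ y
  X≢Y cx cy refl = X∧Y cx cy

  -- Towards a two-vertex component of `X`, the vertex `y` has at most one strong edge and at most
  -- one strong antiedge, and no switchable pair crosses; so it has exactly one of each.
  split-X-edge : ∀ {x x′ y} → X x → X x′ → Y y → Adjacent T x x′ →
    (Adjacent T x y × StronglyAntiadjacent T x′ y) ⊎ (StronglyAntiadjacent T x y × Adjacent T x′ y)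
  split-X-edge {x} {x′} {y} cx cx′ cy xx′
    with adj-or-strongAnti T (X≢Y cx cy) | adj-or-strongAnti T (X≢Y cx′ cy)
  ... | inj₁ a | inj₂ b = inj₁ (a , b)
  ... | inj₂ a | inj₁ b = inj₂ (a , b)
  ... | inj₁ a | inj₁ b = ⊥-elim (proj₁ xx′ (strongY x y y x x′ cx cy done done ((cx , cx′ , xx′) ◅ done)
          (flipₛ (cross-strong cx cy a)) (flipₛ (cross-strong cx′ cy b))))
    where
    flipₛ : ∀ {u v} → StronglyAdjacent T u v → StronglyAdjacent T v u
    flipₛ {u} {v} (ne , eq) = ne ∘ sym , trans (θ-sym T v u) eq
  ... | inj₂ a | inj₂ b = ⊥-elim (proj₁ xx′ (antiY x y y x x′ cx cy done done ((cx , cx′ , xx′) ◅ done)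
          (StronglyAntiadjacent-sym T a) (StronglyAntiadjacent-sym T b)))

  split-Y-pair : ∀ {x y y′} → X x → Y y → Y y′ → Antiadjacent T y y′ →
    (Adjacent T x y × StronglyAntiadjacent T x y′) ⊎ (StronglyAntiadjacent T x y × Adjacent T x y′)
  split-Y-pair {x} {y} {y′} cx cy cy′ yy′
    with adj-or-strongAnti T (X≢Y cx cy) | adj-or-strongAnti T (X≢Y cx cy′)
  ... | inj₁ a | inj₂ b = inj₁ (a , b)
  ... | inj₂ a | inj₁ b = inj₂ (a , b)
  ... | inj₁ a | inj₁ b = ⊥-elim (proj₁ yy′ (strongX x y x y y′ cx cy done done ((cy , cy′ , yy′) ◅ done)
          (cross-strong cx cy a) (cross-strong cx cy′ b)))
  ... | inj₂ a | inj₂ b = ⊥-elim (proj₁ yy′ (antiX x y x y y′ cx cy done done ((cy , cy′ , yy′) ◅ done) a b))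

  XEdge YPair : Fin n → Fin n → Set
  XEdge x x′ = X x × X x′ × Adjacent T x x′
  YPair y y′ = Y y × Y y′ × Antiadjacent T y y′

  XEdge? : ∀ x x′ → Dec (XEdge x x′)
  XEdge? x x′ = X? x ×-dec (X? x′ ×-dec adjacent? T x x′)

  YPair? : ∀ y y′ → Dec (YPair y y′)
  YPair? y y′ = Y? y ×-dec (Y? y′ ×-dec antiadjacent? T y y′)

  Single : Fin n → Set
  Single y = Y y × (∀ y′ → Y y′ → ¬ Antiadjacent T y y′)

  single-or-paired : ∀ {y} → Y y → Single y ⊎ ∃ (YPair y)
  single-or-paired {y} cy with Finₚ.any? (YPair? y)
  ... | yes p = inj₂ p
  ... | no ¬p = inj₁ (cy , λ y′ cy′ yy′ → ¬p (y′ , cy , cy′ , yy′))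

  Single? : ∀ y → Dec (Single y)
  Single? y = Y? y ×-dec Finₚ.all? (λ y′ → Y? y′ →-dec ¬? (antiadjacent? T y y′))

  single-anti : ∀ {y w} → Single y → Y w → ¬ Antiadjacent T w y
  single-anti (_ , s) cw wy = s _ cw (Antiadjacent-sym T wy)

  -- The end of the edge that misses `y` works: its only neighbour in `X` is the other end, which
  -- sees `y`, and no vertex of `Y` is antiadjacent to `y`.
  XEdge-Single : ∀ {x x′ y} → XEdge x x′ → Single y → IsEvenPair T x y ⊎ IsEvenPair T x′ y
  XEdge-Single {x} {x′} {y} (cx , cx′ , xx′) s with split-X-edge cx cx′ (proj₁ s) xx′
  ... | inj₂ (xy , x′y) = inj₁ (dominated-evenPair T xy dom)
    where
    dom : ∀ w → Adjacent T x w → ¬ Antiadjacent T w y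
    dom w xw with X-or-Y w
    ... | inj₂ cw = single-anti s cw
    ... | inj₁ cw with X-unique cx cw cx′ xw xx′
    ...   | refl = cross-dichotomy cw (proj₁ s) x′y
  ... | inj₁ (xy , x′y) = inj₂ (dominated-evenPair T x′y dom)
    where
    dom : ∀ w → Adjacent T x′ w → ¬ Antiadjacent T w y
    dom w x′w with X-or-Y w
    ... | inj₂ cw = single-anti s cw
    ... | inj₁ cw with X-unique cx′ cw cx x′w (Adjacent-sym T xx′)
    ...   | refl = cross-dichotomy cw (proj₁ s) xy

  module _ {x₁ x₂ : Fin n} (e : XEdge x₁ x₂) where

    private
      cx₁ = proj₁ e
      cx₂ = proj₁ (proj₂ e)
      x₁x₂ = proj₂ (proj₂ e)

    -- The antihole is `x₁ y₂ y₁ x₂ y₃ y₄` in this cyclic order: `x₂` has the opposite adjacencies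
    -- of `x₁` towards `Y`, and different anticomponents of `Y` are fully adjacent.
    oriented-antihole : ∀ {y₁ y₂ y₃ y₄} → YPair y₁ y₂ → YPair y₃ y₄ →
      Adjacent T x₁ y₁ → StronglyAntiadjacent T x₁ y₂ → Adjacent T x₁ y₃ → StronglyAntiadjacent T x₁ y₄ →
      y₃ ≢ y₁ → ⊥
    oriented-antihole {y₁} {y₂} {y₃} {y₄} (cy₁ , cy₂ , y₁y₂) (cy₃ , cy₄ , y₃y₄) x₁y₁ x₁y₂ x₁y₃ x₁y₄ y₃≢y₁ =
      noAntihole _ _ (hole (complement T)
        (step (co (Antiadjacent-sym T y₁y₂)) (adj′ (Adjacent-sym T x₂y₂) ∷ apart y₂≢y₃ cy₂ cy₃ cy₁ y₂y₁ y₃≢y₁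
             ∷ apart (y₄≢y₂ ∘ sym) cy₂ cy₄ cy₁ y₂y₁ y₄≢y₁ ∷ [])
        (step (co (Antiadjacent-sym T (strongAnti⇒antiadj T x₂y₁))) (apart (y₃≢y₁ ∘ sym) cy₁ cy₃ cy₂ y₁y₂ (y₂≢y₃ ∘ sym)
             ∷ apart (y₄≢y₁ ∘ sym) cy₁ cy₄ cy₂ y₁y₂ y₄≢y₂ ∷ [])
        (step (co (strongAnti⇒antiadj T x₂y₃)) (adj′ x₂y₄ ∷ [])
        (step (co y₃y₄) [] end))))
        (co (strongAnti⇒antiadj T x₁y₂))
        (skip (adj′ x₁y₁) (skip (adj′ x₁x₂) (skip (adj′ x₁y₃) (final (co (strongAnti⇒antiadj T x₁y₄))))))
        (s≤s (s≤s (s≤s (s≤s z≤n)))))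
      where
      co : ∀ {u v} → Antiadjacent T u v → Adjacent (complement T) u v
      co = antiadj⇒adj-complement T
      adj′ : ∀ {u v} → Adjacent T u v → Antiadjacent (complement T) u v
      adj′ = adj⇒antiadj-complement T
      y₂y₁ = Antiadjacent-sym T y₁y₂
      other : ∀ {y} → Y y → Adjacent T x₁ y → StronglyAntiadjacent T x₂ y
      other cy a = [ proj₂ , (λ (s , _) → ⊥-elim (adj⇒¬strongAnti T a s)) ]′ (split-X-edge cx₁ cx₂ cy x₁x₂)
      other′ : ∀ {y} → Y y → StronglyAntiadjacent T x₁ y → Adjacent T x₂ y
      other′ cy s = [ (λ (a , _) → ⊥-elim (adj⇒¬strongAnti T a s)) , proj₂ ]′ (split-X-edge cx₁ cx₂ cy x₁x₂)
      x₂y₁ = other cy₁ x₁y₁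
      x₂y₃ = other cy₃ x₁y₃
      x₂y₂ = other′ cy₂ x₁y₂
      x₂y₄ = other′ cy₄ x₁y₄
      y₂≢y₃ : y₂ ≢ y₃
      y₂≢y₃ refl = adj⇒¬strongAnti T x₁y₃ x₁y₂
      y₄≢y₁ : y₄ ≢ y₁
      y₄≢y₁ refl = adj⇒¬strongAnti T x₁y₁ x₁y₄
      y₄≢y₂ : y₄ ≢ y₂
      y₄≢y₂ refl = y₃≢y₁ (Y-unique cy₄ cy₃ cy₁ (Antiadjacent-sym T y₃y₄) y₂y₁)
      apart : ∀ {u v w} → u ≢ v → Y u → Y v → Y w → Antiadjacent T u w → v ≢ w → Antiadjacent (complement T) u v
      apart u≢v cu cv cw uw v≢w = adj′ (¬antiadj⇒adj T u≢v (λ uv → v≢w (Y-unique cu cv cw uv uw)))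
    private
      first-adjacent : ∀ {y y′} → YPair y y′ →
        ∃[ z ] ∃[ z′ ] ((z ≡ y ⊎ z ≡ y′) × YPair z z′ × Adjacent T x₁ z × StronglyAntiadjacent T x₁ z′ × (z′ ≡ y ⊎ z′ ≡ y′))
      first-adjacent {y} {y′} p@(cy , cy′ , yy′) with split-Y-pair cx₁ cy cy′ yy′
      ... | inj₁ (a , s) = y , y′ , inj₁ refl , p , a , s , inj₂ refl
      ... | inj₂ (s , a) = y′ , y , inj₂ refl , (cy′ , cy , Antiadjacent-sym T yy′) , a , s , inj₁ refl

    only-YPair : ∀ {y₁ y₂ y₃ y₄} → YPair y₁ y₂ → YPair y₃ y₄ → y₃ ≡ y₁ ⊎ y₃ ≡ y₂
    only-YPair {y₁} {y₂} {y₃} {y₄} p@(cy₁ , cy₂ , y₁y₂) q@(cy₃ , cy₄ , y₃y₄)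
      with first-adjacent p | first-adjacent q
    ... | z , z′ , z∈ , zp , a , s , z′∈ | w , w′ , w∈ , wp , a′ , s′ , w′∈ with w Finₚ.≟ z
    ...   | no ne = ⊥-elim (oriented-antihole zp wp a s a′ s′ ne)
    ...   | yes refl with Y-unique (proj₁ zp) (proj₁ (proj₂ wp)) (proj₁ (proj₂ zp)) (proj₂ (proj₂ wp)) (proj₂ (proj₂ zp))
    ...     | refl with y₃ Finₚ.≟ w | y₃ Finₚ.≟ w′
    ...       | yes refl | _ = z∈
    ...       | _ | yes refl = z′∈
    ...       | no ne | no ne′ = case w∈ , w′∈ of λ where
                  (inj₁ eq , _) → ⊥-elim (ne (sym eq))
                  (_ , inj₁ eq) → ⊥-elim (ne′ (sym eq))
                  (inj₂ eq , inj₂ eq′) → ⊥-elim (proj₁ (proj₂ (proj₂ zp)) (trans eq (sym eq′)))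

  OnlyPair : Fin n → Fin n → Set
  OnlyPair y₁ y₂ = ∀ {y} → Y y → y ≡ y₁ ⊎ y ≡ y₂

  module _ {y₁ y₂ : Fin n} (p : YPair y₁ y₂) (only : OnlyPair y₁ y₂) where

    -- One class consists of `y₁` and the vertices of `X` that miss it. Every edge inside `X` has
    -- exactly one end adjacent to `y₁`, and every vertex of `X` sees exactly one of `y₁`, `y₂`.
    two-Y-bipartite : Bipartite T
    two-Y-bipartite = colour , λ u v → mono u v (X-or-Y u) (X-or-Y v)
      where
      cy₁ = proj₁ p
      cy₂ = proj₁ (proj₂ p)
      y₁y₂ = proj₂ (proj₂ p)
      colour : Fin n → Bool
      colour w = if c w then not (does (adjacent? T w y₁)) else does (w Finₚ.≟ y₁)
      colour-y₁ : colour y₁ ≡ true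
      colour-y₁ rewrite cy₁ = dec-true (y₁ Finₚ.≟ y₁) refl
      colour-y₂ : colour y₂ ≡ false
      colour-y₂ rewrite cy₂ = dec-false (y₂ Finₚ.≟ y₁) (proj₁ y₁y₂ ∘ sym)
      colour-adj : ∀ {x} → X x → Adjacent T x y₁ → colour x ≡ false
      colour-adj {x} cx a rewrite cx = cong not (dec-true (adjacent? T x y₁) a)
      colour-anti : ∀ {x} → X x → StronglyAntiadjacent T x y₁ → colour x ≡ true
      colour-anti {x} cx s rewrite cx =
        cong not (dec-false (adjacent? T x y₁) (λ a → adj⇒¬strongAnti T a s))
      clash : ∀ {u v} → colour u ≡ true → colour v ≡ false → ¬ colour u ≡ colour v
      clash a b eq = case trans (sym a) (trans eq b) of λ ()
      mixed : ∀ {x y} → X x → Y y → colour x ≡ colour y → StronglyAntiadjacent T x y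
      mixed cx cy eq with only cy | split-Y-pair cx cy₁ cy₂ y₁y₂
      ... | inj₁ refl | inj₂ (s , _) = s
      ... | inj₁ refl | inj₁ (a , _) = ⊥-elim (clash colour-y₁ (colour-adj cx a) (sym eq))
      ... | inj₂ refl | inj₁ (_ , s) = s
      ... | inj₂ refl | inj₂ (s , _) = ⊥-elim (clash (colour-anti cx s) colour-y₂ eq)
      mono : ∀ u v → X u ⊎ Y u → X v ⊎ Y v → u ≢ v → colour u ≡ colour v → StronglyAntiadjacent T u v
      mono u v (inj₁ cu) (inj₂ cv) _ eq = mixed cu cv eq
      mono u v (inj₂ cu) (inj₁ cv) _ eq = StronglyAntiadjacent-sym T (mixed cv cu (sym eq))
      mono u v (inj₂ cu) (inj₂ cv) u≢v eq with only cu | only cv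
      ... | inj₁ refl | inj₁ refl = ⊥-elim (u≢v refl)
      ... | inj₂ refl | inj₂ refl = ⊥-elim (u≢v refl)
      ... | inj₁ refl | inj₂ refl = ⊥-elim (clash colour-y₁ colour-y₂ eq)
      ... | inj₂ refl | inj₁ refl = ⊥-elim (clash colour-y₁ colour-y₂ (sym eq))
      mono u v (inj₁ cu) (inj₁ cv) u≢v eq with adj-or-strongAnti T u≢v
      ... | inj₂ s = s
      ... | inj₁ uv with split-X-edge cu cv cy₁ uv
      ...   | inj₁ (a , s) = ⊥-elim (clash (colour-anti cv s) (colour-adj cu a) (sym eq))
      ...   | inj₂ (s , a) = ⊥-elim (clash (colour-anti cu s) (colour-adj cv a) eq)

  all-X-evenPair : (∀ w → X w) → ∀ {u v} → StronglyAntiadjacent T u v → IsEvenPair T u v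
  all-X-evenPair allX uv = long-paths⇒evenPair T uv λ k p P _ _ →
    case IsPath.inj P fzero (fsuc (fsuc fzero)) (X-unique (allX (p (fsuc fzero))) (allX _) (allX _)
      (Adjacent-sym T (IsPath.adj P fzero (fsuc fzero) refl))
      (IsPath.adj P (fsuc fzero) (fsuc (fsuc fzero)) refl)) of λ ()

  data NoSingleShape : Set where
    empty-Y : (∀ w → X w) → NoSingleShape
    two-Y   : Bipartite T → NoSingleShape

  no-single : ∀ {x x′} → XEdge x x′ → ¬ ∃ Single → NoSingleShape
  no-single e none with Finₚ.any? Y?
  ... | no ¬Y = empty-Y λ w → [ id , (λ cw → ⊥-elim (¬Y (w , cw))) ]′ (X-or-Y w)
  ... | yes (y , cy) with single-or-paired cy
  ...   | inj₁ s = ⊥-elim (none (y , s))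
  ...   | inj₂ (y′ , p) = two-Y (two-Y-bipartite p λ cz → case single-or-paired cz of λ where
            (inj₁ s) → ⊥-elim (none (_ , s))
            (inj₂ (_ , q)) → only-YPair e p q)

  -- A third vertex of `Y` would be adjacent to both ends of the switchable pair.
  semi-YPair-bipartite : ∀ {y y′} → YPair y y′ → Semiadjacent T y y′ → Bipartite T
  semi-YPair-bipartite {y} {y′} p@(cy , cy′ , yy′) s = two-Y-bipartite p only
    where
    only : OnlyPair y y′
    only {z} cz with z Finₚ.≟ y | z Finₚ.≟ y′
    ... | yes eq | _ = inj₁ eq
    ... | _ | yes eq = inj₂ eq
    ... | no z≢y | no z≢y′ = ⊥-elim (semi-no-common-neighbour T switch s
          (¬antiadj⇒adj T (z≢y ∘ sym) λ yz → z≢y′ (Y-unique cy cz cy′ yz yy′))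
          (¬antiadj⇒adj T (z≢y′ ∘ sym) λ y′z → z≢y (Y-unique cy′ cz cy y′z (Antiadjacent-sym T yy′))))

  module _ (noEdge : ∀ {x x′} → ¬ XEdge x x′) where

    -- On a long path the second vertex is antiadjacent to `y′`, so it is in `X`, as `y` is the only
    -- partner of `y′`. Then the third is in `Y` and antiadjacent to `y`, which leaves only `y′`
    -- itself.
    strong-YPair-evenPair : ∀ {y y′} → YPair y y′ → StronglyAntiadjacent T y y′ → IsEvenPair T y y′
    strong-YPair-evenPair {y} {y′} (cy , cy′ , yy′) s =
        long-paths⇒evenPair T s λ { k p P refl refl → ⊥-elim (absurd k p P cy cy′ yy′) }
      where
      absurd : ∀ k p → (P : IsPath T p) → Y (p fzero) → Y (p (last (3 + k))) →
        Antiadjacent T (p fzero) (p (last (3 + k))) → ⊥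
      absurd k p P cy cy′ yy′ with X-or-Y (p (fsuc fzero)) | X-or-Y (p (fsuc (fsuc fzero)))
      ... | inj₂ c₁ | _ = case IsPath.inj P _ _ (Y-unique cy′ c₁ cy
              (Antiadjacent-sym T (IsPath.nonadj P (fsuc fzero) (last (3 + k)) (s≤s (s≤s (s≤s z≤n)))))
              (Antiadjacent-sym T yy′)) of λ ()
      ... | inj₁ c₁ | inj₁ c₂ = noEdge (c₁ , c₂ , IsPath.adj P (fsuc fzero) (fsuc (fsuc fzero)) refl)
      ... | inj₁ c₁ | inj₂ c₂ = case IsPath.inj P _ _ (Y-unique cy c₂ cy′
              (IsPath.nonadj P fzero (fsuc (fsuc fzero)) (s≤s (s≤s z≤n))) yy′) of λ ()

    stable-X-hasEvenPair : ∀ {u v} → StronglyAntiadjacent T u v → Bipartite T ⊎ HasEvenPair T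
    stable-X-hasEvenPair {u} {v} uv with Finₚ.any? (λ y → Finₚ.any? (YPair? y))
    ... | yes (y , y′ , p@(_ , _ , yy′)) with adj-or-strongAnti T (proj₁ yy′)
    ...   | inj₁ a = inj₁ (semi-YPair-bipartite p (adj∧antiadj⇒semi T a yy′))
    ...   | inj₂ s = inj₂ (y , y′ , strong-YPair-evenPair p s)
    stable-X-hasEvenPair {u} {v} uv | no noPair
      with Finₚ.any? (λ x → Finₚ.any? (λ y → X? x ×-dec (Y? y ×-dec strongAnti? T x y)))
    ... | yes (x , y , cx , cy , xy) = inj₂ (x , y , dominated-evenPair T xy λ w xw wy → case X-or-Y w of λ where
            (inj₁ cw) → noEdge (cx , cw , xw)
            (inj₂ cw) → noPair (w , y , cw , cy , wy))
    ... | no noAnti with X-or-Y u | X-or-Y v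
    ...   | inj₂ cu | inj₂ cv = ⊥-elim (noPair (u , v , cu , cv , strongAnti⇒antiadj T uv))
    ...   | inj₁ cu | inj₂ cv = ⊥-elim (noAnti (u , v , cu , cv , uv))
    ...   | inj₂ cu | inj₁ cv = ⊥-elim (noAnti (v , u , cv , cu , StronglyAntiadjacent-sym T uv))
    ...   | inj₁ cu | inj₁ cv = inj₂ (u , v , dominated-evenPair T uv λ w uw wv → case X-or-Y w of λ where
            (inj₁ cw) → noEdge (cu , cw , uw)
            (inj₂ cw) → noAnti (v , w , cv , cw , ¬adj⇒strongAnti T (proj₁ wv ∘ sym)
              (λ vw → cross-dichotomy cv cw vw (Antiadjacent-sym T wv))))

  doubled-hasEvenPair : ∀ {u v} → StronglyAntiadjacent T u v → Bipartite T ⊎ HasEvenPair T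
  doubled-hasEvenPair {u} {v} uv with Finₚ.any? (λ x → Finₚ.any? (XEdge? x)) | Finₚ.any? Single?
  ... | no none | _ = stable-X-hasEvenPair (λ {x} {x′} e → none (x , x′ , e)) uv
  ... | yes (x , x′ , e) | yes (y , s) = inj₂ ([ (λ ev → x , y , ev) , (λ ev → x′ , y , ev) ]′ (XEdge-Single e s))
  ... | yes (x , x′ , e) | no none with no-single e none
  ...   | empty-Y all = inj₂ (u , v , all-X-evenPair all uv)
  ...   | two-Y bip   = inj₁ bip

  -- Doubled graphs with the switchable pair inside `X`

  module SmallX {d₁ d₂ : Fin n} (e : XEdge d₁ d₂) where

    InPair : Fin n → Set
    InPair w = w ≡ d₁ ⊎ w ≡ d₂

    InPair? : ∀ w → Dec (InPair w)
    InPair? w = (w Finₚ.≟ d₁) ⊎-dec (w Finₚ.≟ d₂)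

    GoodPair : Set
    GoodPair = ∃[ u ] ∃[ v ] (IsEvenPair T u v × ¬ InPair u × ¬ InPair v)

    Y-outside : ∀ {y} → Y y → ¬ InPair y
    Y-outside cy (inj₁ refl) = X∧Y (proj₁ e) cy
    Y-outside cy (inj₂ refl) = X∧Y (proj₁ (proj₂ e)) cy

    module _ (noEdge : ∀ {x x′} → XEdge x x′ → InPair x)
             (full : ∀ {x y} → X x → ¬ InPair x → Single y → Adjacent T x y) where

      no-X-neighbour : ∀ {x w} → X x → ¬ InPair x → Adjacent T x w → ¬ X w
      no-X-neighbour cx x∉ xw cw = x∉ (noEdge (cx , cw , xw))

      -- The only possible path of length at least three is `x y₁ d d′ y₂`, where `d d′` is the one
      -- edge of `X`; its length is four.
      X-paired-evenPair : ∀ {x y₁ y₂} → X x → ¬ InPair x → YPair y₁ y₂ →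
        StronglyAntiadjacent T x y₂ → IsEvenPair T x y₂
      X-paired-evenPair {x} {y₁} {y₂} cx x∉ q@(cy₁ , cy₂ , y₁y₂) xy₂ =
          long-paths⇒evenPair T xy₂ λ { k p P refl eq → long k p P cx x∉ eq }
        where
        single : ∀ {y} → Y y → y ≢ y₁ → y ≢ y₂ → Single y
        single cy ≢₁ ≢₂ with single-or-paired cy
        ... | inj₁ s = s
        ... | inj₂ (_ , q′) = ⊥-elim ([ ≢₁ , ≢₂ ]′ (only-YPair e q q′))
        long : ∀ k p → IsPath T p → X (p fzero) → ¬ InPair (p fzero) → p (last (3 + k)) ≡ y₂ →
          Even (3 + k)
        long k p P c₀ p₀∉ pend = go₁ (X-or-Y p₁)
          where
          p₁ = p (fsuc fzero)
          p₂ = p (fsuc (fsuc fzero))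
          p₃ = p (fsuc (fsuc (fsuc fzero)))
          p₀p₁ = IsPath.adj P fzero (fsuc fzero) refl
          p₁p₂ = IsPath.adj P (fsuc fzero) (fsuc (fsuc fzero)) refl
          p₂p₃ = IsPath.adj P (fsuc (fsuc fzero)) (fsuc (fsuc (fsuc fzero))) refl
          p₁≢y₂ : p₁ ≢ y₂
          p₁≢y₂ = last≢ T P (fsuc fzero) pend (s≤s (s≤s z≤n))
          p₁∼y₂ : Antiadjacent T p₁ y₂
          p₁∼y₂ = subst (Antiadjacent T p₁) pend (IsPath.nonadj P (fsuc fzero) (last (3 + k)) (s≤s (s≤s (s≤s z≤n))))
          module _ (p₁≡y₁ : p₁ ≡ y₁) where
            y₁p₂ : Adjacent T y₁ p₂
            y₁p₂ = subst (λ w → Adjacent T w p₂) p₁≡y₁ p₁p₂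
            later-Y : ∀ {w} → Y w → Antiadjacent T p₁ w → w ≡ y₂
            later-Y cw a = Y-unique cy₁ cw cy₂ (subst (λ v → Antiadjacent T v _) p₁≡y₁ a) y₁y₂
            p₂≢y₂ : p₂ ≢ y₂
            p₂≢y₂ = last≢ T P (fsuc (fsuc fzero)) pend (s≤s (s≤s (s≤s z≤n)))
            go₂ : X p₂ ⊎ Y p₂ → Even (3 + k)
            go₂ (inj₂ c₂) = ⊥-elim (cross-dichotomy c₀ c₂
              (full c₀ p₀∉ (single c₂ (λ eq → proj₁ y₁p₂ (sym eq)) p₂≢y₂))
              (IsPath.nonadj P fzero (fsuc (fsuc fzero)) (s≤s (s≤s z≤n))))
            go₂ (inj₁ c₂) = go₃ (X-or-Y p₃)
              where
              p₁∼p₃ : Antiadjacent T p₁ p₃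
              p₁∼p₃ = IsPath.nonadj P (fsuc fzero) (fsuc (fsuc (fsuc fzero))) (s≤s (s≤s (s≤s z≤n)))
              go₃ : X p₃ ⊎ Y p₃ → Even (3 + k)
              go₃ (inj₂ c₃) with later-Y c₃ p₁∼p₃
              ... | eq = case split-Y-pair c₂ cy₁ cy₂ y₁y₂ of λ where
                    (inj₁ (_ , s)) → ⊥-elim (adj⇒¬strongAnti T (subst (Adjacent T p₂) eq p₂p₃) s)
                    (inj₂ (s , _)) → ⊥-elim (adj⇒¬strongAnti T (Adjacent-sym T y₁p₂) s)
              go₃ (inj₁ c₃) = go₄ k p P c₂ c₃ pend (λ w∼ cw → later-Y cw w∼)
                where
                -- The path now begins with `x y₁` and an edge of `X`. The next vertex can neither
                -- be a third vertex of that component nor be in `Y` without being `y₂`, so the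
                -- length is four.
                go₄ : ∀ k p → IsPath T p → X (p (fsuc (fsuc fzero))) → X (p (fsuc (fsuc (fsuc fzero)))) →
                  p (last (3 + k)) ≡ y₂ →
                  (∀ {w} → Antiadjacent T (p (fsuc fzero)) w → Y w → w ≡ y₂) → Even (3 + k)
                go₄ zero p P c₂ c₃ pend _ = ⊥-elim (X∧Y c₃ (subst Y (sym pend) cy₂))
                go₄ (suc zero) p P _ _ _ _ = refl
                go₄ (suc (suc k)) p P c₂ c₃ pend later with X-or-Y (p (fsuc (fsuc (fsuc (fsuc fzero)))))
                ... | inj₁ c₄ = case IsPath.inj P _ _ (X-unique c₃ c₂ c₄
                        (Adjacent-sym T (IsPath.adj P (fsuc (fsuc fzero)) (fsuc (fsuc (fsuc fzero))) refl))
                        (IsPath.adj P (fsuc (fsuc (fsuc fzero))) (fsuc (fsuc (fsuc (fsuc fzero)))) refl)) of λ ()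
                ... | inj₂ c₄ = ⊥-elim (last≢ T P (fsuc (fsuc (fsuc (fsuc fzero)))) pend
                        (s≤s (s≤s (s≤s (s≤s (s≤s z≤n)))))
                        (later (IsPath.nonadj P (fsuc fzero) (fsuc (fsuc (fsuc (fsuc fzero)))) (s≤s (s≤s (s≤s z≤n)))) c₄))
          go₁ : X p₁ ⊎ Y p₁ → Even (3 + k)
          go₁ (inj₁ c₁) = ⊥-elim (no-X-neighbour c₀ p₀∉ p₀p₁ c₁)
          go₁ (inj₂ c₁) with p₁ Finₚ.≟ y₁
          ... | yes eq = go₂ eq (X-or-Y p₂)
          ... | no ne  = ⊥-elim (single-anti (single c₁ ne p₁≢y₂) cy₂ (Antiadjacent-sym T p₁∼y₂))

      X-with-YPair : ∀ {x y₁ y₂} → X x → ¬ InPair x → YPair y₁ y₂ → GoodPair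
      X-with-YPair {x} {y₁} {y₂} cx x∉ q@(cy₁ , cy₂ , y₁y₂) with split-Y-pair cx cy₁ cy₂ y₁y₂
      ... | inj₁ (_ , s) = x , y₂ , X-paired-evenPair cx x∉ q s , x∉ , Y-outside cy₂
      ... | inj₂ (s , _) = x , y₁ , X-paired-evenPair cx x∉ (cy₂ , cy₁ , Antiadjacent-sym T y₁y₂) s , x∉ , Y-outside cy₁

      -- Of two antiadjacent vertices of `Y` one is adjacent to `d`.
      rest-clique : (∀ {w} → X w → InPair w) → ∀ {d} → X d → RestCliqueSmall T d₁ d₂ d
      rest-clique allX cd u v (u≢₁ , u≢₂ , ¬du) (v≢₁ , v≢₂ , ¬dv) u≢v with adj-or-strongAnti T u≢v
      ... | inj₁ a = a
      ... | inj₂ s with X-or-Y u | X-or-Y v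
      ...   | inj₁ cu | _ = ⊥-elim ([ u≢₁ , u≢₂ ]′ (allX cu))
      ...   | inj₂ _ | inj₁ cv = ⊥-elim ([ v≢₁ , v≢₂ ]′ (allX cv))
      ...   | inj₂ cu | inj₂ cv = ⊥-elim ([ ¬du ∘ proj₁ , ¬dv ∘ proj₂ ]′ (split-Y-pair cd cu cv (strongAnti⇒antiadj T s)))

      full-pair : (¬ RestCliqueSmall T d₁ d₂ d₁ ⊎ ¬ RestCliqueSmall T d₁ d₂ d₂) →
        ∀ {u v} → StronglyAntiadjacent T u v → ¬ InPair u → ¬ InPair v → GoodPair
      full-pair cond {u} {v} uv u∉ v∉
        with Finₚ.any? (λ x → X? x ×-dec ¬? (InPair? x)) | Finₚ.any? (λ y → Finₚ.any? (YPair? y))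
      ... | no none | _ = ⊥-elim ([ (λ ¬r → ¬r (rest-clique allX (proj₁ e))) , (λ ¬r → ¬r (rest-clique allX (proj₁ (proj₂ e)))) ]′ cond)
        where
        allX : ∀ {w} → X w → InPair w
        allX {w} cw with InPair? w
        ... | yes i = i
        ... | no ¬i = ⊥-elim (none (w , cw , ¬i))
      ... | yes (x , cx , x∉) | yes (y , y′ , q) = X-with-YPair cx x∉ q
      ... | yes _ | no noPair with X-or-Y u | X-or-Y v
      ...   | inj₂ cu | inj₂ cv = ⊥-elim (noPair (u , v , cu , cv , strongAnti⇒antiadj T uv))
      ...   | inj₁ cu | inj₂ cv = ⊥-elim (adj⇒¬strongAnti T (full cu u∉ (cv , λ w cw vw → noPair (v , w , cv , cw , vw))) uv)
      ...   | inj₂ cu | inj₁ cv = ⊥-elim (adj⇒¬strongAnti T (full cv v∉ (cu , λ w cw uw → noPair (u , w , cu , cw , uw)))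
                (StronglyAntiadjacent-sym T uv))
      ...   | inj₁ cu | inj₁ cv = u , v , dominated-evenPair T uv dom , u∉ , v∉
        where
        dom : ∀ w → Adjacent T u w → ¬ Antiadjacent T w v
        dom w uw wv with X-or-Y w
        ... | inj₁ cw = no-X-neighbour cu u∉ uw cw
        ... | inj₂ cw = cross-dichotomy cv cw (full cv v∉ (cw , λ z cz wz → noPair (w , z , cw , cz , wz)))
                          (Antiadjacent-sym T wv)

    -- Each failed attempt adds structure. What reaches `full-pair` has the switchable pair as the
    -- only edge in `X`, and all other vertices of `X` complete to the vertices of `Y` that have no
    -- partner.
    smallX-pair : (¬ RestCliqueSmall T d₁ d₂ d₁ ⊎ ¬ RestCliqueSmall T d₁ d₂ d₂) →
      ∀ {u v} → StronglyAntiadjacent T u v → ¬ InPair u → ¬ InPair v → Bipartite T ⊎ GoodPair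
    smallX-pair cond {u} {v} uv u∉ v∉ with Finₚ.any? Single?
    ... | no none = case no-single e none of λ where
          (empty-Y all) → inj₂ (u , v , all-X-evenPair all uv , u∉ , v∉)
          (two-Y bip)   → inj₁ bip
    ... | yes (y , s) with Finₚ.any? (λ x → Finₚ.any? (λ x′ → XEdge? x x′ ×-dec ¬? (InPair? x)))
    ...   | yes (x , x′ , e′@(cx , cx′ , xx′) , x∉) = inj₂ (case XEdge-Single e′ s of λ where
            (inj₁ ev) → x , y , ev , x∉ , Y-outside (proj₁ s)
            (inj₂ ev) → x′ , y , ev , x′∉ , Y-outside (proj₁ s))
      where
      x′∉ : ¬ InPair x′
      x′∉ (inj₁ refl) = x∉ (inj₂ (X-unique cx′ cx (proj₁ (proj₂ e)) (Adjacent-sym T xx′) (proj₂ (proj₂ e))))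
      x′∉ (inj₂ refl) = x∉ (inj₁ (X-unique cx′ cx (proj₁ e) (Adjacent-sym T xx′) (Adjacent-sym T (proj₂ (proj₂ e)))))
    ...   | no noOther with Finₚ.any? (λ x → Finₚ.any? (λ y → (X? x ×-dec ¬? (InPair? x)) ×-dec (Single? y ×-dec strongAnti? T x y)))
    ...     | yes (x , y′ , (cx , x∉) , s′ , xy′) = inj₂ (x , y′ , dominated-evenPair T xy′ dom , x∉ , Y-outside (proj₁ s′))
      where
      dom : ∀ w → Adjacent T x w → ¬ Antiadjacent T w y′
      dom w xw wy with X-or-Y w
      ... | inj₁ cw = noOther (x , w , (cx , cw , xw) , x∉)
      ... | inj₂ cw = single-anti s′ cw wy
    ...     | no noAnti = inj₂ (full-pair
              (λ {x} {x′} e′ → case InPair? x of λ where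
                (yes i) → i
                (no ¬i) → ⊥-elim (noOther (x , x′ , e′ , ¬i)))
              (λ {x} {y} cx x∉ s′ → [ id , (λ a → ⊥-elim (noAnti (x , y , (cx , x∉) , s′ , a))) ]′
                (adj-or-strongAnti T (X≢Y cx (proj₁ s′))))
              cond uv u∉ v∉)

doubled-conclusion : ∀ {n} (T : Trigraph n) → NoAntihole T → DoubledGraph T → (F : InF T) → Conclusion T F
doubled-conclusion T noAntihole (c , good) F@(_ , switch) = any , disjoint F refl
  where
  open Doubled T c good switch noAntihole
  any : IsComplete T ⊎ HasEvenPair T
  any with complete-or-strongAnti T
  ... | inj₁ complete = inj₁ complete
  ... | inj₂ (u , v , uv) = [ (λ bip → proj₁ (bipartite-conclusion T bip F)) , inj₂ ]′ (doubled-hasEvenPair uv)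
  disjoint : (F : InF T) → proj₂ F ≡ switch → Favorable T F → HasEvenPairDisjoint T F
  disjoint F@(_ , noSwitch _) _ fav@(_ , (u , v , uv , _) , _) = case doubled-hasEvenPair uv of λ where
    (inj₁ bip) → proj₂ (bipartite-conclusion T bip F) fav
    (inj₂ (e , f , even)) → e , f , even , (λ ()) , λ ()
  disjoint F@(_ , small x y xy _ _) refl fav@(_ , (u , v , uv , u∉ , v∉) , cond) with X-or-Y x | X-or-Y y
  ... | inj₁ cx | inj₂ cy = ⊥-elim (noSemi′ cx cy)
    where
    noSemi′ : X x → Y y → ⊥
    noSemi′ cx cy = IsGoodPartition.noSemi good x y cx cy xy
  ... | inj₂ cx | inj₁ cy = ⊥-elim (IsGoodPartition.noSemi good y x cy cx (Semiadjacent-sym T xy))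
  ... | inj₂ cx | inj₂ cy =
        proj₂ (bipartite-conclusion T (semi-YPair-bipartite (cx , cy , semi⇒antiadj T xy) xy) F) fav
  ... | inj₁ cx | inj₁ cy = case SmallX.smallX-pair (cx , cy , semi⇒adj T xy) cond uv u∉ v∉ of λ where
        (inj₁ bip) → proj₂ (bipartite-conclusion T bip F) fav
        (inj₂ good) → good
  -- No switchable pair crosses the partition, so `v`, `x`, `y` lie in one part, where `v` would
  -- have two partners.
  disjoint (_ , light v x y x≢y vx vy _ _ _ _) _ _ with X-or-Y v | X-or-Y x | X-or-Y y
  ... | inj₁ cv | inj₁ cx | inj₁ cy = ⊥-elim (x≢y (X-unique cv cx cy (semi⇒adj T vx) (semi⇒adj T vy)))
  ... | inj₂ cv | inj₂ cx | inj₂ cy = ⊥-elim (x≢y (Y-unique cv cx cy (semi⇒antiadj T vx) (semi⇒antiadj T vy)))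
  ... | inj₁ cv | inj₂ cx | _ = ⊥-elim (IsGoodPartition.noSemi good _ _ cv cx vx)
  ... | inj₁ cv | _ | inj₂ cy = ⊥-elim (IsGoodPartition.noSemi good _ _ cv cy vy)
  ... | inj₂ cv | inj₁ cx | _ = ⊥-elim (IsGoodPartition.noSemi good _ _ cx cv (Semiadjacent-sym T vx))
  ... | inj₂ cv | _ | inj₁ cy = ⊥-elim (IsGoodPartition.noSemi good _ _ cy cv (Semiadjacent-sym T vy))

-- Complements of bipartite trigraphs

module CoBipartite {n : ℕ} (T : Trigraph n) (c : Fin n → Bool)
  (mono : ∀ u v → u ≢ v → c u ≡ c v → StronglyAntiadjacent (complement T) u v)
  (switch : SwitchStructure T) (noAntihole : NoAntihole T) where

  E : Fin n → Fin n → Set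
  E u v = StronglyAntiadjacent T u v

  E-sym : ∀ {u v} → E u v → E v u
  E-sym = StronglyAntiadjacent-sym T

  open Graph Finₚ._≟_ (allFin n) ∈-allFin E (strongAnti? T) E-sym

  same-colour⇒strong : ∀ {u v} → u ≢ v → c u ≡ c v → θ T u v ≡ strong
  same-colour⇒strong {u} {v} u≢v eq with θ T u v | proj₂ (mono u v u≢v eq)
  ... | strong | _ = refl

  same-colour⇒¬antiadj : ∀ {u v} → c u ≡ c v → ¬ Antiadjacent T u v
  same-colour⇒¬antiadj eq (u≢v , inj₁ p) = case trans (sym (same-colour⇒strong u≢v eq)) p of λ ()
  same-colour⇒¬antiadj eq (u≢v , inj₂ p) = case trans (sym (same-colour⇒strong u≢v eq)) p of λ ()

  E-colours : ∀ {u v} → E u v → c u ≢ c v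
  E-colours e eq = same-colour⇒¬antiadj eq (strongAnti⇒antiadj T e)

  E-same : ∀ {u v w} → E u v → E w v → c u ≡ c w
  E-same e f = ≢∧≢⇒≡ (E-colours e) (E-colours f)

  Bisimplicial : List (Fin n) → Fin n → Fin n → Set
  Bisimplicial Z u v = E u v × (∀ {a b} → a ∉ Z → b ∉ Z → E a v → E b u → E a b)

  module _ (Z : List (Fin n)) where

    Away : List (Fin n) → Fin n → Set
    Away C u = u ∉ Z × u ∉ C × All (λ d → ¬ E d u) C

    Away? : ∀ C u → Dec (Away C u)
    Away? C u = ¬? (u ∈? Z) ×-dec (¬? (u ∈? C) ×-dec All.all? (λ d → ¬? (strongAnti? T d u)) C)

    AwayEdge : List (Fin n) → Set
    AwayEdge C = ∃[ u ] ∃[ v ] (Away C u × Away C v × E u v)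

    AwayEdge? : ∀ C → Dec (AwayEdge C)
    AwayEdge? C = Finₚ.any? λ u → Finₚ.any? λ v → Away? C u ×-dec (Away? C v ×-dec strongAnti? T u v)

    Attached : List (Fin n) → Fin n → Set
    Attached C s = s ∉ Z × s ∉ C × Any (λ d → E d s) C

    away-or-attached : ∀ C {s} → s ∉ Z → s ∉ C → Away C s ⊎ Attached C s
    away-or-attached C {s} s∉Z s∉C with Any.any? (λ d → strongAnti? T d s) C
    ... | yes att = inj₂ (s∉Z , s∉C , att)
    ... | no ¬att = inj₁ (s∉Z , s∉C , Allₚ.¬Any⇒All¬ C ¬att)

    -- Maximality is tested against adding a single attached vertex, which is all that
    -- `attached-complete` uses.
    record Maximal (C : List (Fin n)) : Set where
      field
        connected : ∀ {d d′} → d ∈ C → d′ ∈ C → Walk (_∈ C) d d′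
        edge      : AwayEdge C
        maximal   : ∀ {s} → Attached C s → ¬ AwayEdge (s ∷ C)

    -- A vertex of `C` outside `Z` is kept in the result so that deleting `C` afterwards makes the
    -- graph strictly smaller.
    extend : ∀ C → Acc _<_ (free (C ++ Z)) → (∀ {d d′} → d ∈ C → d′ ∈ C → Walk (_∈ C) d d′) → AwayEdge C →
      ∃[ d ] (d ∈ C × d ∉ Z) → ∃[ C′ ] (Maximal C′ × ∃[ d ] (d ∈ C′ × d ∉ Z))
    extend C (acc rec) conn edge ne
      with Finₚ.any? (λ s → (¬? (s ∈? Z) ×-dec (¬? (s ∈? C) ×-dec Any.any? (λ d → strongAnti? T d s) C)) ×-dec AwayEdge? (s ∷ C))
    ... | no none = C , record { connected = conn ; edge = edge ; maximal = λ att e → none (_ , att , e) } , ne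
    ... | yes (s , (s∉Z , s∉C , att) , edge′) with find att
    ...   | d₀ , d₀∈ , d₀s =
      extend (s ∷ C) (rec (free-< there (λ s∈ → [ s∉C , s∉Z ]′ (∈-++⁻ C s∈)) (here refl))) conn′ edge′ (s , here refl , s∉Z)
      where
      into : ∀ {d} → d ∈ s ∷ C → Walk (_∈ s ∷ C) d d₀
      into (here refl) = go (here refl) (E-sym d₀s) (stop (there d₀∈))
      into (there d∈)  = walk-map there (conn d∈ d₀∈)
      conn′ : ∀ {d d′} → d ∈ s ∷ C → d′ ∈ s ∷ C → Walk (_∈ s ∷ C) d d′
      conn′ d∈ d′∈ = walk-trans (into d∈) (walk-sym (into d′∈))

  co-adj : ∀ {u v} → E u v → Adjacent (complement T) u v
  co-adj = antiadj⇒adj-complement T ∘ strongAnti⇒antiadj T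

  co-anti : ∀ {u v} → u ≢ v → ¬ E u v → Antiadjacent (complement T) u v
  co-anti u≢v ¬e = adj⇒antiadj-complement T ([ id , ⊥-elim ∘ ¬e ]′ (adj-or-strongAnti T u≢v))

  induced⇒inducedPath : ∀ {A b y xs} → Induced A (λ x → E x b) y xs → b ∉ y ∷ xs →
    InducedPath (complement T) y (xs ++ [ b ])
  induced⇒inducedPath (end _ p) b∉ = step (co-adj p) [] end
  induced⇒inducedPath {xs = x ∷ xs} (step _ ¬p e none y∉ ind) b∉ =
    step (co-adj e)
      (Allₚ.++⁺ (All.tabulate λ z∈ → co-anti (λ { refl → y∉ (there z∈) }) (All.lookup none z∈))
                (co-anti (λ { refl → b∉ (here refl) }) ¬p ∷ []))
      (induced⇒inducedPath ind (b∉ ∘ there))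

  module _ {Z C : List (Fin n)} (M : Maximal Z C) where
    open Maximal M

    -- Otherwise `a` could be added to `C`: it misses `u`, being on the same side, and it misses
    -- `b`, so `u b` would still be an edge away from the larger set.
    attached-complete : ∀ {a u b} → Attached Z C a → Away Z C u → Away Z C b → E u b → c a ≡ c u → E a b
    attached-complete {a} {u} {b} att (u∉Z , u∉C , u-) (b∉Z , b∉C , b-) ub ca≡cu with strongAnti? T a b
    ... | yes e = e
    ... | no ¬ab = ⊥-elim (maximal att (u , b ,
            (u∉Z , off-∷ (λ { refl → clash u- att }) u∉C , (λ e → E-colours e ca≡cu) ∷ u-) ,
            (b∉Z , off-∷ (λ { refl → clash b- att }) b∉C , ¬ab ∷ b-) , ub))
      where
      clash : ∀ {s} → All (λ d → ¬ E d s) C → Attached Z C s → ⊥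
      clash none (_ , _ , some) = let d , d∈ , e = find some in All.lookup none d∈ e

    -- A shortest path from a to b through C closes up with v and u to a long hole of the complement.
    attached-joined : ∀ {a b u v} → Attached Z C a → Attached Z C b → Away Z C u → Away Z C v → E u v →
      E a v → E b u → E a b
    attached-joined {a} {b} {u} {v} (_ , a∉C , atta) (_ , b∉C , attb) (_ , u∉C , u-) (_ , v∉C , v-) uv av bu
      with v Finₚ.≟ b | u Finₚ.≟ a
    ... | yes refl | _ = av
    ... | no _ | yes refl = E-sym bu
    ... | no v≢b | no u≢a with find atta | find attb
    ...   | d , d∈ , da | d′ , d′∈ , d′b
      with induce {A = λ x → x ≡ a ⊎ x ∈ C} (λ x → strongAnti? T x b)
             (go (inj₁ refl) (E-sym da) (walk-map inj₂ (connected d∈ d′∈))) d′b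
    ...     | _ , end _ e = e
    ...     | _ , ind@(step {x = x} {xs} _ ¬ab ax none a∉ ind′) = ⊥-elim (noAntihole _ _ (hole (complement T)
              (step (co-adj (E-sym av)) (Allₚ.++⁺ {xs = x ∷ xs} (All.map v-anti inC) (v-b ∷ []))
                (induced⇒inducedPath ind b∉))
              (co-adj uv)
              (skip (co-anti u≢a (λ e → E-colours e (E-same uv av))) (to-last (All.map u-anti inC)))
              (s≤s (s≤s (s≤s (long xs))))))
      where
      c∈ : ∀ {z} → z ∈ x ∷ xs → z ∈ C
      c∈ z∈ with All.lookup (induced-all ind) (there z∈)
      ... | inj₁ refl = ⊥-elim (a∉ z∈)
      ... | inj₂ z∈C  = z∈C
      inC : All (_∈ C) (x ∷ xs)
      inC = All.tabulate c∈
      v-anti : ∀ {z} → z ∈ C → Antiadjacent (complement T) v z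
      v-anti z∈ = co-anti (λ { refl → v∉C z∈ }) (λ e → All.lookup v- z∈ (E-sym e))
      u-anti : ∀ {z} → z ∈ C → Antiadjacent (complement T) u z
      u-anti z∈ = co-anti (λ { refl → u∉C z∈ }) (λ e → All.lookup u- z∈ (E-sym e))
      v-b : Antiadjacent (complement T) v b
      v-b = co-anti v≢b (λ e → E-colours e (E-same (E-sym uv) bu))
      b∉ : b ∉ a ∷ x ∷ xs
      b∉ (here refl) = E-colours bu (E-same av uv)
      b∉ (there b∈)  = b∉C (c∈ b∈)
      to-last : ∀ {ys} → All (Antiadjacent (complement T) u) ys → AdjacentToLast (complement T) u (ys ++ [ b ])
      to-last []       = final (co-adj (E-sym bu))
      to-last (a ∷ as) = skip a (to-last as)
      long : ∀ ys → 1 ≤ length (ys ++ [ b ])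
      long []      = s≤s z≤n
      long (_ ∷ _) = s≤s z≤n

  -- If no vertex has an edge away from it, every edge is bisimplicial: a missing edge `a b` would
  -- leave `u b` away from `a`. After the induction step, neighbours of `u` or `v` are never in `C`;
  -- they are away from it or attached to it, and the four combinations are settled separately.
  bisimplicial-acc : ∀ Z → Acc _<_ (free Z) → (∃[ u ] ∃[ v ] (u ∉ Z × v ∉ Z × E u v)) →
    ∃[ u ] ∃[ v ] (u ∉ Z × v ∉ Z × Bisimplicial Z u v)
  bisimplicial-acc Z (acc rec) (u , v , u∉ , v∉ , uv)
    with Finₚ.any? (λ d → ¬? (d ∈? Z) ×-dec AwayEdge? Z [ d ])
  ... | no none = u , v , u∉ , v∉ , uv , bis
    where
    bis : ∀ {a b} → a ∉ Z → b ∉ Z → E a v → E b u → E a b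
    bis {a} {b} a∉ b∉ av bu with strongAnti? T a b
    ... | yes e = e
    ... | no ¬ab with u Finₚ.≟ a
    ...   | yes refl = E-sym bu
    ...   | no u≢a = ⊥-elim (none (a , a∉ , u , b ,
              (u∉ , off-∷ u≢a (λ ()) , (λ e → E-colours e (E-same av uv)) ∷ []) ,
              (b∉ , off-∷ (λ { refl → E-colours bu (E-same av uv) }) (λ ()) , ¬ab ∷ []) , E-sym bu))
  ... | yes (d , d∉ , edge) with extend Z [ d ] (<-wellFounded _)
                                  (λ { (here refl) (here refl) → stop (here refl) }) edge (d , here refl , d∉)
  ...   | C , M , (d₀ , d₀∈ , d₀∉Z) = finish (bisimplicial-acc Z′ (rec (free-< (∈-++⁺ʳ C ∘ ∈-++⁺ʳ N) d₀∉Z (∈-++⁺ˡ d₀∈)))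
            (let u , v , Au , Av , e = Maximal.edge M in u , v , away⇒∉ Au , away⇒∉ Av , e))
    where
    N : List (Fin n)
    N = filter (λ s → Any.any? (λ d → strongAnti? T d s) C) (allFin n)
    Z′ : List (Fin n)
    Z′ = C ++ N ++ Z
    away⇒∉ : ∀ {w} → Away Z C w → w ∉ Z′
    away⇒∉ (w∉Z , w∉C , none) w∈ with ∈-++⁻ C w∈
    ... | inj₁ w∈C = w∉C w∈C
    ... | inj₂ w∈′ with ∈-++⁻ N w∈′
    ...   | inj₂ w∈Z = w∉Z w∈Z
    ...   | inj₁ w∈N = let _ , some = ∈-filter⁻ (λ s → Any.any? (λ d → strongAnti? T d s) C) {xs = allFin n} w∈N
                           d , d∈ , e = find some in All.lookup none d∈ e
    ∉⇒away : ∀ {w} → w ∉ Z′ → Away Z C w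
    ∉⇒away w∉ with away-or-attached Z C (w∉ ∘ ∈-++⁺ʳ C ∘ ∈-++⁺ʳ N) (w∉ ∘ ∈-++⁺ˡ)
    ... | inj₁ away = away
    ... | inj₂ (_ , _ , some) = ⊥-elim (w∉ (∈-++⁺ʳ C (∈-++⁺ˡ
            (∈-filter⁺ (λ s → Any.any? (λ d → strongAnti? T d s) C) (∈-allFin _) some))))
    finish : ∃[ u ] ∃[ v ] (u ∉ Z′ × v ∉ Z′ × Bisimplicial Z′ u v) →
      ∃[ u ] ∃[ v ] (u ∉ Z × v ∉ Z × Bisimplicial Z u v)
    finish (u , v , u∉ , v∉ , uv , bis) with ∉⇒away u∉ | ∉⇒away v∉
    ... | Au@(u∉Z , _ , u-) | Av@(v∉Z , _ , v-) = u , v , u∉Z , v∉Z , uv , bis′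
      where
      bis′ : ∀ {a b} → a ∉ Z → b ∉ Z → E a v → E b u → E a b
      bis′ {a} {b} a∉ b∉ av bu
        with away-or-attached Z C a∉ (λ a∈ → All.lookup v- a∈ av) | away-or-attached Z C b∉ (λ b∈ → All.lookup u- b∈ bu)
      ... | inj₁ Aa | inj₁ Ab = bis (away⇒∉ Aa) (away⇒∉ Ab) av bu
      ... | inj₂ Sa | inj₁ Ab = attached-complete M Sa Au Ab (E-sym bu) (E-same av uv)
      ... | inj₁ Aa | inj₂ Sb = E-sym (attached-complete M Sb Av Aa (E-sym av) (E-same bu (E-sym uv)))
      ... | inj₂ Sa | inj₂ Sb = attached-joined M Sa Sb Au Av uv av bu

  -- A path with four edges has three pairwise antiadjacent vertices, two of them of one colour. On
  -- a path with three edges the antiadjacent pairs at distance two have a common neighbour, hence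
  -- are strong, and bisimpliciality makes the two middle vertices antiadjacent.
  bisimplicial-evenPair : ∀ {u v} → Bisimplicial [] u v → IsEvenPair T u v
  bisimplicial-evenPair {u} {v} (uv , bis) = long-paths⇒evenPair T uv λ where
      zero p P refl refl → ⊥-elim (adj⇒¬strongAnti T
        (IsPath.adj P (fsuc fzero) (fsuc (fsuc fzero)) refl)
        (bis (λ ()) (λ ())
          (strengthen (IsPath.nonadj P (fsuc fzero) (fsuc (fsuc (fsuc fzero))) (s≤s (s≤s (s≤s z≤n))))
            (IsPath.adj P (fsuc fzero) (fsuc (fsuc fzero)) refl)
            (Adjacent-sym T (IsPath.adj P (fsuc (fsuc fzero)) (fsuc (fsuc (fsuc fzero))) refl)))
          (E-sym (strengthen (IsPath.nonadj P fzero (fsuc (fsuc fzero)) (s≤s (s≤s z≤n)))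
            (IsPath.adj P fzero (fsuc fzero) refl)
            (Adjacent-sym T (IsPath.adj P (fsuc fzero) (fsuc (fsuc fzero)) refl))))))
      (suc k) p P _ _ → ⊥-elim (
        same-colour⇒¬antiadj (≢∧≢⇒≡
          (λ eq → same-colour⇒¬antiadj eq (IsPath.nonadj P fzero (fsuc (fsuc fzero)) (s≤s (s≤s z≤n))))
          (λ eq → same-colour⇒¬antiadj (sym eq)
            (IsPath.nonadj P (fsuc (fsuc fzero)) (fsuc (fsuc (fsuc (fsuc fzero)))) (s≤s (s≤s (s≤s (s≤s z≤n)))))))
        (IsPath.nonadj P fzero (fsuc (fsuc (fsuc (fsuc fzero)))) (s≤s (s≤s z≤n))))
    where
    strengthen : ∀ {a b w} → Antiadjacent T a b → Adjacent T a w → Adjacent T b w → E a b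
    strengthen ab aw bw = ¬adj⇒strongAnti T (proj₁ ab) λ a →
      semi-no-common-neighbour T switch (adj∧antiadj⇒semi T a ab) aw bw

  cobipartite-hasEvenPair : ∀ {u v} → StronglyAntiadjacent T u v → HasEvenPair T
  cobipartite-hasEvenPair {u} {v} uv with bisimplicial-acc [] (<-wellFounded _) (u , v , (λ ()) , (λ ()) , uv)
  ... | u′ , v′ , _ , _ , bis = u′ , v′ , bisimplicial-evenPair bis

  non-neighbours-clique : ∀ {z u v} → u ≢ z → v ≢ z → ¬ Adjacent T z u → ¬ Adjacent T z v → u ≢ v → Adjacent T u v
  non-neighbours-clique {z} u≢z v≢z ¬zu ¬zv u≢v =
    u≢v , inj₁ (same-colour⇒strong u≢v (≢∧≢⇒≡ (differ u≢z ¬zu) (differ v≢z ¬zv)))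
    where
    differ : ∀ {w} → w ≢ z → ¬ Adjacent T z w → c w ≢ c z
    differ w≢z ¬zw eq = ¬zw (w≢z ∘ sym , inj₁ (same-colour⇒strong (w≢z ∘ sym) (sym eq)))

cobipartite-conclusion : ∀ {n} (T : Trigraph n) → NoAntihole T → Bipartite (complement T) →
  (F : InF T) → Conclusion T F
cobipartite-conclusion T noAntihole (c , mono) F@(_ , switch) =
  Sum.map₂ (λ (_ , _ , uv) → cobipartite-hasEvenPair uv) (complete-or-strongAnti T) , disjoint F refl
  where
  open CoBipartite T c mono switch noAntihole
  disjoint : (F : InF T) → proj₂ F ≡ switch → Favorable T F → HasEvenPairDisjoint T F
  disjoint (_ , noSwitch _) _ (_ , (u , v , uv , _) , _) =
    let e , f , even = cobipartite-hasEvenPair uv in e , f , even , (λ ()) , λ ()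
  -- The vertices not adjacent to a given one all have the other colour and form a clique, so a
  -- small component contradicts favorability.
  disjoint (_ , small x y xy _ _) _ (_ , _ , cond) = ⊥-elim ([
    (λ ¬r → ¬r λ u v (u≢ , _ , ¬u) (v≢ , _ , ¬v) → non-neighbours-clique u≢ v≢ ¬u ¬v) ,
    (λ ¬r → ¬r λ u v (_ , u≢ , ¬u) (_ , v≢ , ¬v) → non-neighbours-clique u≢ v≢ ¬u ¬v) ]′ cond)
  -- Both `x` and `y` are antiadjacent to `v`, so they share the other colour, and a colour class is
  -- a strong clique.
  disjoint (_ , light v x y _ vx vy _ _ xy _) _ _ = ⊥-elim (E-colours xy
    (≢∧≢⇒≡ (λ eq → same-colour⇒¬antiadj eq (Antiadjacent-sym T (semi⇒antiadj T vx)))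
            (λ eq → same-colour⇒¬antiadj eq (Antiadjacent-sym T (semi⇒antiadj T vy)))))

-- Complements of line trigraphs

three-members : ∀ {n} {S : Subset n} {x y z} → x ∈ₛ S → y ∈ₛ S → z ∈ₛ S → x ≢ y → x ≢ z → y ≢ z → 3 ≤ ∣ S ∣
three-members {x = x} {y} x∈ y∈ z∈ x≢y x≢z y≢z =
  ℕₚ.≤-trans (s≤s (ℕₚ.≤-trans (s≤s (ℕₚ.≤-trans (s≤s z≤n) (Subsetₚ.x∈p⇒∣p-x∣<∣p∣ z∈″))) (Subsetₚ.x∈p⇒∣p-x∣<∣p∣ y∈′)))
    (Subsetₚ.x∈p⇒∣p-x∣<∣p∣ x∈)
  where
  y∈′ = Subsetₚ.x∈p∧x≢y⇒x∈p-y y∈ (x≢y ∘ sym)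
  z∈″ = Subsetₚ.x∈p∧x≢y⇒x∈p-y (Subsetₚ.x∈p∧x≢y⇒x∈p-y z∈ (x≢z ∘ sym)) (y≢z ∘ sym)

module _ {n : ℕ} (T : Trigraph n) where

  complement-adj⇒antiadj : ∀ {u v} → Adjacent (complement T) u v → Antiadjacent T u v
  complement-adj⇒antiadj {u} {v} (ne , p) with θ T u v
  ... | semi = ne , inj₁ refl
  ... | anti = ne , inj₂ refl
  complement-adj⇒antiadj (ne , inj₁ ()) | strong
  complement-adj⇒antiadj (ne , inj₂ ()) | strong

  complement-antiadj⇒adj : ∀ {u v} → Antiadjacent (complement T) u v → Adjacent T u v
  complement-antiadj⇒adj {u} {v} (ne , p) with θ T u v
  ... | strong = ne , inj₁ refl
  ... | semi   = ne , inj₂ refl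
  complement-antiadj⇒adj (ne , inj₁ ()) | anti
  complement-antiadj⇒adj (ne , inj₂ ()) | anti

  complement-strong⇒anti : ∀ {u v} → StronglyAdjacent (complement T) u v → StronglyAntiadjacent T u v
  complement-strong⇒anti {u} {v} (ne , p) with θ T u v
  ... | anti = ne , refl

  lookup-inducedPath-injective : ∀ {x xs} → InducedPath T x xs → ∀ {i j} →
    lookup (x ∷ xs) i ≡ lookup (x ∷ xs) j → i ≡ j
  lookup-inducedPath-injective {x} {xs} P {i} {j} eq with ℕₚ.<-cmp (toℕ i) (toℕ j)
  ... | tri≈ _ i≡j _ = Finₚ.toℕ-injective i≡j
  ... | tri< lt _ _ = ⊥-elim ([ (λ (_ , a) → proj₁ a eq) , (λ (_ , a) → proj₁ a eq) ]′ (path-pair T P i j lt))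
  ... | tri> _ _ gt = ⊥-elim ([ (λ (_ , a) → proj₁ a (sym eq)) , (λ (_ , a) → proj₁ a (sym eq)) ]′ (path-pair T P j i gt))

  inducedPath-length : ∀ {x xs} → InducedPath T x xs → suc (length xs) ≤ n
  inducedPath-length P = Finₚ.injective⇒≤ (lookup-inducedPath-injective P)

module CoLine {n a b : ℕ} (T : Trigraph n) (noAntihole : NoAntihole T)
  (ε : Fin n → Fin a × Fin b) (ε-inj : ∀ u v → ε u ≡ ε v → u ≡ v)
  (adj⇒share : ∀ u v → u ≢ v → Adjacent (complement T) u v → proj₁ (ε u) ≡ proj₁ (ε v) ⊎ proj₂ (ε u) ≡ proj₂ (ε v))
  (share⇒adj : ∀ u v → u ≢ v → proj₁ (ε u) ≡ proj₁ (ε v) ⊎ proj₂ (ε u) ≡ proj₂ (ε v) → Adjacent (complement T) u v)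
  (cliques : ∀ (S : Subset n) → IsCliqueₛ (complement T) S → 3 ≤ ∣ S ∣ → IsStrongCliqueₛ (complement T) S)
  where

  open Host ε ε-inj

  antiadj⇒endpoint : ∀ {e f} → Antiadjacent T e f → ∃[ c ] (endpoint c e ≡ endpoint c f)
  antiadj⇒endpoint ef = case adj⇒share _ _ (proj₁ ef) (antiadj⇒adj-complement T ef) of λ where
    (inj₁ eq) → true , cong inj₁ eq
    (inj₂ eq) → false , cong inj₂ eq

  antiadj⇒meet : ∀ {e f} → Antiadjacent T e f → ∃[ v ] (Inc e v × Inc f v)
  antiadj⇒meet {e} {f} ef with antiadj⇒endpoint ef
  ... | c , eq = endpoint c e , endpoint-inc c e , subst (Inc f) (sym eq) (endpoint-inc c f)

  meet⇒antiadj : ∀ {e f v} → e ≢ f → Inc e v → Inc f v → Antiadjacent T e f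
  meet⇒antiadj {v = inj₁ _} e≢f p q = complement-adj⇒antiadj T
    (share⇒adj _ _ e≢f (inj₁ (Sumₚ.inj₁-injective (trans (sym p) q))))
  meet⇒antiadj {v = inj₂ _} e≢f p q = complement-adj⇒antiadj T
    (share⇒adj _ _ e≢f (inj₂ (Sumₚ.inj₂-injective (trans (sym p) q))))

  triangle-strong : ∀ {e f g} → Antiadjacent T e f → Antiadjacent T e g → Antiadjacent T f g →
    StronglyAntiadjacent T e f
  triangle-strong {e} {f} {g} ef eg fg =
    complement-strong⇒anti T (cliques S clique
      (three-members e∈ f∈ g∈ (proj₁ ef) (proj₁ eg) (proj₁ fg)) e f e∈ f∈ (proj₁ ef))
    where
    S : Subset n
    S = ⁅ e ⁆ ∪ (⁅ f ⁆ ∪ ⁅ g ⁆)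
    e∈ : e ∈ₛ S
    e∈ = Subsetₚ.x∈p∪q⁺ (inj₁ (Subsetₚ.x∈⁅x⁆ e))
    f∈ : f ∈ₛ S
    f∈ = Subsetₚ.x∈p∪q⁺ (inj₂ (Subsetₚ.x∈p∪q⁺ (inj₁ (Subsetₚ.x∈⁅x⁆ f))))
    g∈ : g ∈ₛ S
    g∈ = Subsetₚ.x∈p∪q⁺ (inj₂ (Subsetₚ.x∈p∪q⁺ (inj₂ (Subsetₚ.x∈⁅x⁆ g))))
    member : ∀ {u} → u ∈ₛ S → u ≡ e ⊎ u ≡ f ⊎ u ≡ g
    member u∈ = Sum.map (Subsetₚ.x∈⁅y⁆⇒x≡y e)
      (Sum.map (Subsetₚ.x∈⁅y⁆⇒x≡y f) (Subsetₚ.x∈⁅y⁆⇒x≡y g) ∘ Subsetₚ.x∈p∪q⁻ ⁅ f ⁆ ⁅ g ⁆)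
      (Subsetₚ.x∈p∪q⁻ ⁅ e ⁆ (⁅ f ⁆ ∪ ⁅ g ⁆) u∈)
    co : ∀ {u v} → Antiadjacent T u v → Adjacent (complement T) u v
    co = antiadj⇒adj-complement T
    co′ : ∀ {u v} → Antiadjacent T u v → Adjacent (complement T) v u
    co′ = antiadj⇒adj-complement T ∘ Antiadjacent-sym T
    clique : IsCliqueₛ (complement T) S
    clique u v u∈ v∈ u≢v with member u∈ | member v∈
    ... | inj₁ refl        | inj₁ refl        = ⊥-elim (u≢v refl)
    ... | inj₁ refl        | inj₂ (inj₁ refl) = co ef
    ... | inj₁ refl        | inj₂ (inj₂ refl) = co eg
    ... | inj₂ (inj₁ refl) | inj₁ refl        = co′ ef
    ... | inj₂ (inj₁ refl) | inj₂ (inj₁ refl) = ⊥-elim (u≢v refl)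
    ... | inj₂ (inj₁ refl) | inj₂ (inj₂ refl) = co fg
    ... | inj₂ (inj₂ refl) | inj₁ refl        = co′ eg
    ... | inj₂ (inj₂ refl) | inj₂ (inj₁ refl) = co′ fg
    ... | inj₂ (inj₂ refl) | inj₂ (inj₂ refl) = ⊥-elim (u≢v refl)

  -- The edge `g` has only two ends; if neither `y` nor `z` uses the one used by `x`, both use the
  -- other.
  claw-free : ∀ {g x y z} → Antiadjacent T g x → Antiadjacent T g y → Antiadjacent T g z →
    x ≢ y → x ≢ z → y ≢ z → ¬ Antiadjacent T x y → ¬ Antiadjacent T x z → Antiadjacent T y z
  claw-free {g} gx gy gz x≢y x≢z y≢z ¬xy ¬xz
    with antiadj⇒meet gx | antiadj⇒meet gy | antiadj⇒meet gz
  ... | u , gu , xu | v , gv , yv | w , gw , zw with side u Boolₚ.≟ side v | side u Boolₚ.≟ side w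
  ...   | yes s | _ = ⊥-elim (¬xy (meet⇒antiadj x≢y xu (subst (Inc _) (inc-same-side gv gu (sym s)) yv)))
  ...   | no _ | yes s = ⊥-elim (¬xz (meet⇒antiadj x≢z xu (subst (Inc _) (inc-same-side gw gu (sym s)) zw)))
  ...   | no s | no s′ = meet⇒antiadj y≢z yv
            (subst (Inc _) (inc-same-side gw gv (≢∧≢⇒≡ (s′ ∘ sym) (s ∘ sym))) zw)

  -- If `g` missed `v`, it would meet the other ends of `e` and `f`. These are on one side, hence
  -- equal, and `e` and `f` would share both ends.
  third-at : ∀ {e f g v} → e ≢ f → Inc e v → Inc f v → Antiadjacent T e g → Antiadjacent T f g → Inc g v
  third-at {e} {f} {g} {v} e≢f ev fv eg fg with antiadj⇒meet eg | antiadj⇒meet fg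
  ... | v₁ , ev₁ , gv₁ | v₂ , fv₂ , gv₂ with side v₁ Boolₚ.≟ side v | side v₂ Boolₚ.≟ side v
  ...   | yes s | _ = subst (Inc g) (inc-same-side ev₁ ev s) gv₁
  ...   | no _ | yes s = subst (Inc g) (inc-same-side fv₂ fv s) gv₂
  ...   | no s | no s′ = ⊥-elim (e≢f (edge-unique (mkEdge ev ev₁ (≢⇒≡not (s ∘ sym))) fv
            (subst (Inc f) (inc-same-side gv₂ gv₁ (≢∧≢⇒≡ s′ s)) fv₂)))

  -- Length four is even, and five edges are impossible: the fifth and sixth vertices, as host
  -- edges, pass through the point where the first and third meet, so with the first they form a
  -- triangle of the complement, which is strong, although they are adjacent.
  short-evenPair : ∀ {e f} → StronglyAntiadjacent T e f →
    (∀ {x y} → Adjacent T e x → Adjacent T x y → Adjacent T y f → Antiadjacent T e y → Antiadjacent T x f → ⊥) →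
    IsEvenPair T e f
  short-evenPair ef no-P₄ = long-paths⇒evenPair T ef λ where
      zero p P refl refl → ⊥-elim (no-P₄
        (IsPath.adj P fzero (fsuc fzero) refl)
        (IsPath.adj P (fsuc fzero) (fsuc (fsuc fzero)) refl)
        (IsPath.adj P (fsuc (fsuc fzero)) (fsuc (fsuc (fsuc fzero))) refl)
        (IsPath.nonadj P fzero (fsuc (fsuc fzero)) (s≤s (s≤s z≤n)))
        (IsPath.nonadj P (fsuc fzero) (fsuc (fsuc (fsuc fzero))) (s≤s (s≤s (s≤s z≤n)))))
      (suc zero) p _ _ _ → refl
      (suc (suc k)) p P _ _ → ⊥-elim (no-P₆ k p P)
    where
    no-P₆ : ∀ k (p : Fin (6 + k) → Fin n) → IsPath T p → ⊥
    no-P₆ k p P = adj⇒¬strongAnti T (adj i₄ i₅ refl)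
        (triangle-strong (meet⇒antiadj (proj₁ (adj i₄ i₅ refl)) at₄ at₅) (Antiadjacent-sym T a₀₄) (Antiadjacent-sym T a₀₅))
      where
      open IsPath P
      i₂ i₄ i₅ : Fin (6 + k)
      i₂ = fsuc (fsuc fzero)
      i₄ = fsuc (fsuc (fsuc (fsuc fzero)))
      i₅ = fsuc (fsuc (fsuc (fsuc (fsuc fzero))))
      a₀₂ = nonadj fzero i₂ (s≤s (s≤s z≤n))
      a₀₄ = nonadj fzero i₄ (s≤s (s≤s z≤n))
      a₀₅ = nonadj fzero i₅ (s≤s (s≤s z≤n))
      a₂₄ = nonadj i₂ i₄ (s≤s (s≤s (s≤s (s≤s z≤n))))
      a₂₅ = nonadj i₂ i₅ (s≤s (s≤s (s≤s (s≤s z≤n))))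
      at₄ = let v , i , j = antiadj⇒meet a₀₂ in third-at (proj₁ a₀₂) i j a₀₄ a₂₄
      at₅ = let v , i , j = antiadj⇒meet a₀₂ in third-at (proj₁ a₀₂) i j a₀₅ a₂₅

  -- Complements of line trigraphs without switchable pairs

  module NoSwitch (no-semi : ∀ u v → ¬ Semiadjacent T u v) where

    adj⇒¬antiadj : ∀ {u v} → Adjacent T u v → ¬ Antiadjacent T u v
    adj⇒¬antiadj a s = no-semi _ _ (adj∧antiadj⇒semi T a s)

    private
      T̄ = complement T
      co : ∀ {u v} → Antiadjacent T u v → Adjacent T̄ u v
      co = antiadj⇒adj-complement T
      co⁻ : ∀ {u v} → Adjacent T u v → Antiadjacent T̄ u v
      co⁻ = adj⇒antiadj-complement T

    data FirstNeighbour (w y : Fin n) (ys : List (Fin n)) : Set where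
      none  : All (Antiadjacent T̄ w) (y ∷ ys) → FirstNeighbour w y ys
      first : Adjacent T̄ w y → FirstNeighbour w y ys
      later : ∀ pre {g post} → ys ≡ pre ++ g ∷ post → All (Antiadjacent T̄ w) (y ∷ pre) → Adjacent T̄ w g →
              FirstNeighbour w y ys

    first-neighbour : ∀ {w} y ys → w ∉ y ∷ ys → FirstNeighbour w y ys
    first-neighbour {w} y ys w∉ with antiadjacent? T w y
    ... | yes a = first (co a)
    ... | no ¬a with ys
    ...   | [] = none (co⁻ (¬antiadj⇒adj T (w∉ ∘ here) ¬a) ∷ [])
    ...   | z ∷ zs with first-neighbour z zs (w∉ ∘ there)
    ...     | none all = none (co⁻ (¬antiadj⇒adj T (w∉ ∘ here) ¬a) ∷ all)
    ...     | first g = later [] refl (co⁻ (¬antiadj⇒adj T (w∉ ∘ here) ¬a) ∷ []) g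
    ...     | later pre eq all g = later (z ∷ pre) (cong (z ∷_) eq) (co⁻ (¬antiadj⇒adj T (w∉ ∘ here) ¬a) ∷ all) g

    inducedPath-prefix : ∀ {x} pre {g post} → InducedPath T̄ x (pre ++ g ∷ post) → InducedPath T̄ x (pre ++ [ g ])
    inducedPath-prefix []        (step e _ _) = step e [] end
    inducedPath-prefix (y ∷ pre) (step e all P) =
      step e (Allₚ.++⁺ (Allₚ.++⁻ˡ pre all) (All.head (Allₚ.++⁻ʳ pre all) ∷ [])) (inducedPath-prefix pre P)

    adjacentToLast : ∀ {w pre g} → All (Antiadjacent T̄ w) pre → Adjacent T̄ w g → AdjacentToLast T̄ w (pre ++ [ g ])
    adjacentToLast []       e = final e
    adjacentToLast (a ∷ as) e = skip a (adjacentToLast as e)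

    long : ∀ (pre : List (Fin n)) {g} → 1 ≤ length (pre ++ [ g ])
    long []      = s≤s z≤n
    long (_ ∷ _) = s≤s z≤n

    Longer : ℕ → Set
    Longer k = ∃[ x ] ∃[ xs ] (InducedPath T̄ x xs × length xs ≡ suc k)

    -- Here e₀ z w e₁ is a path of T. In the complement either w extends e₀ e₁ … or, as there is
    -- no hole, w sees the third vertex y of the path, and then z extends e₁ e₀ w followed by the part after y.
    module Reroute {e₀ e₁ w z : Fin n}
      (zw : Adjacent T z w) (e₀z : Adjacent T e₀ z) (we₁ : Adjacent T w e₁)
      (e₀w : Antiadjacent T e₀ w) (ze₁ : Antiadjacent T z e₁) where

      private
        we₀ = Antiadjacent-sym T e₀w

      not-on : ∀ {u v ys} → Antiadjacent T u v → All (Antiadjacent T̄ v) ys → u ∉ ys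
      not-on uv all u∈ = adj⇒¬antiadj (complement-antiadj⇒adj T (All.lookup all u∈)) (Antiadjacent-sym T uv)

      -- The first neighbour of `z` on `ys` in the complement would close a hole through `e₁`, `e₀`
      -- and `w`.
      extend-z : ∀ ys → InducedPath T̄ w ys → All (Antiadjacent T̄ e₀) ys → All (Antiadjacent T̄ e₁) ys →
        Adjacent T̄ e₀ e₁ → InducedPath T̄ z (e₁ ∷ e₀ ∷ w ∷ ys)
      extend-z ys P none₀ none₁ e₀e₁ =
        step (co ze₁) (co⁻ (Adjacent-sym T e₀z) ∷ co⁻ zw ∷ z-none ys P none₀ none₁) (route P none₀ none₁)
        where
        route : ∀ {ys} → InducedPath T̄ w ys → All (Antiadjacent T̄ e₀) ys → All (Antiadjacent T̄ e₁) ys →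
          InducedPath T̄ e₁ (e₀ ∷ w ∷ ys)
        route P none₀ none₁ = step (Adjacent-sym T̄ e₀e₁) (co⁻ (Adjacent-sym T we₁) ∷ none₁) (step (co e₀w) none₀ P)
        closing : ∀ pre {g post} → InducedPath T̄ w (pre ++ g ∷ post) → All (Antiadjacent T̄ e₀) (pre ++ g ∷ post) →
          All (Antiadjacent T̄ e₁) (pre ++ g ∷ post) → All (Antiadjacent T̄ z) pre → Adjacent T̄ z g → ⊥
        closing pre P none₀ none₁ all zg = noAntihole _ _ (hole T̄
          (inducedPath-prefix (e₀ ∷ w ∷ pre) (route P none₀ none₁))
          (co ze₁) (skip (co⁻ (Adjacent-sym T e₀z)) (skip (co⁻ zw) (adjacentToLast all zg)))
          (s≤s (s≤s (s≤s (long pre)))))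
        z-none : ∀ ys → InducedPath T̄ w ys → All (Antiadjacent T̄ e₀) ys → All (Antiadjacent T̄ e₁) ys →
          All (Antiadjacent T̄ z) ys
        z-none [] _ _ _ = []
        z-none (y ∷ ys) P none₀ none₁ with first-neighbour y ys (not-on ze₁ none₁)
        ... | none all = all
        ... | first zy = ⊥-elim (closing [] P none₀ none₁ [] zy)
        ... | later pre refl all zg = ⊥-elim (closing (y ∷ pre) P none₀ none₁ all zg)

      longer : ∀ ys → InducedPath T̄ e₀ (e₁ ∷ ys) → Longer (suc (length ys))
      longer [] (step e₀e₁ _ _) = _ , _ , step (co we₀) (co⁻ we₁ ∷ []) (step e₀e₁ [] end) , refl
      longer (y ∷ ys) P@(step e₀e₁ none₀ P₁) with first-neighbour y ys (not-on we₀ none₀)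
      ... | none all = _ , _ , step (co we₀) (co⁻ we₁ ∷ all) P , refl
      ... | later pre refl all wg = ⊥-elim (noAntihole _ _ (hole T̄
              (inducedPath-prefix (e₁ ∷ y ∷ pre) P) (co we₀) (skip (co⁻ we₁) (adjacentToLast all wg))
              (s≤s (s≤s (s≤s (long pre))))))
      ... | first wy with P₁ | none₀
      ...   | step e₁y none₁ P₂ | e₀y ∷ none₀′ =
              _ , _ , extend-z ys (past ys P₂ none₁ none₀′) none₀′ none₁ e₀e₁ , refl
        where
        yw = Antiadjacent-sym T (complement-adj⇒antiadj T wy)
        -- In the complement `w` can replace `y`. The claw at `y` with leaves `e₁`, `w`, `x` forces
        -- `w` to see `x`; a later neighbour `v` of `w` would give the claw at `w` with leaves `e₀`,
        -- `y`, `v`.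
        past : ∀ ys → InducedPath T̄ y ys → All (Antiadjacent T̄ e₁) ys → All (Antiadjacent T̄ e₀) ys → InducedPath T̄ w ys
        past [] _ _ _ = end
        past (x ∷ xs) (step yx noneY P₃) (e₁x ∷ _) (e₀x ∷ none₀″) =
          step (co (claw-free (Antiadjacent-sym T (complement-adj⇒antiadj T e₁y)) yw (complement-adj⇒antiadj T yx)
                 (proj₁ (Adjacent-sym T we₁)) (proj₁ e₁x) (λ { refl → not-on we₀ (e₀x ∷ none₀″) (here refl) })
                 (adj⇒¬antiadj (Adjacent-sym T we₁)) (adj⇒¬antiadj (complement-antiadj⇒adj T e₁x))))
            (All.tabulate λ {v} v∈ → co⁻ (¬antiadj⇒adj T (λ { refl → not-on we₀ (e₀x ∷ none₀″) (there v∈) }) λ wv →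
              adj⇒¬antiadj (complement-antiadj⇒adj T (All.lookup noneY v∈))
                (claw-free we₀ (Antiadjacent-sym T yw) wv
                  (proj₁ e₀y) (proj₁ (All.lookup none₀″ v∈)) (proj₁ (All.lookup noneY v∈))
                  (adj⇒¬antiadj (complement-antiadj⇒adj T e₀y))
                  (adj⇒¬antiadj (complement-antiadj⇒adj T (All.lookup none₀″ v∈))))))
            P₃

    -- An induced path has at most `n` vertices and each rerouting adds one; `fuel` bounds how many
    -- can still be added.
    grow : ∀ fuel {e₀ e₁ ys} → InducedPath T̄ e₀ (e₁ ∷ ys) → n ≤ fuel + suc (suc (length ys)) → HasEvenPair T
    grow fuel {e₀} {e₁} {ys} P@(step e₀e₁ _ _) n≤
      with Finₚ.any? (λ z → Finₚ.any? (λ w → (adjacent? T e₀ z ×-dec (adjacent? T z w ×-dec adjacent? T w e₁))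
                                             ×-dec (antiadjacent? T e₀ w ×-dec antiadjacent? T z e₁)))
    ... | no free = e₀ , e₁ , short-evenPair
            (¬adj⇒strongAnti T (proj₁ e₀e₁) (λ a → adj⇒¬antiadj a (complement-adj⇒antiadj T e₀e₁)))
            (λ e₀x xy ye₁ e₀y xe₁ → free (_ , _ , (e₀x , xy , ye₁) , e₀y , xe₁))
    ... | yes (z , w , (e₀z , zw , we₁) , e₀w , ze₁) with Reroute.longer zw e₀z we₁ e₀w ze₁ ys P
    ...   | x , y ∷ xs , Q , eq with fuel
    ...     | zero = ⊥-elim (ℕₚ.<-irrefl refl (ℕₚ.≤-trans (subst (λ k → suc k ≤ n) eq (inducedPath-length T̄ Q)) n≤))
    ...     | suc fuel′ = grow fuel′ Q (subst (n ≤_)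
                (trans (sym (ℕₚ.+-suc fuel′ _)) (cong (λ k → fuel′ + suc k) (sym eq))) n≤)

    hasEvenPair : ∀ {u v} → StronglyAntiadjacent T u v → HasEvenPair T
    hasEvenPair {u} {v} uv = grow n (step (co (strongAnti⇒antiadj T uv)) [] end) (ℕₚ.m≤m+n n 2)

  -- Complements of line trigraphs with a small switchable component

  module Small {x y : Fin n} (xy : Semiadjacent T x y) (only : OnlySemi1 T x y)
    (noCommon : ∀ w → Adjacent T x w → Adjacent T y w → ⊥) (c : Bool) (meet : endpoint c x ≡ endpoint c y) where

    A B p : V
    p = endpoint c x
    A = endpoint (not c) x
    B = endpoint (not c) y

    A≢B : A ≢ B
    A≢B eq = proj₁ xy (endpoints-injective c meet eq)

    not-at-p : ∀ {w} → w ≢ x → w ≢ y → ¬ Inc w p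
    not-at-p {w} w≢x w≢y i = adj⇒¬strongAnti T (semi⇒adj T xy) (triangle-strong (semi⇒antiadj T xy)
      (meet⇒antiadj (w≢x ∘ sym) (endpoint-inc c x) i)
      (meet⇒antiadj (w≢y ∘ sym) (subst (Inc y) (sym meet) (endpoint-inc c y)) i))

    antiadj-x : ∀ {w} → w ≢ x → w ≢ y → Antiadjacent T x w → Inc w A
    antiadj-x {w} w≢x w≢y a with antiadj⇒meet a
    ... | v , i , j with inc-cases (edge-ends c x) i
    ...   | inj₁ refl = ⊥-elim (not-at-p w≢x w≢y j)
    ...   | inj₂ refl = j

    antiadj-y : ∀ {w} → w ≢ x → w ≢ y → Antiadjacent T y w → Inc w B
    antiadj-y {w} w≢x w≢y a with antiadj⇒meet a
    ... | v , i , j with inc-cases (edge-ends c y) i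
    ...   | inj₁ refl = ⊥-elim (not-at-p w≢x w≢y (subst (Inc w) (sym meet) j))
    ...   | inj₂ refl = j

    -- As `x` and `y` have no common neighbour, every other vertex is antiadjacent to one of them.
    -- As host edges the two then meet, and not at `p`, since a third edge there would make the pair
    -- `x y` strong.
    at-ends : ∀ w → Inc w A ⊎ Inc w B
    at-ends w with w Finₚ.≟ x | w Finₚ.≟ y
    ... | yes refl | _ = inj₁ (endpoint-inc (not c) x)
    ... | _ | yes refl = inj₂ (endpoint-inc (not c) y)
    ... | no w≢x | no w≢y with antiadjacent? T x w | antiadjacent? T y w
    ...   | yes a | _ = inj₁ (antiadj-x w≢x w≢y a)
    ...   | _ | yes a = inj₂ (antiadj-y w≢x w≢y a)
    ...   | no ¬a | no ¬b = ⊥-elim (noCommon w (¬antiadj⇒adj T (w≢x ∘ sym) ¬a) (¬antiadj⇒adj T (w≢y ∘ sym) ¬b))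

    not-both-at : ∀ {K} → K ≡ A ⊎ K ≡ B → Inc x K → ¬ Inc y K
    not-both-at (inj₁ refl) _ j = A≢B (inc-same-side j (endpoint-inc (not c) y)
      (trans (side-endpoint (not c) x) (sym (side-endpoint (not c) y))))
    not-both-at (inj₂ refl) i _ = A≢B (inc-same-side (endpoint-inc (not c) x) i
      (trans (side-endpoint (not c) x) (sym (side-endpoint (not c) y))))

    ¬adj-at : ∀ {K e f} → K ≡ A ⊎ K ≡ B → Inc e K → Inc f K → ¬ Adjacent T e f
    ¬adj-at K∈ i j a with only _ _ (adj∧antiadj⇒semi T a (meet⇒antiadj (proj₁ a) i j))
    ... | inj₁ (refl , refl) = not-both-at K∈ i j
    ... | inj₂ (refl , refl) = not-both-at K∈ j i

    -- The inner vertices of a path with three edges are adjacent to `e` or `f` and so miss `K`;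
    -- both pass through `K′` and cannot be adjacent.
    evenPair-at : ∀ {K K′ e f} → K ≡ A ⊎ K ≡ B → K′ ≡ A ⊎ K′ ≡ B → (∀ w → Inc w K ⊎ Inc w K′) →
      e ≢ f → Inc e K → Inc f K → IsEvenPair T e f
    evenPair-at K∈ K′∈ ends e≢f i j = short-evenPair (¬adj⇒strongAnti T e≢f (¬adj-at K∈ i j))
      (λ {u} {w} eu uw wf _ _ → ¬adj-at K′∈
        ([ (λ k → ⊥-elim (¬adj-at K∈ i k eu)) , id ]′ (ends u))
        ([ (λ k → ⊥-elim (¬adj-at K∈ k j wf)) , id ]′ (ends w)) uw)

    at-A : ∀ {e f} → e ≢ f → Inc e A → Inc f A → IsEvenPair T e f
    at-A = evenPair-at (inj₁ refl) (inj₂ refl) at-ends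

    at-B : ∀ {e f} → e ≢ f → Inc e B → Inc f B → IsEvenPair T e f
    at-B = evenPair-at (inj₂ refl) (inj₁ refl) (Sum.swap ∘ at-ends)

    mixed : ∀ {u v} → StronglyAntiadjacent T u v → Inc u A → Inc v B → HasEvenPair T
    mixed {u} {v} uv i j with u Finₚ.≟ x | v Finₚ.≟ y
    ... | no u≢x | _ = u , x , at-A u≢x i (endpoint-inc (not c) x)
    ... | yes _ | no v≢y = v , y , at-B v≢y j (endpoint-inc (not c) y)
    ... | yes refl | yes refl = ⊥-elim (adj⇒¬strongAnti T (semi⇒adj T xy) uv)

    hasEvenPair : ∀ {u v} → StronglyAntiadjacent T u v → HasEvenPair T
    hasEvenPair {u} {v} uv with at-ends u | at-ends v
    ... | inj₁ i | inj₁ j = u , v , at-A (proj₁ uv) i j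
    ... | inj₂ i | inj₂ j = u , v , at-B (proj₁ uv) i j
    ... | inj₁ i | inj₂ j = mixed uv i j
    ... | inj₂ i | inj₁ j = mixed (StronglyAntiadjacent-sym T uv) j i

    disjoint : ¬ RestCliqueSmall T x y x ⊎ ¬ RestCliqueSmall T x y y →
      ∃[ u ] ∃[ v ] (IsEvenPair T u v × ¬ (u ≡ x ⊎ u ≡ y) × ¬ (v ≡ x ⊎ v ≡ y))
    disjoint (inj₁ ¬rest) with RestCliqueSmall-or-pair T x y x
    ... | inj₁ rest = ⊥-elim (¬rest rest)
    ... | inj₂ (u , v , uv , (u≢x , u≢y , ¬u) , (v≢x , v≢y , ¬v)) = u , v ,
            at-A (proj₁ uv) (antiadj-x u≢x u≢y (¬adj⇒antiadj T (u≢x ∘ sym) ¬u))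
                            (antiadj-x v≢x v≢y (¬adj⇒antiadj T (v≢x ∘ sym) ¬v)) ,
            [ u≢x , u≢y ]′ , [ v≢x , v≢y ]′
    disjoint (inj₂ ¬rest) with RestCliqueSmall-or-pair T x y y
    ... | inj₁ rest = ⊥-elim (¬rest rest)
    ... | inj₂ (u , v , uv , (u≢x , u≢y , ¬u) , (v≢x , v≢y , ¬v)) = u , v ,
            at-B (proj₁ uv) (antiadj-y u≢x u≢y (¬adj⇒antiadj T (u≢y ∘ sym) ¬u))
                            (antiadj-y v≢x v≢y (¬adj⇒antiadj T (v≢y ∘ sym) ¬v)) ,
            [ u≢x , u≢y ]′ , [ v≢x , v≢y ]′

coline-conclusion : ∀ {n} (T : Trigraph n) → NoAntihole T → LineTrigraph (complement T) →
  (F : InF T) → Conclusion T F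
coline-conclusion T noAntihole ((_ , _ , ε , inj , to , from) , cliques) = conclude
  where
  open CoLine T noAntihole ε inj to from cliques
  conclude : (F : InF T) → Conclusion T F
  conclude (_ , noSwitch none) =
    Sum.map₂ (λ (_ , _ , uv) → NoSwitch.hasEvenPair none uv) (complete-or-strongAnti T) ,
    λ (_ , (_ , _ , uv , _) , _) → let e , f , even = NoSwitch.hasEvenPair none uv in e , f , even , (λ ()) , λ ()
  conclude (_ , small x y xy only common) with antiadj⇒endpoint (semi⇒antiadj T xy)
  ... | c , meet = Sum.map₂ (λ (_ , _ , uv) → hasEvenPair uv) (complete-or-strongAnti T) ,
                   λ (_ , _ , cond) → disjoint cond
    where open Small xy only common c meet
  -- In the complement `v`, `x`, `y` form a clique of size three containing switchable pairs.
  conclude (_ , light v x y _ vx vy _ _ xy _) = ⊥-elim (adj⇒¬strongAnti T (semi⇒adj T vx)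
    (triangle-strong (semi⇒antiadj T vx) (semi⇒antiadj T vy) (strongAnti⇒antiadj T xy)))

theorem4p1 : ∀ {n : ℕ} (T : Trigraph n) (F : InF T) →
    Basic T → NoOddPrism T → NoAntihole T →
    (IsComplete T ⊎ HasEvenPair T) × (Favorable T F → HasEvenPairDisjoint T F)
theorem4p1 T F (inj₁ bipartite) _ _ = bipartite-conclusion T bipartite F
theorem4p1 T F (inj₂ (inj₁ cobipartite)) _ noAntihole = cobipartite-conclusion T noAntihole cobipartite F
theorem4p1 T F (inj₂ (inj₂ (inj₁ line))) noOddPrism _ = line-conclusion T noOddPrism line F
theorem4p1 T F (inj₂ (inj₂ (inj₂ (inj₁ coline)))) _ noAntihole = coline-conclusion T noAntihole coline F
theorem4p1 T F (inj₂ (inj₂ (inj₂ (inj₂ doubled)))) _ noAntihole = doubled-conclusion T noAntihole doubled F
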